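{- Let $g:\mathbb{C}\to\mathbb{C}$ be holomorphic at $0$ with $g(0)=0$ and $g'(0)\neq 0$, let $\varphi:\mathbb{N}\to\mathbb{C}\setminus\{0\}$, and let $a$ be a real number. Let $(P_n(x))_{n\ge 0}$ be a sequence of Appell polynomials of type $(g,\varphi)$ with generating function $f$, i.e. $f$ is holomorphic at $0$, $f(0)\neq 0$, and $$\sum_{n\ge 0}P_n(x)\frac{t^n}{\varphi(0)\varphi(1)\cdots\varphi(n)}=f(t)e^{x g(t)}$$ for all $x\in\mathbb{C}$ and all $t$ near $0$. Put $h(t)=f(t)e^{\frac{a}{2}g(t)}$. Then $P_n(a-x)=(-1)^nP_n(x)$ for all $n\ge 0$ and all $x$ if and only if $g$ is an odd function and $h$ is an even function (near $0$).
   Context: Here $\mathbb{N}=\{0,1,2,\dots\}$. A sequence of polynomials $(P_n)_n$ is called a sequence of Appell polynomials of type $(g,\varphi)$ if there exists a function $f$ holomorphic at $0$ with $f(0)\neq0$ (its generating function) such that the displayed generating-function identity holds. -}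

module Defs where

open import Data.Nat as ℕ using (ℕ; zero; suc; _!)
open import Data.Nat.Properties using (_!≢0)
import Data.Nat.Properties as ℕ
open import Data.Integer as ℤ using (+_; -[1+_])
import Data.Integer.Properties as ℤ
open import Data.Rational as ℚ using (ℚ; 0ℚ; 1ℚ; ½)
import Data.Rational.Properties as ℚ
import Data.Rational.Unnormalised as ℚᵘ
import Data.Rational.Unnormalised.Properties as ℚᵘ
open import Data.Rational.Solver using (module +-*-Solver)
open import Data.List using (List; []; _∷_)
open import Data.Product using (∃; _×_; _,_; proj₁; proj₂)
open import Data.Sum using (inj₁; inj₂; [_,_]′)
open import Relation.Nullary using (¬_; yes; no; contradiction)
open import Relation.Binary.PropositionalEquality
  using (_≡_; refl; sym; trans; cong; cong₂; subst; subst₂; module ≡-Reasoning)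

------------------------------------------------------------------------
-- Auxiliary facts about ℚ

module RationalLemmas where

  open import Data.Rational using (_+_; _*_; _-_; -_; _<_; _≤_; ∣_∣; _/_)
  open +-*-Solver

  half-pos : ∀ {ε} → 0ℚ < ε → 0ℚ < ½ * ε
  half-pos {ε} 0<ε = subst (_< ½ * ε) (ℚ.*-zeroʳ ½) (ℚ.*-monoʳ-<-pos ½ 0<ε)

  half+half : ∀ ε → ½ * ε + ½ * ε ≡ ε
  half+half ε = trans (sym (ℚ.*-distribʳ-+ ε ½ ½)) (ℚ.*-identityˡ ε)

  sum-< : ∀ {a b ε} → a < ½ * ε → b < ½ * ε → a + b < ε
  sum-< {ε = ε} p q = subst (_ <_) (half+half ε) (ℚ.+-mono-< p q)

  triangle : ∀ a b c → ∣ a - c ∣ ≤ ∣ a - b ∣ + ∣ b - c ∣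
  triangle a b c = subst (λ z → ∣ z ∣ ≤ ∣ a - b ∣ + ∣ b - c ∣)
    (solve 3 (λ a b c → (a :- b) :+ (b :- c) := a :- c) refl a b c)
    (ℚ.∣p+q∣≤∣p∣+∣q∣ (a - b) (b - c))

  dist-sym : ∀ a b → ∣ a - b ∣ ≡ ∣ b - a ∣
  dist-sym a b = trans (sym (ℚ.∣-p∣≡∣p∣ (a - b)))
    (cong ∣_∣ (solve 2 (λ a b → :- (a :- b) := b :- a) refl a b))

  near-trans : ∀ {a b c ε} → ∣ a - b ∣ < ½ * ε → ∣ b - c ∣ < ½ * ε → ∣ a - c ∣ < ε
  near-trans {a} {b} {c} p q = ℚ.≤-<-trans (triangle a b c) (sum-< p q)

  dist-0 : ∀ a {ε} → 0ℚ < ε → ∣ a - a ∣ < ε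
  dist-0 a 0<ε = subst (_< _) (cong ∣_∣ (sym (ℚ.+-inverseʳ a))) 0<ε

  *-monoˡ : ∀ {a b c} → 0ℚ ≤ c → a ≤ b → a * c ≤ b * c
  *-monoˡ {c = c} 0≤c = ℚ.*-monoʳ-≤-nonNeg c {{ℚ.nonNegative 0≤c}}

  *-monoʳ : ∀ {a b c} → 0ℚ ≤ c → a ≤ b → c * a ≤ c * b
  *-monoʳ {c = c} 0≤c = ℚ.*-monoˡ-≤-nonNeg c {{ℚ.nonNegative 0≤c}}

  *-mono : ∀ {a b c d} → 0ℚ ≤ b → 0ℚ ≤ c → a ≤ b → c ≤ d → a * c ≤ b * d
  *-mono 0≤b 0≤c p q = ℚ.≤-trans (*-monoˡ 0≤c p) (*-monoʳ 0≤b q)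

  *-pos : ∀ {a b} → 0ℚ < a → 0ℚ < b → 0ℚ < a * b
  *-pos {a} {b} p q =
    subst (_< a * b) (ℚ.*-zeroʳ a) (ℚ.*-monoʳ-<-pos a {{ℚ.positive p}} q)

  *-nonNeg : ∀ {a b} → 0ℚ ≤ a → 0ℚ ≤ b → 0ℚ ≤ a * b
  *-nonNeg {a} {b} p q = subst (_≤ a * b) (ℚ.*-zeroʳ a) (*-monoʳ p q)

  inv : ℚ → ℚ
  inv p with p ℚ.≟ 0ℚ
  ... | yes _   = 0ℚ
  ... | no  p≢0 = ℚ.1/_ p {{ℚ.≢-nonZero p≢0}}

  inv-inverse : ∀ {p} → 0ℚ < p → p * inv p ≡ 1ℚ
  inv-inverse {p} 0<p with p ℚ.≟ 0ℚ
  ... | yes p≡0 = contradiction (sym p≡0) (ℚ.<⇒≢ 0<p)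
  ... | no  p≢0 = ℚ.*-inverseʳ p {{ℚ.≢-nonZero p≢0}}

  inv-pos : ∀ {p} → 0ℚ < p → 0ℚ < inv p
  inv-pos {p} 0<p with inv p ℚ.≤? 0ℚ
  ... | no  q≰0 = ℚ.≰⇒> q≰0
  ... | yes q≤0 = contradiction
    (subst₂ _≤_ (inv-inverse 0<p) (ℚ.*-zeroʳ p) (*-monoʳ (ℚ.<⇒≤ 0<p) q≤0))
    (λ 1≤0 → ℚ.<-irrefl refl (ℚ.<-≤-trans (ℚ.positive⁻¹ 1ℚ) 1≤0))

  inv-anti : ∀ {p q} → 0ℚ < p → p ≤ q → inv q ≤ inv p
  inv-anti {p} {q} 0<p p≤q = subst₂ _≤_ eq₁ eq₂
      (*-monoʳ {c = inv q * inv p}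
        (*-nonNeg (ℚ.<⇒≤ (inv-pos 0<q)) (ℚ.<⇒≤ (inv-pos 0<p))) p≤q)
    where
    0<q : 0ℚ < q
    0<q = ℚ.<-≤-trans 0<p p≤q
    eq₁ : inv q * inv p * p ≡ inv q
    eq₁ = trans (solve 3 (λ x y z → x :* y :* z := x :* (z :* y)) refl (inv q) (inv p) p)
          (trans (cong (inv q *_) (inv-inverse 0<p)) (ℚ.*-identityʳ _))
    eq₂ : inv q * inv p * q ≡ inv p
    eq₂ = trans (solve 3 (λ x y z → x :* y :* z := y :* (z :* x)) refl (inv q) (inv p) q)
          (trans (cong (inv p *_) (inv-inverse 0<q)) (ℚ.*-identityʳ _))

  -- η · (1/B) is the standard bound making a product with something ≤ B small.
  prod-< : ∀ {a b B η} → 0ℚ < B → ∣ a ∣ ≤ B → ∣ b ∣ < η * inv B → ∣ a * b ∣ < η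
  prod-< {a} {b} {B} {η} 0<B p q = ℚ.≤-<-trans
    (subst (_≤ B * ∣ b ∣) (sym (ℚ.∣p*q∣≡∣p∣*∣q∣ a b)) (*-monoˡ (ℚ.0≤∣p∣ b) p))
    (subst (B * ∣ b ∣ <_)
      (trans (solve 3 (λ x y z → x :* (y :* z) := y :* (x :* z)) refl B η (inv B))
        (trans (cong (η *_) (inv-inverse 0<B)) (ℚ.*-identityʳ η)))
      (ℚ.*-monoʳ-<-pos B {{ℚ.positive 0<B}} q))

  ratio : ℕ → ℚ
  ratio n = + n / 1

  private
    ratioᵘ : ∀ n → ℚ.toℚᵘ (ratio n) ℚᵘ.≃ (+ n ℚᵘ./ 1)
    ratioᵘ n = ℚ.toℚᵘ-fromℚᵘ (ℚᵘ.mkℚᵘ (+ n) 0)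

  ratio-suc : ∀ n → ratio (suc n) ≡ 1ℚ + ratio n
  ratio-suc n = ℚ.toℚᵘ-injective (ℚᵘ.≃-trans (ratioᵘ (suc n)) (ℚᵘ.≃-sym
    (ℚᵘ.≃-trans (ℚ.toℚᵘ-homo-+ 1ℚ (ratio n))
      (ℚᵘ.≃-trans (ℚᵘ.+-congʳ (ℚ.toℚᵘ 1ℚ) (ratioᵘ n))
        (ℚᵘ.*≡* (cong (λ m → (+ 1 ℤ.+ m) ℤ.* + 1) (ℤ.*-identityʳ (+ n))))))))

  ratio-nonNeg : ∀ n → 0ℚ ≤ ratio n
  ratio-nonNeg zero    = ℚ.≤-refl
  ratio-nonNeg (suc n) = subst (0ℚ ≤_) (sym (ratio-suc n))
    (ℚ.+-mono-≤ {0ℚ} {1ℚ} (ℚ.nonNegative⁻¹ 1ℚ) (ratio-nonNeg n))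

  ratio-pos : ∀ n → 0ℚ < ratio (suc n)
  ratio-pos n = subst (0ℚ <_) (sym (ratio-suc n))
    (ℚ.+-mono-<-≤ {0ℚ} {1ℚ} (ℚ.positive⁻¹ 1ℚ) (ratio-nonNeg n))

  ratio-step : ∀ n → ratio n ≤ ratio (suc n)
  ratio-step n = subst₂ _≤_ (ℚ.+-identityˡ _) (sym (ratio-suc n))
    (ℚ.+-monoˡ-≤ (ratio n) (ℚ.nonNegative⁻¹ 1ℚ))

  ratio-mono : ∀ {m n} → m ℕ.≤ n → ratio m ≤ ratio n
  ratio-mono {m} {n} m≤n = go {m} {n} (ℕ.≤⇒≤′ m≤n)
    where
    go : ∀ {m n} → m ℕ.≤′ n → ratio m ≤ ratio n
    go (ℕ.≤′-reflexive refl)  = ℚ.≤-refl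
    go {m} (ℕ.≤′-step {n} p)  = ℚ.≤-trans (go {m} {n} p) (ratio-step n)

  archimedean : ∀ q → ∃ λ n → q < ratio n
  archimedean q@(ℚ.mkℚ (+ m) d _) = suc m , ℚ.toℚᵘ-cancel-<
    (ℚᵘ.<-respʳ-≃ (ℚᵘ.≃-sym (ratioᵘ (suc m)))
      (ℚᵘ.*<* (subst₂ ℤ._<_ (ℤ.pos-* m 1) (ℤ.pos-* (suc m) (suc d))
        (ℤ.+<+ (subst (ℕ._< suc m ℕ.* suc d) (sym (ℕ.*-identityʳ m))
          (ℕ.<-≤-trans (ℕ.n<1+n m) (ℕ.m≤m*n (suc m) (suc d))))))))
  archimedean q@(ℚ.mkℚ -[1+ m ] d _) = 0 , ℚ.negative⁻¹ q

  invFact : ℕ → ℚ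
  invFact k = _/_ (+ 1) (k !) {{k !≢0}}

  private
    frac : ∀ a b .{{_ : ℕ.NonZero a}} .{{_ : ℕ.NonZero b}} .{{_ : ℕ.NonZero (a ℕ.* b)}} →
           (+ 1 / (a ℕ.* b)) * ratio a ≡ + 1 / b
    frac (suc a) (suc b) = ℚ.toℚᵘ-injective (begin
      ℚ.toℚᵘ ((+ 1 / (suc a ℕ.* suc b)) * ratio (suc a))
        ≈⟨ ℚ.toℚᵘ-homo-* (+ 1 / (suc a ℕ.* suc b)) (ratio (suc a)) ⟩
      ℚ.toℚᵘ (+ 1 / (suc a ℕ.* suc b)) ℚᵘ.* ℚ.toℚᵘ (ratio (suc a))
        ≈⟨ ℚᵘ.*-cong (ℚ.toℚᵘ-fromℚᵘ (ℚᵘ.mkℚᵘ (+ 1) (b ℕ.+ a ℕ.* suc b))) (ratioᵘ (suc a)) ⟩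
      (+ 1 ℚᵘ./ (suc a ℕ.* suc b)) ℚᵘ.* (+ suc a ℚᵘ./ 1)
        ≈⟨ ℚᵘ.*≡* (cong +_ (eq (suc a) (suc b))) ⟩
      + 1 ℚᵘ./ suc b
        ≈⟨ ℚᵘ.≃-sym (ℚ.toℚᵘ-fromℚᵘ (ℚᵘ.mkℚᵘ (+ 1) b)) ⟩
      ℚ.toℚᵘ (+ 1 / suc b) ∎)
      where
      open ℚᵘ.≃-Reasoning
      eq : ∀ m n → (m ℕ.+ 0) ℕ.* n ≡ (m ℕ.* n) ℕ.* 1 ℕ.+ 0
      eq m n = trans (cong (ℕ._* n) (ℕ.+-identityʳ m))
        (sym (trans (ℕ.+-identityʳ _) (ℕ.*-identityʳ _)))

  invFact-suc : ∀ k → invFact (suc k) ≡ invFact k * inv (ratio (suc k))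
  invFact-suc k = begin
    invFact (suc k)
      ≡⟨ sym (ℚ.*-identityʳ _) ⟩
    invFact (suc k) * 1ℚ
      ≡⟨ cong (invFact (suc k) *_) (sym (inv-inverse (ratio-pos k))) ⟩
    invFact (suc k) * (ratio (suc k) * inv (ratio (suc k)))
      ≡⟨ sym (ℚ.*-assoc (invFact (suc k)) _ _) ⟩
    invFact (suc k) * ratio (suc k) * inv (ratio (suc k))
      ≡⟨ cong (_* inv (ratio (suc k)))
           (frac (suc k) (k !) {{_}} {{k !≢0}} {{suc k !≢0}}) ⟩
    invFact k * inv (ratio (suc k)) ∎
    where open ≡-Reasoning

  invFact-nonNeg : ∀ k → 0ℚ ≤ invFact k
  invFact-nonNeg zero    = ℚ.nonNegative⁻¹ 1ℚ
  invFact-nonNeg (suc k) = subst (0ℚ ≤_) (sym (invFact-suc k))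
    (*-nonNeg (invFact-nonNeg k) (ℚ.<⇒≤ (inv-pos (ratio-pos k))))

  pow : ℚ → ℕ → ℚ
  pow B zero    = 1ℚ
  pow B (suc k) = B * pow B k

  pow-nonNeg : ∀ {B} → 0ℚ ≤ B → ∀ k → 0ℚ ≤ pow B k
  pow-nonNeg 0≤B zero    = ℚ.nonNegative⁻¹ 1ℚ
  pow-nonNeg 0≤B (suc k) = *-nonNeg 0≤B (pow-nonNeg 0≤B k)

  -- A nonnegative sequence that at least halves at each step from K on; it
  -- controls the tails of every sequence whose increments it dominates.
  module Halving (b : ℕ → ℚ) (b≥0 : ∀ n → 0ℚ ≤ b n) (K : ℕ)
                 (halving : ∀ n → K ℕ.≤ n → b (suc n) + b (suc n) ≤ b n) where

    decay : ∀ j → b (j ℕ.+ K) * ratio (suc j) ≤ b K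
    decay zero    = ℚ.≤-reflexive (ℚ.*-identityʳ (b K))
    decay (suc j) = begin
      b′ * ratio (suc (suc j))
        ≤⟨ *-monoʳ (b≥0 (suc j ℕ.+ K)) step ⟩
      b′ * (ratio (suc j) + ratio (suc j))
        ≡⟨ solve 2 (λ x y → x :* (y :+ y) := (x :+ x) :* y) refl b′ (ratio (suc j)) ⟩
      (b′ + b′) * ratio (suc j)
        ≤⟨ *-monoˡ (ratio-nonNeg (suc j)) (halving (j ℕ.+ K) (ℕ.m≤n+m K j)) ⟩
      b (j ℕ.+ K) * ratio (suc j)
        ≤⟨ decay j ⟩
      b K ∎
      where
      open ℚ.≤-Reasoning
      b′ = b (suc j ℕ.+ K)
      step : ratio (suc (suc j)) ≤ ratio (suc j) + ratio (suc j)
      step = subst (_≤ ratio (suc j) + ratio (suc j)) (sym (ratio-suc (suc j)))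
        (ℚ.+-monoˡ-≤ (ratio (suc j)) (ratio-mono {1} {suc j} (ℕ.s≤s ℕ.z≤n)))

    increments : ∀ (s : ℕ → ℚ) → (∀ n → ∣ s (suc n) - s n ∣ ≤ b n) →
                 ∀ m → K ℕ.≤ m → ∀ j →
                 ∣ s (j ℕ.+ m) - s m ∣ + (b (j ℕ.+ m) + b (j ℕ.+ m)) ≤ b m + b m
    increments s inc m K≤m zero    = ℚ.≤-reflexive (trans
      (cong (λ z → ∣ z ∣ + (b m + b m)) (ℚ.+-inverseʳ (s m)))
      (ℚ.+-identityˡ (b m + b m)))
    increments s inc m K≤m (suc j) = begin
      ∣ s (suc n) - s m ∣ + (b (suc n) + b (suc n))
        ≤⟨ ℚ.+-mono-≤ (triangle (s (suc n)) (s n) (s m))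
             (halving n (ℕ.≤-trans K≤m (ℕ.m≤n+m m j))) ⟩
      (∣ s (suc n) - s n ∣ + ∣ s n - s m ∣) + b n
        ≤⟨ ℚ.+-monoˡ-≤ (b n) (ℚ.+-monoˡ-≤ ∣ s n - s m ∣ (inc n)) ⟩
      (b n + ∣ s n - s m ∣) + b n
        ≡⟨ solve 2 (λ x y → (x :+ y) :+ x := y :+ (x :+ x)) refl (b n) ∣ s n - s m ∣ ⟩
      ∣ s n - s m ∣ + (b n + b n)
        ≤⟨ increments s inc m K≤m j ⟩
      b m + b m ∎
      where
      open ℚ.≤-Reasoning
      n = j ℕ.+ m

    tail : ∀ (s : ℕ → ℚ) → (∀ n → ∣ s (suc n) - s n ∣ ≤ b n) →
           ∀ m n → K ℕ.≤ m → m ℕ.≤ n → ∣ s n - s m ∣ ≤ b m + b m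
    tail s inc m n K≤m m≤n = begin
      ∣ s n - s m ∣
        ≡⟨ cong (λ k → ∣ s k - s m ∣) (sym (ℕ.m∸n+n≡m m≤n)) ⟩
      ∣ s k - s m ∣
        ≡⟨ sym (ℚ.+-identityʳ _) ⟩
      ∣ s k - s m ∣ + 0ℚ
        ≤⟨ ℚ.+-monoʳ-≤ ∣ s k - s m ∣ (ℚ.+-mono-≤ {0ℚ} {b k} {0ℚ} {b k} (b≥0 k) (b≥0 k)) ⟩
      ∣ s k - s m ∣ + (b k + b k)
        ≤⟨ increments s inc m K≤m (n ℕ.∸ m) ⟩
      b m + b m ∎
      where
      open ℚ.≤-Reasoning
      k = (n ℕ.∸ m) ℕ.+ m

    small : ∀ {ε} → 0ℚ < ε → ∃ λ N → K ℕ.≤ N × (∀ m → N ℕ.≤ m → b m + b m < ε)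
    small {ε} 0<ε = J ℕ.+ K , ℕ.m≤n+m K J , bound
      where
      open ℚ.≤-Reasoning
      c : ℕ → ℚ
      c n = b n + b n
      J = proj₁ (archimedean (c K * inv ε))
      bound : ∀ m → J ℕ.+ K ℕ.≤ m → c m < ε
      bound m J+K≤m = subst (λ k → c k < ε) (ℕ.m∸n+n≡m K≤m)
        (ℚ.*-cancelʳ-<-nonNeg (ratio (suc j)) {{ℚ.nonNegative (ratio-nonNeg (suc j))}} (begin-strict
          c (j ℕ.+ K) * ratio (suc j)
            ≡⟨ ℚ.*-distribʳ-+ (ratio (suc j)) (b (j ℕ.+ K)) (b (j ℕ.+ K)) ⟩
          b (j ℕ.+ K) * ratio (suc j) + b (j ℕ.+ K) * ratio (suc j)
            ≤⟨ ℚ.+-mono-≤ (decay j) (decay j) ⟩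
          c K
            ≡⟨ sym (ℚ.*-identityʳ (c K)) ⟩
          c K * 1ℚ
            ≡⟨ cong (c K *_) (sym (inv-inverse 0<ε)) ⟩
          c K * (ε * inv ε)
            ≡⟨ solve 3 (λ x y z → x :* (y :* z) := y :* (x :* z)) refl (c K) ε (inv ε) ⟩
          ε * (c K * inv ε)
            <⟨ ℚ.*-monoʳ-<-pos ε {{ℚ.positive 0<ε}} (proj₂ (archimedean (c K * inv ε))) ⟩
          ε * ratio J
            ≤⟨ *-monoʳ (ℚ.<⇒≤ 0<ε) (ratio-mono {J} {suc j} (ℕ.m≤n⇒m≤1+n J≤j)) ⟩
          ε * ratio (suc j) ∎))
        where
        K≤m : K ℕ.≤ m
        K≤m = ℕ.≤-trans (ℕ.m≤n+m K J) J+K≤m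
        j = m ℕ.∸ K
        J≤j : J ℕ.≤ j
        J≤j = subst (ℕ._≤ j) (ℕ.m+n∸n≡m J K) (ℕ.∸-monoˡ-≤ K J+K≤m)

  module ExpBound (B : ℚ) (0≤B : 0ℚ ≤ B) where

    expBound : ℕ → ℚ
    expBound k = invFact k * pow B k

    expBound-nonNeg : ∀ k → 0ℚ ≤ expBound k
    expBound-nonNeg k = *-nonNeg (invFact-nonNeg k) (pow-nonNeg 0≤B k)

    expK : ℕ
    expK = proj₁ (archimedean (B + B))

    halving : ∀ n → expK ℕ.≤ n → expBound (suc n) + expBound (suc n) ≤ expBound n
    halving n K≤n = begin
      invFact (suc n) * (B * p) + invFact (suc n) * (B * p)
        ≡⟨ cong (λ q → q * (B * p) + q * (B * p)) (invFact-suc n) ⟩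
      invFact n * i * (B * p) + invFact n * i * (B * p)
        ≡⟨ solve 4 (λ f i B p → f :* i :* (B :* p) :+ f :* i :* (B :* p)
                              := f :* p :* ((B :+ B) :* i)) refl (invFact n) i B p ⟩
      invFact n * p * ((B + B) * i)
        ≤⟨ *-monoʳ (expBound-nonNeg n) (*-monoˡ (ℚ.<⇒≤ (inv-pos (ratio-pos n)))
             (ℚ.≤-trans (ℚ.<⇒≤ (proj₂ (archimedean (B + B))))
               (ratio-mono {expK} {suc n} (ℕ.m≤n⇒m≤1+n K≤n)))) ⟩
      invFact n * p * (ratio (suc n) * i)
        ≡⟨ cong (invFact n * p *_) (inv-inverse (ratio-pos n)) ⟩
      invFact n * p * 1ℚ
        ≡⟨ ℚ.*-identityʳ _ ⟩
      invFact n * p ∎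
      where
      open ℚ.≤-Reasoning
      i = inv (ratio (suc n))
      p = pow B n

    open Halving expBound expBound-nonNeg expK halving public

------------------------------------------------------------------------
-- The real numbers: Cauchy sequences of rationals with a modulus of
-- convergence, up to the equality _≈ᵣ_

infix  4 _≈ᵣ_ _<ᵣ_ _≤ᵣ_
infix  8 -ᵣ_
infixl 7 _*ᵣ_
infixl 6 _+ᵣ_

Eventually : (ℕ → Set) → Set
Eventually P = ∃ λ N → ∀ n → N ℕ.≤ n → P n

IsCauchy : (ℕ → ℚ) → Set
IsCauchy s = ∀ ε → 0ℚ ℚ.< ε →
  ∃ λ N → ∀ m n → N ℕ.≤ m → N ℕ.≤ n → ℚ.∣ s m ℚ.- s n ∣ ℚ.< ε

record ℝ : Set where
  constructor mkℝ
  field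
    seq    : ℕ → ℚ
    cauchy : IsCauchy seq

open ℝ public

_≈ᵣ_ : ℝ → ℝ → Set
x ≈ᵣ y = ∀ ε → 0ℚ ℚ.< ε → Eventually λ n → ℚ.∣ seq x n ℚ.- seq y n ∣ ℚ.< ε

_<ᵣ_ : ℝ → ℝ → Set
x <ᵣ y = ∃ λ ε → 0ℚ ℚ.< ε × Eventually λ n → seq x n ℚ.+ ε ℚ.< seq y n

_≤ᵣ_ : ℝ → ℝ → Set
x ≤ᵣ y = ¬ (y <ᵣ x)

module RealLemmas where

  open import Data.Rational using (_+_; _*_; _-_; -_; _<_; _≤_; ∣_∣)
  open +-*-Solver
  open RationalLemmas

  constant-cauchy : ∀ q → IsCauchy (λ _ → q)
  constant-cauchy q ε 0<ε = 0 , λ _ _ _ _ → dist-0 q 0<ε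

  +-cauchy : ∀ s t → IsCauchy s → IsCauchy t → IsCauchy (λ n → s n + t n)
  +-cauchy s t cs ct ε 0<ε = N₁ ℕ.⊔ N₂ , λ m n Nm Nn →
    ℚ.≤-<-trans
      (subst (λ z → ∣ z ∣ ≤ ∣ s m - s n ∣ + ∣ t m - t n ∣)
        (solve 4 (λ a b c d → (a :- c) :+ (b :- d) := (a :+ b) :- (c :+ d)) refl
          (s m) (t m) (s n) (t n))
        (ℚ.∣p+q∣≤∣p∣+∣q∣ (s m - s n) (t m - t n)))
      (sum-<
        (p₁ m n (ℕ.m⊔n≤o⇒m≤o N₁ N₂ Nm) (ℕ.m⊔n≤o⇒m≤o N₁ N₂ Nn))
        (p₂ m n (ℕ.m⊔n≤o⇒n≤o N₁ N₂ Nm) (ℕ.m⊔n≤o⇒n≤o N₁ N₂ Nn)))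
    where
    N₁ = proj₁ (cs (½ * ε) (half-pos 0<ε))
    p₁ = proj₂ (cs (½ * ε) (half-pos 0<ε))
    N₂ = proj₁ (ct (½ * ε) (half-pos 0<ε))
    p₂ = proj₂ (ct (½ * ε) (half-pos 0<ε))

  neg-cauchy : ∀ s → IsCauchy s → IsCauchy (λ n → - s n)
  neg-cauchy s cs ε 0<ε = proj₁ (cs ε 0<ε) , λ m n Nm Nn →
    subst (_< ε)
      (trans (dist-sym (s m) (s n))
        (cong ∣_∣ (solve 2 (λ a b → b :- a := (:- a) :- (:- b)) refl (s m) (s n))))
      (proj₂ (cs ε 0<ε) m n Nm Nn)

  sumAbs : (ℕ → ℚ) → ℕ → ℚ
  sumAbs s zero    = ∣ s 0 ∣
  sumAbs s (suc n) = sumAbs s n + ∣ s (suc n) ∣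

  sumAbs-nonNeg : ∀ s n → 0ℚ ≤ sumAbs s n
  sumAbs-nonNeg s zero    = ℚ.0≤∣p∣ (s 0)
  sumAbs-nonNeg s (suc n) =
    ℚ.+-mono-≤ {0ℚ} {_} {0ℚ} (sumAbs-nonNeg s n) (ℚ.0≤∣p∣ (s (suc n)))

  ≤-sumAbs : ∀ s n N → n ℕ.≤′ N → ∣ s n ∣ ≤ sumAbs s N
  ≤-sumAbs s zero    _ (ℕ.≤′-reflexive refl) = ℚ.≤-refl
  ≤-sumAbs s (suc n) _ (ℕ.≤′-reflexive refl) =
    subst (_≤ sumAbs s (suc n)) (ℚ.+-identityˡ _)
      (ℚ.+-monoˡ-≤ ∣ s (suc n) ∣ (sumAbs-nonNeg s n))
  ≤-sumAbs s n _ (ℕ.≤′-step {N} p) = ℚ.≤-trans (≤-sumAbs s n N p)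
    (subst (_≤ sumAbs s (suc N)) (ℚ.+-identityʳ _)
      (ℚ.+-monoʳ-≤ (sumAbs s N) (ℚ.0≤∣p∣ (s (suc N)))))

  bounded : ∀ s → IsCauchy s → ∃ λ B → 0ℚ < B × (∀ n → ∣ s n ∣ ≤ B)
  bounded s cs = B , 0<B , bound
    where
    N = proj₁ (cs 1ℚ (ℚ.positive⁻¹ 1ℚ))
    B = 1ℚ + sumAbs s N
    0<B : 0ℚ < B
    0<B = ℚ.+-mono-<-≤ {0ℚ} {1ℚ} {0ℚ} (ℚ.positive⁻¹ 1ℚ) (sumAbs-nonNeg s N)
    bound : ∀ n → ∣ s n ∣ ≤ B
    bound n with ℕ.≤-total n N
    ... | inj₁ n≤N = ℚ.≤-trans (≤-sumAbs s n N (ℕ.≤⇒≤′ n≤N))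
      (subst (_≤ B) (ℚ.+-identityˡ _)
        (ℚ.+-monoˡ-≤ (sumAbs s N) (ℚ.nonNegative⁻¹ 1ℚ)))
    ... | inj₂ N≤n = ℚ.≤-trans
      (subst (λ z → ∣ z ∣ ≤ ∣ s n - s N ∣ + ∣ s N ∣)
        (solve 2 (λ a b → (a :- b) :+ b := a) refl (s n) (s N))
        (ℚ.∣p+q∣≤∣p∣+∣q∣ (s n - s N) (s N)))
      (ℚ.+-mono-≤
        (ℚ.<⇒≤ (proj₂ (cs 1ℚ (ℚ.positive⁻¹ 1ℚ)) n N N≤n ℕ.≤-refl))
        (≤-sumAbs s N N (ℕ.≤′-reflexive refl)))

  *-cauchy : ∀ s t → IsCauchy s → IsCauchy t → IsCauchy (λ n → s n * t n)
  *-cauchy s t cs ct ε 0<ε = N₁ ℕ.⊔ N₂ , λ m n Nm Nn →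
    ℚ.≤-<-trans
      (subst (λ z → ∣ z ∣ ≤ ∣ s m * (t m - t n) ∣ + ∣ t n * (s m - s n) ∣)
        (solve 4 (λ a b c d → a :* (b :- d) :+ d :* (a :- c) := a :* b :- c :* d) refl
          (s m) (t m) (s n) (t n))
        (ℚ.∣p+q∣≤∣p∣+∣q∣ (s m * (t m - t n)) (t n * (s m - s n))))
      (sum-<
        (prod-< {s m} {t m - t n} 0<S (boundS m)
          (p₂ m n (ℕ.m⊔n≤o⇒n≤o N₁ N₂ Nm) (ℕ.m⊔n≤o⇒n≤o N₁ N₂ Nn)))
        (prod-< {t n} {s m - s n} 0<T (boundT n)
          (p₁ m n (ℕ.m⊔n≤o⇒m≤o N₁ N₂ Nm) (ℕ.m⊔n≤o⇒m≤o N₁ N₂ Nn))))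
    where
    S = proj₁ (bounded s cs)
    T = proj₁ (bounded t ct)
    0<S = proj₁ (proj₂ (bounded s cs))
    0<T = proj₁ (proj₂ (bounded t ct))
    boundS = proj₂ (proj₂ (bounded s cs))
    boundT = proj₂ (proj₂ (bounded t ct))
    cs′ = cs (½ * ε * inv T) (*-pos (half-pos 0<ε) (inv-pos 0<T))
    ct′ = ct (½ * ε * inv S) (*-pos (half-pos 0<ε) (inv-pos 0<S))
    N₁ = proj₁ cs′
    p₁ = proj₂ cs′
    N₂ = proj₁ ct′
    p₂ = proj₂ ct′

  inv-cauchy : ∀ s {δ} → 0ℚ < δ → Eventually (λ n → δ < s n) →
               IsCauchy s → IsCauchy (λ n → inv (s n))
  inv-cauchy s {δ} 0<δ (N₁ , δ<s) cs ε 0<ε = N₁ ℕ.⊔ N₂ , λ m n Nm Nn →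
    close m n (δ<s m (ℕ.m⊔n≤o⇒m≤o N₁ N₂ Nm)) (δ<s n (ℕ.m⊔n≤o⇒m≤o N₁ N₂ Nn))
      (p₂ n m (ℕ.m⊔n≤o⇒n≤o N₁ N₂ Nn) (ℕ.m⊔n≤o⇒n≤o N₁ N₂ Nm))
    where
    C = inv δ * inv δ
    0<C : 0ℚ < C
    0<C = *-pos (inv-pos 0<δ) (inv-pos 0<δ)
    cs′ = cs (ε * inv C) (*-pos 0<ε (inv-pos 0<C))
    N₂ = proj₁ cs′
    p₂ = proj₂ cs′
    close : ∀ m n → δ < s m → δ < s n → ∣ s n - s m ∣ < ε * inv C →
            ∣ inv (s m) - inv (s n) ∣ < ε
    close m n δ<a δ<b p = subst (λ z → ∣ z ∣ < ε) eq
      (prod-< {inv a * inv b} {b - a} 0<C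
        (subst (_≤ C) (sym (ℚ.0≤p⇒∣p∣≡p 0≤ab))
          (*-mono (ℚ.<⇒≤ (inv-pos 0<δ)) (ℚ.<⇒≤ (inv-pos 0<b))
            (inv-anti 0<δ (ℚ.<⇒≤ δ<a)) (inv-anti 0<δ (ℚ.<⇒≤ δ<b))))
        p)
      where
      a = s m
      b = s n
      0<a : 0ℚ < a
      0<a = ℚ.<-trans 0<δ δ<a
      0<b : 0ℚ < b
      0<b = ℚ.<-trans 0<δ δ<b
      0≤ab : 0ℚ ≤ inv a * inv b
      0≤ab = ℚ.<⇒≤ (*-pos (inv-pos 0<a) (inv-pos 0<b))
      eq : inv a * inv b * (b - a) ≡ inv a - inv b
      eq = begin
        inv a * inv b * (b - a)
          ≡⟨ solve 4 (λ x y a b → x :* y :* (b :- a) := x :* (b :* y) :- y :* (a :* x))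
               refl (inv a) (inv b) a b ⟩
        inv a * (b * inv b) - inv b * (a * inv a)
          ≡⟨ cong₂ (λ u v → inv a * u - inv b * v) (inv-inverse 0<b) (inv-inverse 0<a) ⟩
        inv a * 1ℚ - inv b * 1ℚ
          ≡⟨ cong₂ _-_ (ℚ.*-identityʳ (inv a)) (ℚ.*-identityʳ (inv b)) ⟩
        inv a - inv b ∎
        where open ≡-Reasoning

open RealLemmas

fromℚ : ℚ → ℝ
fromℚ q = mkℝ (λ _ → q) (constant-cauchy q)

0ᵣ 1ᵣ : ℝ
0ᵣ = fromℚ 0ℚ
1ᵣ = fromℚ 1ℚ

_+ᵣ_ _*ᵣ_ : ℝ → ℝ → ℝ
x +ᵣ y = mkℝ (λ n → seq x n ℚ.+ seq y n) (+-cauchy (seq x) (seq y) (cauchy x) (cauchy y))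
x *ᵣ y = mkℝ (λ n → seq x n ℚ.* seq y n) (*-cauchy (seq x) (seq y) (cauchy x) (cauchy y))

-ᵣ_ : ℝ → ℝ
-ᵣ x = mkℝ (λ n → ℚ.- seq x n) (neg-cauchy (seq x) (cauchy x))

recip : (x : ℝ) → 0ᵣ <ᵣ x → ℝ
recip x (δ , 0<δ , N , p) = mkℝ (λ n → RationalLemmas.inv (seq x n))
  (inv-cauchy (seq x) 0<δ (N , λ n N≤n → subst (ℚ._< seq x n) (ℚ.+-identityˡ δ) (p n N≤n))
    (cauchy x))

-- ∣x - y∣ ≤ ε follows from Near ε x y, and ∣x - y∣ < ε implies it.
Near : ℚ → ℝ → ℝ → Set
Near ε x y = Eventually λ n → ℚ.∣ seq x n ℚ.- seq y n ∣ ℚ.< ε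

IsCauchyᵣ : (ℕ → ℝ) → Set
IsCauchyᵣ s = ∀ ε → 0ℚ ℚ.< ε →
  ∃ λ N → ∀ m n → N ℕ.≤ m → N ℕ.≤ n → Near ε (s m) (s n)

Convergesᵣ : (ℕ → ℝ) → ℝ → Set
Convergesᵣ s l = ∀ ε → 0ℚ ℚ.< ε → Eventually λ n → Near ε (s n) l

module Completeness (s : ℕ → ℝ) (cs : IsCauchyᵣ s) where

  open import Data.Rational using (_+_; _*_; _-_; -_; _<_; _≤_; ∣_∣)
  open RationalLemmas

  private
    e : ℕ → ℚ
    e k = inv (ratio (suc k))

    e>0 : ∀ k → 0ℚ < e k
    e>0 k = inv-pos (ratio-pos k)

    e-small : ∀ {η} → 0ℚ < η → ∃ λ K → ∀ k → K ℕ.≤ k → e k ≤ η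
    e-small {η} 0<η = K , λ k K≤k → subst (e k ≤_) inv-inv
      (inv-anti (inv-pos 0<η) (ℚ.≤-trans (ℚ.<⇒≤ (proj₂ (archimedean (inv η))))
        (ratio-mono {K} {suc k} (ℕ.m≤n⇒m≤1+n K≤k))))
      where
      open +-*-Solver
      K = proj₁ (archimedean (inv η))
      inv-inv : inv (inv η) ≡ η
      inv-inv = begin
        inv (inv η)
          ≡⟨ sym (ℚ.*-identityˡ _) ⟩
        1ℚ * inv (inv η)
          ≡⟨ cong (_* inv (inv η)) (sym (inv-inverse 0<η)) ⟩
        η * inv η * inv (inv η)
          ≡⟨ ℚ.*-assoc η (inv η) (inv (inv η)) ⟩
        η * (inv η * inv (inv η))
          ≡⟨ cong (η *_) (inv-inverse (inv-pos 0<η)) ⟩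
        η * 1ℚ
          ≡⟨ ℚ.*-identityʳ η ⟩
        η ∎
        where open ≡-Reasoning

    N : ℕ → ℕ
    N k = proj₁ (cs (e k) (e>0 k))

    L : ℕ → ℕ
    L k = proj₁ (cauchy (s (N k)) (e k) (e>0 k))

    a : ℕ → ℚ
    a k = seq (s (N k)) (L k)

    approx : ∀ {η i} → e i ≤ ½ * η → ∀ p → N i ℕ.≤ p →
             Eventually λ m → ∣ a i - seq (s p) m ∣ < η
    approx {η} {i} small p Ni≤p = L i ℕ.⊔ M , λ m q →
      near-trans {a i} {seq (s (N i)) m} {seq (s p) m}
        (ℚ.<-≤-trans (proj₂ (cauchy (s (N i)) (e i) (e>0 i)) (L i) m
          ℕ.≤-refl (ℕ.m⊔n≤o⇒m≤o (L i) M q)) small)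
        (ℚ.<-≤-trans (proj₂ near m (ℕ.m⊔n≤o⇒n≤o (L i) M q)) small)
      where
      near = proj₂ (cs (e i) (e>0 i)) (N i) p ℕ.≤-refl Ni≤p
      M = proj₁ near

    close : ∀ {ε i j} → e i ≤ ½ * (½ * ε) → e j ≤ ½ * (½ * ε) → ∣ a i - a j ∣ < ε
    close {ε} {i} {j} si sj = near-trans {a i} {seq (s p) m} {a j}
      (proj₂ A m (ℕ.m≤m⊔n (proj₁ A) (proj₁ B)))
      (subst (_< ½ * ε) (dist-sym (a j) (seq (s p) m))
        (proj₂ B m (ℕ.m≤n⊔m (proj₁ A) (proj₁ B))))
      where
      p = N i ℕ.⊔ N j
      A = approx {½ * ε} {i} si p (ℕ.m≤m⊔n (N i) (N j))
      B = approx {½ * ε} {j} sj p (ℕ.m≤n⊔m (N i) (N j))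
      m = proj₁ A ℕ.⊔ proj₁ B

    a-cauchy : IsCauchy a
    a-cauchy ε 0<ε = proj₁ E , λ m n Em En →
      close {ε} {m} {n} (proj₂ E m Em) (proj₂ E n En)
      where E = e-small (half-pos (half-pos 0<ε))

  lim : ℝ
  lim = mkℝ a a-cauchy

  lim-converges : Convergesᵣ s lim
  lim-converges ε 0<ε = N i , λ n Ni≤n →
    let A = approx {½ * ε} {i} ei≤ n Ni≤n in
    proj₁ A ℕ.⊔ i , λ m q →
      near-trans {seq (s n) m} {a i} {a m}
        (subst (_< ½ * ε) (dist-sym (a i) (seq (s n) m))
          (proj₂ A m (ℕ.m⊔n≤o⇒m≤o (proj₁ A) i q)))
        (close {½ * ε} {i} {m} (proj₂ E i ℕ.≤-refl)
          (proj₂ E m (ℕ.m⊔n≤o⇒n≤o (proj₁ A) i q)))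
    where
    E = e-small (half-pos (half-pos (half-pos 0<ε)))
    i = proj₁ E
    ei≤ : e i ≤ ½ * (½ * ε)
    ei≤ = ℚ.≤-trans (proj₂ E i ℕ.≤-refl)
      (ℚ.<⇒≤ (subst (½ * (½ * (½ * ε)) <_) (half+half (½ * (½ * ε)))
        (subst (_< h + h) (ℚ.+-identityʳ h) (ℚ.+-monoʳ-< h (half-pos (half-pos (half-pos 0<ε)))))))
      where h = ½ * (½ * (½ * ε))

------------------------------------------------------------------------
-- The complex numbers

infix  4 _≈_
infix  8 -_ _#0
infixl 7 _*_
infixl 6 _+_ _-_
infixr 9 _^_

record ℂ : Set where
  constructor _+i_
  field
    re im : ℝ

open ℂ public

_≈_ : ℂ → ℂ → Set
z ≈ w = re z ≈ᵣ re w × im z ≈ᵣ im w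

fromℝ : ℝ → ℂ
fromℝ x = x +i 0ᵣ

0ℂ 1ℂ : ℂ
0ℂ = fromℝ 0ᵣ
1ℂ = fromℝ 1ᵣ

-_ : ℂ → ℂ
- z = (-ᵣ re z) +i (-ᵣ im z)

_+_ _*_ _-_ : ℂ → ℂ → ℂ
z + w = (re z +ᵣ re w) +i (im z +ᵣ im w)
z * w = (re z *ᵣ re w +ᵣ -ᵣ (im z *ᵣ im w)) +i (re z *ᵣ im w +ᵣ im z *ᵣ re w)
z - w = z + (- w)

_^_ : ℂ → ℕ → ℂ
z ^ zero  = 1ℂ
z ^ suc n = z * z ^ n

∣_∣² : ℂ → ℝ
∣ z ∣² = re z *ᵣ re z +ᵣ im z *ᵣ im z

-- The modulus only ever occurs in comparisons, which are stated for squares so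
-- that no square root is needed; they are meant for r ≥ 0.
∣_∣<_ : ℂ → ℝ → Set
∣ z ∣< r = ∣ z ∣² <ᵣ r *ᵣ r

∣_∣≤_·∣_∣ : ℂ → ℝ → ℂ → Set
∣ z ∣≤ r ·∣ w ∣ = ∣ z ∣² ≤ᵣ (r *ᵣ r) *ᵣ ∣ w ∣²

-- Apartness from zero, the constructive form of z ≠ 0; it is what makes z
-- invertible.
_#0 : ℂ → Set
z #0 = 0ᵣ <ᵣ ∣ z ∣²

inverse : (z : ℂ) → z #0 → ℂ
inverse z z#0 = (re z *ᵣ recip ∣ z ∣² z#0) +i (-ᵣ im z *ᵣ recip ∣ z ∣² z#0)

*-#0 : ∀ z w → z #0 → w #0 → (z * w) #0
*-#0 z w (δ , 0<δ , M , p) (η , 0<η , N , q) =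
  ½ ℚ.* (δ ℚ.* η) , half-pos 0<δη , M ℕ.⊔ N , λ n r → begin-strict
    0ℚ ℚ.+ ½ ℚ.* (δ ℚ.* η)
      ≡⟨ ℚ.+-identityˡ _ ⟩
    ½ ℚ.* (δ ℚ.* η)
      ≡⟨ sym (ℚ.+-identityʳ _) ⟩
    ½ ℚ.* (δ ℚ.* η) ℚ.+ 0ℚ
      <⟨ ℚ.+-monoʳ-< (½ ℚ.* (δ ℚ.* η)) (half-pos 0<δη) ⟩
    ½ ℚ.* (δ ℚ.* η) ℚ.+ ½ ℚ.* (δ ℚ.* η)
      ≡⟨ half+half (δ ℚ.* η) ⟩
    δ ℚ.* η
      ≤⟨ *-mono (ℚ.<⇒≤ (ℚ.<-trans 0<δ (δ< n r))) (ℚ.<⇒≤ 0<η)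
           (ℚ.<⇒≤ (δ< n r)) (ℚ.<⇒≤ (η< n r)) ⟩
    seq ∣ z ∣² n ℚ.* seq ∣ w ∣² n
      ≡⟨ solve 4 (λ a b c d → (a :* a :+ b :* b) :* (c :* c :+ d :* d) :=
             (a :* c :- b :* d) :* (a :* c :- b :* d) :+
             (a :* d :+ b :* c) :* (a :* d :+ b :* c)) refl
           (seq (re z) n) (seq (im z) n) (seq (re w) n) (seq (im w) n) ⟩
    seq ∣ z * w ∣² n ∎
  where
  open ℚ.≤-Reasoning
  open RationalLemmas
  open +-*-Solver
  0<δη : 0ℚ ℚ.< δ ℚ.* η
  0<δη = *-pos 0<δ 0<η
  δ< : ∀ n → M ℕ.⊔ N ℕ.≤ n → δ ℚ.< seq ∣ z ∣² n
  δ< n r = subst (ℚ._< seq ∣ z ∣² n) (ℚ.+-identityˡ δ) (p n (ℕ.m⊔n≤o⇒m≤o M N r))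
  η< : ∀ n → M ℕ.⊔ N ℕ.≤ n → η ℚ.< seq ∣ w ∣² n
  η< n r = subst (ℚ._< seq ∣ w ∣² n) (ℚ.+-identityˡ η) (q n (ℕ.m⊔n≤o⇒n≤o M N r))

------------------------------------------------------------------------
-- Limits, series, the exponential

infix 4 _⟶_

_⟶_ : (ℕ → ℂ) → ℂ → Set
s ⟶ l = ∀ ε → 0ᵣ <ᵣ ε → ∃ λ N → ∀ n → N ℕ.≤ n → ∣ s n - l ∣< ε

-- partialSum c n = c 0 + ⋯ + c (n - 1)
partialSum : (ℕ → ℂ) → ℕ → ℂ
partialSum c zero    = 0ℂ
partialSum c (suc n) = partialSum c n + c n

HasSum : (ℕ → ℂ) → ℂ → Set
HasSum c l = partialSum c ⟶ l

expTerm : ℂ → ℕ → ℂ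
expTerm z k = fromℝ (fromℚ (RationalLemmas.invFact k)) * z ^ k

module ExpConvergence (z : ℂ) where

  open import Data.Rational using (_≤_; _<_; ∣_∣)
  open RationalLemmas
  open +-*-Solver

  size : ℂ → ℕ → ℚ
  size w n = ∣ seq (re w) n ∣ ℚ.+ ∣ seq (im w) n ∣

  size-nonNeg : ∀ w n → 0ℚ ≤ size w n
  size-nonNeg w n = ℚ.+-mono-≤ {0ℚ} {_} {0ℚ} (ℚ.0≤∣p∣ (seq (re w) n)) (ℚ.0≤∣p∣ (seq (im w) n))

  size-* : ∀ v w n → size (v * w) n ≤ size v n ℚ.* size w n
  size-* v w n = begin
    ∣ a ℚ.* c ℚ.- b ℚ.* d ∣ ℚ.+ ∣ a ℚ.* d ℚ.+ b ℚ.* c ∣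
      ≤⟨ ℚ.+-mono-≤ (ℚ.∣p-q∣≤∣p∣+∣q∣ (a ℚ.* c) (b ℚ.* d))
                    (ℚ.∣p+q∣≤∣p∣+∣q∣ (a ℚ.* d) (b ℚ.* c)) ⟩
    (∣ a ℚ.* c ∣ ℚ.+ ∣ b ℚ.* d ∣) ℚ.+ (∣ a ℚ.* d ∣ ℚ.+ ∣ b ℚ.* c ∣)
      ≡⟨ cong₂ ℚ._+_ (cong₂ ℚ._+_ (ℚ.∣p*q∣≡∣p∣*∣q∣ a c) (ℚ.∣p*q∣≡∣p∣*∣q∣ b d))
                     (cong₂ ℚ._+_ (ℚ.∣p*q∣≡∣p∣*∣q∣ a d) (ℚ.∣p*q∣≡∣p∣*∣q∣ b c)) ⟩
    (∣ a ∣ ℚ.* ∣ c ∣ ℚ.+ ∣ b ∣ ℚ.* ∣ d ∣) ℚ.+ (∣ a ∣ ℚ.* ∣ d ∣ ℚ.+ ∣ b ∣ ℚ.* ∣ c ∣)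
      ≡⟨ solve 4 (λ a b c d → (a :* c :+ b :* d) :+ (a :* d :+ b :* c)
                            := (a :+ b) :* (c :+ d)) refl (∣ a ∣) (∣ b ∣) (∣ c ∣) (∣ d ∣) ⟩
    (∣ a ∣ ℚ.+ ∣ b ∣) ℚ.* (∣ c ∣ ℚ.+ ∣ d ∣) ∎
    where
    open ℚ.≤-Reasoning
    a = seq (re v) n
    b = seq (im v) n
    c = seq (re w) n
    d = seq (im w) n

  private
    bre = bounded (seq (re z)) (cauchy (re z))
    bim = bounded (seq (im z)) (cauchy (im z))

  B : ℚ
  B = proj₁ bre ℚ.+ proj₁ bim

  0≤B : 0ℚ ≤ B
  0≤B = ℚ.+-mono-≤ {0ℚ} {_} {0ℚ} (ℚ.<⇒≤ (proj₁ (proj₂ bre))) (ℚ.<⇒≤ (proj₁ (proj₂ bim)))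

  size-≤-B : ∀ n → size z n ≤ B
  size-≤-B n = ℚ.+-mono-≤ (proj₂ (proj₂ bre) n) (proj₂ (proj₂ bim) n)

  open ExpBound B 0≤B

  size-^ : ∀ k n → size (z ^ k) n ≤ pow B k
  size-^ zero    n = ℚ.≤-refl
  size-^ (suc k) n = ℚ.≤-trans (size-* z (z ^ k) n)
    (*-mono 0≤B (size-nonNeg (z ^ k) n) (size-≤-B n) (size-^ k n))

  size-expTerm : ∀ k n → size (expTerm z k) n ≤ expBound k
  size-expTerm k n = ℚ.≤-trans (size-* (fromℝ (fromℚ (invFact k))) (z ^ k) n)
    (subst (λ q → q ℚ.* size (z ^ k) n ≤ expBound k)
      (sym (trans (ℚ.+-identityʳ ∣ invFact k ∣) (ℚ.0≤p⇒∣p∣≡p (invFact-nonNeg k))))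
      (*-monoʳ (invFact-nonNeg k) (size-^ k n)))

  private
    add-sub : ∀ x y → (x ℚ.+ y) ℚ.- x ≡ y
    add-sub = solve 2 (λ x y → (x :+ y) :- x := y) refl

    increment-re : ∀ j k → ∣ seq (re (partialSum (expTerm z) (suc k))) j ℚ.-
                             seq (re (partialSum (expTerm z) k)) j ∣ ≤ expBound k
    increment-re j k = begin
      ∣ (x ℚ.+ y) ℚ.- x ∣  ≡⟨ cong ∣_∣ (add-sub x y) ⟩
      ∣ y ∣                ≡⟨ sym (ℚ.+-identityʳ ∣ y ∣) ⟩
      ∣ y ∣ ℚ.+ 0ℚ         ≤⟨ ℚ.+-monoʳ-≤ ∣ y ∣ (ℚ.0≤∣p∣ (seq (im (expTerm z k)) j)) ⟩
      size (expTerm z k) j ≤⟨ size-expTerm k j ⟩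
      expBound k           ∎
      where
      open ℚ.≤-Reasoning
      x = seq (re (partialSum (expTerm z) k)) j
      y = seq (re (expTerm z k)) j

    increment-im : ∀ j k → ∣ seq (im (partialSum (expTerm z) (suc k))) j ℚ.-
                             seq (im (partialSum (expTerm z) k)) j ∣ ≤ expBound k
    increment-im j k = begin
      ∣ (x ℚ.+ y) ℚ.- x ∣  ≡⟨ cong ∣_∣ (add-sub x y) ⟩
      ∣ y ∣                ≡⟨ sym (ℚ.+-identityˡ ∣ y ∣) ⟩
      0ℚ ℚ.+ ∣ y ∣         ≤⟨ ℚ.+-monoˡ-≤ ∣ y ∣ (ℚ.0≤∣p∣ (seq (re (expTerm z k)) j)) ⟩
      size (expTerm z k) j ≤⟨ size-expTerm k j ⟩
      expBound k           ∎
      where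
      open ℚ.≤-Reasoning
      x = seq (im (partialSum (expTerm z) k)) j
      y = seq (im (expTerm z k)) j

    dominated-cauchy : ∀ (s : ℕ → ℝ) →
      (∀ j k → ∣ seq (s (suc k)) j ℚ.- seq (s k) j ∣ ≤ expBound k) → IsCauchyᵣ s
    dominated-cauchy s inc ε 0<ε = N , λ m n N≤m N≤n → 0 , λ j _ → bound j m n N≤m N≤n
      where
      N = proj₁ (small 0<ε)
      K≤N = proj₁ (proj₂ (small 0<ε))
      N-small = proj₂ (proj₂ (small 0<ε))
      ordered : ∀ j m n → N ℕ.≤ m → m ℕ.≤ n → ∣ seq (s n) j ℚ.- seq (s m) j ∣ < ε
      ordered j m n N≤m m≤n = ℚ.≤-<-trans
        (tail (λ k → seq (s k) j) (inc j) m n (ℕ.≤-trans K≤N N≤m) m≤n) (N-small m N≤m)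
      bound : ∀ j m n → N ℕ.≤ m → N ℕ.≤ n → ∣ seq (s m) j ℚ.- seq (s n) j ∣ < ε
      bound j m n N≤m N≤n = [
        (λ m≤n → subst (_< ε) (dist-sym (seq (s n) j) (seq (s m) j)) (ordered j m n N≤m m≤n)) ,
        (λ n≤m → ordered j n m N≤n n≤m) ]′ (ℕ.≤-total m n)

  re-cauchy : IsCauchyᵣ (λ k → re (partialSum (expTerm z) k))
  re-cauchy = dominated-cauchy (λ k → re (partialSum (expTerm z) k)) increment-re

  im-cauchy : IsCauchyᵣ (λ k → im (partialSum (expTerm z) k))
  im-cauchy = dominated-cauchy (λ k → im (partialSum (expTerm z) k)) increment-im

-- The sum of the series Σ zᵏ / k!, as the limit of its partial sums.
exp : ℂ → ℂ
exp z = Completeness.lim (λ k → re (partialSum (expTerm z) k)) re-cauchy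
     +i Completeness.lim (λ k → im (partialSum (expTerm z) k)) im-cauchy
  where open ExpConvergence z

exp-converges : ∀ z →
  Convergesᵣ (λ k → re (partialSum (expTerm z) k)) (re (exp z)) ×
  Convergesᵣ (λ k → im (partialSum (expTerm z) k)) (im (exp z))
exp-converges z =
  Completeness.lim-converges (λ k → re (partialSum (expTerm z) k)) re-cauchy ,
  Completeness.lim-converges (λ k → im (partialSum (expTerm z) k)) im-cauchy
  where open ExpConvergence z

------------------------------------------------------------------------
-- Holomorphy

-- Functions ℂ → ℂ below are not assumed to respect _≈_ everywhere: a function
-- differentiable on a disc automatically respects _≈_ there, and its values
-- outside play no role.  So a function defined only near 0 may be represented by
-- any total function, extensional or not, agreeing with it on a disc around 0.

HasDerivAt : (ℂ → ℂ) → ℂ → ℂ → Set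
HasDerivAt f d z = ∀ ε → 0ᵣ <ᵣ ε → ∃ λ δ → 0ᵣ <ᵣ δ ×
  (∀ w → ∣ w - z ∣< δ → ∣ (f w - f z) - d * (w - z) ∣≤ ε ·∣ w - z ∣)

Near0 : (ℂ → Set) → Set
Near0 P = ∃ λ r → 0ᵣ <ᵣ r × (∀ t → ∣ t ∣< r → P t)

HolomorphicAt0 : (ℂ → ℂ) → Set
HolomorphicAt0 f = Near0 λ t → ∃ λ d → HasDerivAt f d t

OddNear0 : (ℂ → ℂ) → Set
OddNear0 f = Near0 λ t → f (- t) ≈ - f t

EvenNear0 : (ℂ → ℂ) → Set
EvenNear0 f = Near0 λ t → f (- t) ≈ f t

------------------------------------------------------------------------
-- Appell polynomials

-- A polynomial is the list of its coefficients, constant term first.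
Polynomial : Set
Polynomial = List ℂ

eval : Polynomial → ℂ → ℂ
eval []      x = 0ℂ
eval (c ∷ p) x = c + x * eval p x

-- φ(0) φ(1) ⋯ φ(n)
prodUpTo : (ℕ → ℂ) → ℕ → ℂ
prodUpTo φ zero    = φ 0
prodUpTo φ (suc n) = prodUpTo φ n * φ (suc n)

prodUpTo-#0 : ∀ φ → (∀ n → φ n #0) → ∀ n → prodUpTo φ n #0
prodUpTo-#0 φ φ#0 zero    = φ#0 0
prodUpTo-#0 φ φ#0 (suc n) = *-#0 (prodUpTo φ n) (φ (suc n)) (prodUpTo-#0 φ φ#0 n) (φ#0 (suc n))

-- P is a sequence of Appell polynomials of type (g , φ) with generating
-- function f.  The neighbourhood of t = 0 may depend on x.
IsAppell : (g : ℂ → ℂ) (φ : ℕ → ℂ) → (∀ n → φ n #0) → (f : ℂ → ℂ) → (ℕ → Polynomial) → Set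
IsAppell g φ φ#0 f P =
  HolomorphicAt0 f × f 0ℂ #0 ×
  (∀ x → Near0 λ t →
    HasSum (λ n → eval (P n) x * (t ^ n * inverse (prodUpTo φ n) (prodUpTo-#0 φ φ#0 n)))
           (f t * exp (x * g t)))

{-# OPTIONS --safe #-}

-- Write F(x, t) = f(t) exp(x g(t)) and h(t) = F(a/2, t).  By uniqueness of
-- the coefficients of a power series, P_n(a - x) = (-1)^n P_n(x) for all n
-- means that F(a - x, t) = F(x, -t) for t near 0.  Since
-- F(x, t) = h(t) exp((x - a/2) g(t)), this follows from h even and g odd.
-- Conversely, x = a/2 gives that h is even, and x = a/2 + 1 then gives
-- exp(-g(t)) = exp(g(-t)), because h(t) is invertible.  So
-- exp(g(t) + g(-t)) = 1, where g(t) + g(-t) is small by continuity, and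
-- |exp(u) - 1| ≥ |u|/2 for small u.  Identities and estimates in ℂ are proved
-- at each index of the approximating sequences, that is, in the Gaussian
-- rationals.

module Submission where

open import Defs
open import Algebra.Bundles using (CommutativeRing)
import Algebra.Solver.Ring.AlmostCommutativeRing as ACR
import Algebra.Solver.Ring.NaturalCoefficients.Default as SemiringSolver
import Algebra.Solver.Ring.Simple as RingSolver
open import Data.Nat as ℕ using (ℕ; zero; suc)
import Data.Nat.Properties as ℕ
open import Data.Product using (∃; _×_; _,_; proj₁; proj₂)
open import Data.Product.Properties using (≡-dec)
open import Data.Rational as ℚ using (ℚ; 0ℚ; 1ℚ; ½)
import Data.Rational.Properties as ℚ
open import Data.Rational.Solver using (module +-*-Solver)
open import Data.Sum using ([_,_]′)
open import Function.Base using (_∘_; flip)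
open import Function.Bundles using (_⇔_; mk⇔)
open import Level using (0ℓ)
open import Relation.Binary.Bundles using (Setoid)
open import Relation.Binary.PropositionalEquality
  using (_≡_; refl; sym; trans; cong; cong₂; subst; subst₂; isEquivalence; module ≡-Reasoning)
import Relation.Binary.Reasoning.Setoid as SetoidReasoning
open import Relation.Nullary using (yes; no; contradiction)
open import Relation.Nullary.Decidable using (toWitness)
open RationalLemmas

-- The operations of ℂ act index by index, so a ring identity in ℂ reduces to propositional
-- equalities in ℚ × ℚ, where equality is decidable and a ring solver applies. The neighbourhood of
-- t = 0 may shrink with x, so no argument can let x vary while t is fixed. Each step uses one pair
-- x, a - x, and in the converse the two points a/2 and a/2 + 1 must suffice. Nor are f and g
-- assumed to respect equality everywhere, so t and - t enter as fixed terms and only the x in F(x,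
-- t) is ever replaced by an equal one. The analytic facts are reduced to rational majorants: the
-- addition theorem to the exponential series of one rational number, uniqueness of coefficients to
-- a geometric series at rational t > 0, and the lower bound for exp(u) - 1 to a geometric tail.

𝔾 : Set
𝔾 = ℚ × ℚ

infixl 7 _⊠_
infixl 6 _⊞_

-- The formulas copy those for ℂ term by term, so that `at n (z * w)` computes to `at n z ⊠ at n w`,
-- and likewise for sums.
_⊞_ _⊠_ : 𝔾 → 𝔾 → 𝔾
(a , b) ⊞ (c , d) = a ℚ.+ c , b ℚ.+ d
(a , b) ⊠ (c , d) = a ℚ.* c ℚ.+ ℚ.- (b ℚ.* d) , a ℚ.* d ℚ.+ b ℚ.* c

⊟_ : 𝔾 → 𝔾
⊟ (a , b) = ℚ.- a , ℚ.- b

real : ℚ → 𝔾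
real q = q , 0ℚ

𝔾-ring : CommutativeRing 0ℓ 0ℓ
𝔾-ring = record
  { Carrier = 𝔾 ; _≈_ = _≡_ ; _+_ = _⊞_ ; _*_ = _⊠_ ; -_ = ⊟_ ; 0# = real 0ℚ ; 1# = real 1ℚ
  ; isCommutativeRing = record
    { isRing = record
      { +-isAbelianGroup = record
        { isGroup = record
          { isMonoid = record
            { isSemigroup = record
              { isMagma = record { isEquivalence = isEquivalence ; ∙-cong = cong₂ _⊞_ }
              ; assoc = λ (a , b) (c , d) (e , f) → cong₂ _,_ (ℚ.+-assoc a c e) (ℚ.+-assoc b d f) }
            ; identity = (λ (a , b) → cong₂ _,_ (ℚ.+-identityˡ a) (ℚ.+-identityˡ b))
                       , (λ (a , b) → cong₂ _,_ (ℚ.+-identityʳ a) (ℚ.+-identityʳ b)) }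
          ; inverse = (λ (a , b) → cong₂ _,_ (ℚ.+-inverseˡ a) (ℚ.+-inverseˡ b))
                    , (λ (a , b) → cong₂ _,_ (ℚ.+-inverseʳ a) (ℚ.+-inverseʳ b))
          ; ⁻¹-cong = cong ⊟_ }
        ; comm = λ (a , b) (c , d) → cong₂ _,_ (ℚ.+-comm a c) (ℚ.+-comm b d) }
      ; *-cong = cong₂ _⊠_
      ; *-assoc = λ (a , b) (c , d) (e , f) → cong₂ _,_
          (solve 6 (λ a b c d e f → (a :* c :+ :- (b :* d)) :* e :+ :- ((a :* d :+ b :* c) :* f)
                                 := a :* (c :* e :+ :- (d :* f)) :+ :- (b :* (c :* f :+ d :* e))) refl a b c d e f)
          (solve 6 (λ a b c d e f → (a :* c :+ :- (b :* d)) :* f :+ (a :* d :+ b :* c) :* e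
                                 := a :* (c :* f :+ d :* e) :+ b :* (c :* e :+ :- (d :* f))) refl a b c d e f)
      ; *-identity = (λ (a , b) → cong₂ _,_
            (solve 2 (λ a b → con 1ℚ :* a :+ :- (con 0ℚ :* b) := a) refl a b)
            (solve 2 (λ a b → con 1ℚ :* b :+ con 0ℚ :* a := b) refl a b))
          , (λ (a , b) → cong₂ _,_
            (solve 2 (λ a b → a :* con 1ℚ :+ :- (b :* con 0ℚ) := a) refl a b)
            (solve 2 (λ a b → a :* con 0ℚ :+ b :* con 1ℚ := b) refl a b))
      ; distrib = (λ (a , b) (c , d) (e , f) → cong₂ _,_
            (solve 6 (λ a b c d e f → a :* (c :+ e) :+ :- (b :* (d :+ f))
                                   := a :* c :+ :- (b :* d) :+ (a :* e :+ :- (b :* f))) refl a b c d e f)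
            (solve 6 (λ a b c d e f → a :* (d :+ f) :+ b :* (c :+ e)
                                   := a :* d :+ b :* c :+ (a :* f :+ b :* e)) refl a b c d e f))
          , (λ (a , b) (c , d) (e , f) → cong₂ _,_
            (solve 6 (λ a b c d e f → (c :+ e) :* a :+ :- ((d :+ f) :* b)
                                   := c :* a :+ :- (d :* b) :+ (e :* a :+ :- (f :* b))) refl a b c d e f)
            (solve 6 (λ a b c d e f → (c :+ e) :* b :+ (d :+ f) :* a
                                   := c :* b :+ d :* a :+ (e :* b :+ f :* a)) refl a b c d e f)) }
    ; *-comm = λ (a , b) (c , d) → cong₂ _,_
        (solve 4 (λ a b c d → a :* c :+ :- (b :* d) := c :* a :+ :- (d :* b)) refl a b c d)
        (solve 4 (λ a b c d → a :* d :+ b :* c := c :* b :+ d :* a) refl a b c d) } }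
  where open +-*-Solver

module 𝔾-Solver = RingSolver (ACR.fromCommutativeRing 𝔾-ring) (≡-dec ℚ._≟_ ℚ._≟_)

-- Complex numbers at one index, and their ℓ¹ norm

at : ℕ → ℂ → 𝔾
at n z = seq (re z) n , seq (im z) n

-- The ℓ¹ norm stays in ℚ, where the modulus would need a square root. It is submultiplicative and
-- exceeds the modulus by a factor of at most √2.
∥_∥ : 𝔾 → ℚ
∥ a , b ∥ = ℚ.∣ a ∣ ℚ.+ ℚ.∣ b ∣

∥∥-nonNeg : ∀ x → 0ℚ ℚ.≤ ∥ x ∥
∥∥-nonNeg (a , b) = ℚ.+-mono-≤ {0ℚ} {_} {0ℚ} (ℚ.0≤∣p∣ a) (ℚ.0≤∣p∣ b)

∥∥-⊞ : ∀ x y → ∥ x ⊞ y ∥ ℚ.≤ ∥ x ∥ ℚ.+ ∥ y ∥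
∥∥-⊞ (a , b) (c , d) = subst (∥ (a , b) ⊞ (c , d) ∥ ℚ.≤_)
  (solve 4 (λ a b c d → (a :+ c) :+ (b :+ d) := (a :+ b) :+ (c :+ d)) refl
    ℚ.∣ a ∣ ℚ.∣ b ∣ ℚ.∣ c ∣ ℚ.∣ d ∣)
  (ℚ.+-mono-≤ (ℚ.∣p+q∣≤∣p∣+∣q∣ a c) (ℚ.∣p+q∣≤∣p∣+∣q∣ b d))
  where open +-*-Solver

∥∥-⊟ : ∀ x → ∥ ⊟ x ∥ ≡ ∥ x ∥
∥∥-⊟ (a , b) = cong₂ ℚ._+_ (ℚ.∣-p∣≡∣p∣ a) (ℚ.∣-p∣≡∣p∣ b)

∥∥-⊠ : ∀ x y → ∥ x ⊠ y ∥ ℚ.≤ ∥ x ∥ ℚ.* ∥ y ∥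
∥∥-⊠ (a , b) (c , d) = ExpConvergence.size-* 0ℂ (fromℚ a +i fromℚ b) (fromℚ c +i fromℚ d) 0

∥∥-real : ∀ {q} → 0ℚ ℚ.≤ q → ∥ real q ∥ ≡ q
∥∥-real {q} 0≤q = trans (ℚ.+-identityʳ ℚ.∣ q ∣) (ℚ.0≤p⇒∣p∣≡p 0≤q)

-- Eventual bounds and equality of complex numbers

eventually-zip : ∀ {P Q R : ℕ → Set} → (∀ {n} → P n → Q n → R n) →
                 Eventually P → Eventually Q → Eventually R
eventually-zip h (M , p) (N , q) = M ℕ.⊔ N , λ n le →
  h (p n (ℕ.m⊔n≤o⇒m≤o M N le)) (q n (ℕ.m⊔n≤o⇒n≤o M N le))

infix 4 _≺_ _≋_

-- For the limit this lies between ∥ z ∥ < q and ∥ z ∥ ≤ q. Being strict at some index, it forces q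
-- > 0.
record _≺_ (z : ℂ) (q : ℚ) : Set where
  constructor mk≺
  field bound : Eventually λ n → ∥ at n z ∥ ℚ.< q

≺-map : ∀ {z w p q} → (∀ n → ∥ at n z ∥ ℚ.< p → ∥ at n w ∥ ℚ.< q) → z ≺ p → w ≺ q
≺-map h (mk≺ (N , p)) = mk≺ (N , λ n le → h n (p n le))

≺-resp : ∀ {z w q} → z ≺ q → (∀ n → at n z ≡ at n w) → w ≺ q
≺-resp {q = q} p eq = flip ≺-map p λ n → subst (λ x → ∥ x ∥ ℚ.< q) (eq n)

≺-weaken : ∀ {z p q} → p ℚ.≤ q → z ≺ p → z ≺ q
≺-weaken p≤q = ≺-map λ _ r → ℚ.<-≤-trans r p≤q

≺-zero : ∀ {q} → 0ℚ ℚ.< q → 0ℂ ≺ q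
≺-zero 0<q = mk≺ (0 , λ _ _ → 0<q)

≺-+ : ∀ {z w p q} → z ≺ p → w ≺ q → z + w ≺ p ℚ.+ q
≺-+ {z} {w} (mk≺ zp) (mk≺ wq) = mk≺ (eventually-zip
  (λ {n} r s → ℚ.≤-<-trans (∥∥-⊞ (at n z) (at n w)) (ℚ.+-mono-< r s)) zp wq)

≺-neg : ∀ {z q} → z ≺ q → - z ≺ q
≺-neg {z} {q} = ≺-map λ n → subst (ℚ._< q) (sym (∥∥-⊟ (at n z)))

≺-* : ∀ {z w p q} → z ≺ p → w ≺ q → z * w ≺ p ℚ.* q
≺-* {z} {w} {p} {q} (mk≺ zp) (mk≺ wq) = mk≺ (eventually-zip step zp wq)
  where
  step : ∀ {n} → ∥ at n z ∥ ℚ.< p → ∥ at n w ∥ ℚ.< q → ∥ at n (z * w) ∥ ℚ.< p ℚ.* q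
  step {n} r s = begin-strict
    ∥ at n (z * w) ∥            ≤⟨ ∥∥-⊠ (at n z) (at n w) ⟩
    ∥ at n z ∥ ℚ.* ∥ at n w ∥   ≤⟨ *-monoˡ (∥∥-nonNeg (at n w)) (ℚ.<⇒≤ r) ⟩
    p ℚ.* ∥ at n w ∥            <⟨ ℚ.*-monoʳ-<-pos p {{ℚ.positive 0<p}} s ⟩
    p ℚ.* q                     ∎
    where
    open ℚ.≤-Reasoning
    0<p = ℚ.≤-<-trans (∥∥-nonNeg (at n z)) r

≺-positive : ∀ {z q} → z ≺ q → 0ℚ ℚ.< q
≺-positive {z} (mk≺ (N , p)) = ℚ.≤-<-trans (∥∥-nonNeg (at N z)) (p N ℕ.≤-refl)

≺-bounded : ∀ z → ∃ λ B → 0ℚ ℚ.< B × z ≺ B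
≺-bounded z = 1ℚ ℚ.+ B , ≺-positive z≺ , z≺
  where
  open ExpConvergence z
  z≺ : z ≺ 1ℚ ℚ.+ B
  z≺ = mk≺ (0 , λ n _ → ℚ.≤-<-trans (size-≤-B n)
    (subst (ℚ._< 1ℚ ℚ.+ B) (ℚ.+-identityˡ B) (ℚ.+-monoˡ-< B (ℚ.positive⁻¹ 1ℚ))))

-- The same relation as _≈_, but as a record, so that z and w can be inferred.
-- The operations of ℂ cannot: they unfold to pairs of Cauchy sequences with
-- their moduli, so below arguments that only occur under them are given explicitly.
record _≋_ (z w : ℂ) : Set where
  constructor from-bounds
  field bounds : ∀ {ε} → 0ℚ ℚ.< ε → Eventually λ n → ∥ at n z ⊞ ⊟ at n w ∥ ℚ.< ε

mk≋ : ∀ {z w} → (∀ {ε} → 0ℚ ℚ.< ε → z - w ≺ ε) → z ≋ w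
mk≋ h = from-bounds λ 0<ε → _≺_.bound (h 0<ε)

diff : ∀ {z w ε} → z ≋ w → 0ℚ ℚ.< ε → z - w ≺ ε
diff z≋w 0<ε = mk≺ (_≋_.bounds z≋w 0<ε)

-- The bridge by which identities solved in `𝔾` become equalities of complex numbers.
≡⇒≋ : ∀ {z w} → (∀ n → at n z ≡ at n w) → z ≋ w
≡⇒≋ {z} {w} eq = mk≋ λ 0<ε → ≺-resp (≺-zero 0<ε) λ n →
    subst (λ x → at n 0ℂ ≡ x ⊞ ⊟ at n w) (sym (eq n)) (w-w≡0 n)
  where
  open 𝔾-Solver
  w-w≡0 : ∀ n → at n 0ℂ ≡ at n (w - w)
  w-w≡0 n = solve 1 (λ x → con (real 0ℚ) := x :- x) refl (at n w)

≋-refl : ∀ {z} → z ≋ z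
≋-refl = ≡⇒≋ λ _ → refl

≋-sym : ∀ {z w} → z ≋ w → w ≋ z
≋-sym {z} {w} z≋w = mk≋ λ 0<ε → ≺-resp
  (≺-neg (diff z≋w 0<ε)) (λ n → solve 2 (λ z w → :- (z :- w) := w :- z) refl (at n z) (at n w))
  where open 𝔾-Solver

≺-halves : ∀ {x y ε} → x ≺ ½ ℚ.* ε → y ≺ ½ ℚ.* ε → x + y ≺ ε
≺-halves {x} {y} {ε} p q = subst (x + y ≺_) (half+half ε) (≺-+ {x} {y} p q)

≋-trans : ∀ {x y z} → x ≋ y → y ≋ z → x ≋ z
≋-trans {x} {y} {z} p q = mk≋ λ 0<ε → ≺-resp
  (≺-halves (diff p (half-pos 0<ε)) (diff q (half-pos 0<ε)))
  (λ n → solve 3 (λ x y z → (x :- y) :+ (y :- z) := x :- z) refl (at n x) (at n y) (at n z))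
  where open 𝔾-Solver

ℂ-setoid : Setoid 0ℓ 0ℓ
ℂ-setoid = record
  { Carrier = ℂ ; _≈_ = _≋_
  ; isEquivalence = record { refl = ≋-refl ; sym = ≋-sym ; trans = ≋-trans } }

+-cong : ∀ {x y u v} → x ≋ y → u ≋ v → x + u ≋ y + v
+-cong {x} {y} {u} {v} p q = mk≋ λ 0<ε → ≺-resp
  (≺-halves (diff p (half-pos 0<ε)) (diff q (half-pos 0<ε)))
  (λ n → solve 4 (λ x y u v → (x :- y) :+ (u :- v) := (x :+ u) :- (y :+ v)) refl
    (at n x) (at n y) (at n u) (at n v))
  where open 𝔾-Solver

≺-scale : ∀ {x z B ε} → z ≺ B → 0ℚ ℚ.< B → x ≺ ε ℚ.* inv B → z * x ≺ ε
≺-scale {x} {z} {B} {ε} z≺B 0<B x≺ = subst (z * x ≺_)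
  (trans (solve 3 (λ b e i → b :* (e :* i) := e :* (b :* i)) refl B ε (inv B))
    (trans (cong (ε ℚ.*_) (inv-inverse 0<B)) (ℚ.*-identityʳ ε)))
  (≺-* {z} {x} z≺B x≺)
  where open +-*-Solver

*-congˡ : ∀ {x y} z → x ≋ y → z * x ≋ z * y
*-congˡ {x} {y} z p = mk≋ λ 0<ε → let B , 0<B , z≺B = ≺-bounded z in ≺-resp
  (≺-scale z≺B 0<B (diff p (*-pos 0<ε (inv-pos 0<B))))
  (λ n → solve 3 (λ x y z → z :* (x :- y) := z :* x :- z :* y) refl (at n x) (at n y) (at n z))
  where open 𝔾-Solver

*-comm : ∀ x y → x * y ≋ y * x
*-comm x y = ≡⇒≋ λ n → solve 2 (λ x y → x :* y := y :* x) refl (at n x) (at n y)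
  where open 𝔾-Solver

*-cong : ∀ {x y u v} → x ≋ y → u ≋ v → x * u ≋ y * v
*-cong {x} {y} {u} {v} p q = ≋-trans (*-congˡ {u} {v} x q)
  (≋-trans (*-comm x v) (≋-trans (*-congˡ {x} {y} v p) (*-comm v y)))

^-cong : ∀ {x y} → x ≋ y → ∀ n → x ^ n ≋ y ^ n
^-cong p zero    = ≋-refl
^-cong {x} {y} p (suc n) = *-cong {x} {y} {x ^ n} {y ^ n} p (^-cong p n)

≈⇒≋ : ∀ {z w} → z ≈ w → z ≋ w
≈⇒≋ (p , q) = mk≋ λ 0<ε → mk≺ (eventually-zip sum-< (p _ (half-pos 0<ε)) (q _ (half-pos 0<ε)))

≋⇒≈ : ∀ {z w} → z ≋ w → z ≈ w
≋⇒≈ {z} {w} p = (λ ε 0<ε → proj₁ (_≺_.bound (diff p 0<ε)) , λ n le →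
       ℚ.≤-<-trans (subst (ℚ._≤ ∥ at n (z - w) ∥) (ℚ.+-identityʳ _)
         (ℚ.+-monoʳ-≤ ℚ.∣ seq (re (z - w)) n ∣ (ℚ.0≤∣p∣ (seq (im (z - w)) n))))
         (proj₂ (_≺_.bound (diff p 0<ε)) n le))
  , (λ ε 0<ε → proj₁ (_≺_.bound (diff p 0<ε)) , λ n le →
       ℚ.≤-<-trans (subst (ℚ._≤ ∥ at n (z - w) ∥) (ℚ.+-identityˡ _)
         (ℚ.+-monoˡ-≤ ℚ.∣ seq (im (z - w)) n ∣ (ℚ.0≤∣p∣ (seq (re (z - w)) n))))
         (proj₂ (_≺_.bound (diff p 0<ε)) n le))

-- Limits of complex sequences

infix 4 _↦_

-- The counterpart of `_⟶_` with rational ε and the ℓ¹ norm. Here `n` indexes the sequence and `k`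
-- the rational approximations; the threshold for `k` may depend on `n`.
record _↦_ (s : ℕ → ℂ) (l : ℂ) : Set where
  constructor from-bounds
  field bounds : ∀ {ε} → 0ℚ ℚ.< ε → Eventually λ n → Eventually λ k → ∥ at k (s n) ⊞ ⊟ at k l ∥ ℚ.< ε

mk↦ : ∀ {s l} → (∀ {ε} → 0ℚ ℚ.< ε → Eventually λ n → s n - l ≺ ε) → s ↦ l
mk↦ h = from-bounds λ 0<ε → proj₁ (h 0<ε) , λ n le → _≺_.bound (proj₂ (h 0<ε) n le)

tends : ∀ {s l ε} → s ↦ l → 0ℚ ℚ.< ε → Eventually λ n → s n - l ≺ ε
tends p 0<ε = proj₁ (_↦_.bounds p 0<ε) , λ n le → mk≺ (proj₂ (_↦_.bounds p 0<ε) n le)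

↦-unique : ∀ {s l m} → s ↦ l → s ↦ m → l ≋ m
↦-unique {s} {l} {m} p q = mk≋ λ 0<ε →
  let N , r = tends p (half-pos 0<ε)
      M , t = tends q (half-pos 0<ε)
      n = N ℕ.⊔ M
  in ≺-resp (≺-halves (≺-neg {s n - l} (r n (ℕ.m≤m⊔n N M))) (t n (ℕ.m≤n⊔m N M)))
       (λ k → solve 3 (λ s l m → :- (s :- l) :+ (s :- m) := l :- m) refl (at k (s n)) (at k l) (at k m))
  where open 𝔾-Solver

↦-close : ∀ {s t l} →
  (∀ {ε} → 0ℚ ℚ.< ε → Eventually λ n → Eventually λ k → ∥ at k (t n) ⊞ ⊟ at k (s n) ∥ ℚ.< ε) →
  s ↦ l → t ↦ l
↦-close {s} {t} {l} close p = mk↦ λ 0<ε →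
  let M , q = close (half-pos 0<ε)
      N , r = tends p (half-pos 0<ε)
  in M ℕ.⊔ N , λ n le → ≺-resp
       (≺-halves {s n - l} {t n - s n} (r n (ℕ.m⊔n≤o⇒n≤o M N le)) (mk≺ (q n (ℕ.m⊔n≤o⇒m≤o M N le))))
       (λ k → solve 3 (λ s t l → (s :- l) :+ (t :- s) := t :- l) refl (at k (s n)) (at k (t n)) (at k l))
  where open 𝔾-Solver

↦-resp : ∀ {s t l} → (∀ n → s n ≋ t n) → s ↦ l → t ↦ l
↦-resp {s} {t} eq = ↦-close {s} {t} λ 0<ε → 0 , λ n _ → _≋_.bounds (≋-sym (eq n)) 0<ε

↦-respʳ : ∀ {s l m} → l ≋ m → s ↦ l → s ↦ m
↦-respʳ {s} {l} {m} eq p = mk↦ λ 0<ε → let N , r = tends p (half-pos 0<ε) in N , λ n le → ≺-resp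
  (≺-halves (r n le) (diff eq (half-pos 0<ε)))
  (λ k → solve 3 (λ s l m → (s :- l) :+ (l :- m) := s :- m) refl (at k (s n)) (at k l) (at k m))
  where open 𝔾-Solver

↦-shift : ∀ {s l} → s ↦ l → (λ n → s (suc n)) ↦ l
↦-shift p = from-bounds λ 0<ε → let N , r = _↦_.bounds p 0<ε in N , λ n le → r (suc n) (ℕ.m≤n⇒m≤1+n le)

↦-const : ∀ l → (λ _ → l) ↦ l
↦-const l = from-bounds λ 0<ε → 0 , λ _ _ → _≋_.bounds (≋-refl {l}) 0<ε

↦-+ : ∀ {s t l m} → s ↦ l → t ↦ m → (λ n → s n + t n) ↦ l + m
↦-+ {s} {t} {l} {m} p q = mk↦ λ 0<ε → eventually-zip {R = λ n → (s n + t n) - (l + m) ≺ _}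
  (λ {n} a b → ≺-resp
    (≺-halves a b)
    (λ k → solve 4 (λ s t l m → (s :- l) :+ (t :- m) := (s :+ t) :- (l :+ m)) refl
      (at k (s n)) (at k (t n)) (at k l) (at k m))) (tends p (half-pos 0<ε)) (tends q (half-pos 0<ε))
  where open 𝔾-Solver

↦-neg : ∀ {s l} → s ↦ l → (λ n → - s n) ↦ - l
↦-neg {s} {l} p = mk↦ λ 0<ε → let N , r = tends p 0<ε in N , λ n le → ≺-resp
  (≺-neg (r n le))
  (λ k → solve 2 (λ s l → :- (s :- l) := :- s :- :- l) refl (at k (s n)) (at k l))
  where open 𝔾-Solver

↦-* : ∀ {s t l m} → s ↦ l → t ↦ m → (λ n → s n * t n) ↦ l * m
↦-* {s} {t} {l} {m} p q = mk↦ λ 0<ε →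
  let B , 0<B , m≺B = ≺-bounded m
      C , 0<C , l≺C = ≺-bounded l
      -- `s n` is `l` plus a difference that is eventually below 1, so `C + 1` bounds it.
      0<C+1 = ℚ.+-mono-<-≤ {0ℚ} {C} {0ℚ} {1ℚ} 0<C (ℚ.nonNegative⁻¹ 1ℚ)
  in eventually-zip {R = λ n → (s n * t n) - (l * m) ≺ _}
      (λ {n} (a , c) b → ≺-resp
        (≺-halves (≺-scale (≺-+ {l} {s n - l} l≺C c) 0<C+1 b) (≺-scale m≺B 0<B a))
        (λ k → solve 4 (λ s t l m → (l :+ (s :- l)) :* (t :- m) :+ m :* (s :- l) := s :* t :- l :* m) refl
          (at k (s n)) (at k (t n)) (at k l) (at k m)))
      (eventually-zip _,_ (tends p (*-pos (half-pos 0<ε) (inv-pos 0<B))) (tends p (ℚ.positive⁻¹ 1ℚ)))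
      (tends q (*-pos (half-pos 0<ε) (inv-pos 0<C+1)))
  where open 𝔾-Solver

-- Cauchy products and the addition theorem for the exponential

module Convolution (R : CommutativeRing 0ℓ 0ℓ) where

  open CommutativeRing R
    using (Carrier; 0#; commutativeSemiring; +-assoc; *-assoc; distribʳ)
    renaming (_≈_ to _∼_; _+_ to _⊕_; _*_ to _⊗_; +-cong to ⊕-cong; +-congˡ to ⊕-congˡ;
              +-congʳ to ⊕-congʳ; *-congˡ to ⊗-congˡ; *-congʳ to ⊗-congʳ;
             
              refl to ∼-refl; trans to ∼-trans)
  open SemiringSolver commutativeSemiring using (solve; con; _:+_; _:*_; _:=_)

  sum : (ℕ → Carrier) → ℕ → Carrier
  sum a zero    = 0#
  sum a (suc n) = sum a n ⊕ a n

  -- Peeling coefficients off `a` avoids the truncated subtraction in the usual sum of a(k) b(n -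
  -- k).
  conv : (ℕ → Carrier) → (ℕ → Carrier) → ℕ → Carrier
  conv a b zero    = a 0 ⊗ b 0
  conv a b (suc n) = a 0 ⊗ b (suc n) ⊕ conv (a ∘ suc) b n

  sum-head : ∀ a n → sum a (suc n) ∼ a 0 ⊕ sum (a ∘ suc) n
  sum-head a zero    = solve 1 (λ x → con 0 :+ x := x :+ con 0) ∼-refl (a 0)
  sum-head a (suc n) = ∼-trans (⊕-congʳ (sum-head a n))
    (+-assoc (a 0) (sum (a ∘ suc) n) (a (suc n)))

  -- The triangle i + j ≤ n consists of its row i = 0 and a smaller triangle for the shifted
  -- sequence.
  sum-conv : ∀ a b n → sum (conv a b) (suc n) ∼ a 0 ⊗ sum b (suc n) ⊕ sum (conv (a ∘ suc) b) n
  sum-conv a b zero    = solve 2 (λ x y → con 0 :+ x :* y := x :* (con 0 :+ y) :+ con 0)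
    ∼-refl (a 0) (b 0)
  sum-conv a b (suc n) = ∼-trans (⊕-congʳ (sum-conv a b n))
    (solve 5 (λ x s t y c → (x :* s :+ t) :+ (x :* y :+ c) := x :* (s :+ y) :+ (t :+ c))
      ∼-refl (a 0) (sum b (suc n)) (sum (conv (a ∘ suc) b) n) (b (suc n)) (conv (a ∘ suc) b n))

  sum-cong : ∀ {a b} → (∀ n → a n ∼ b n) → ∀ n → sum a n ∼ sum b n
  sum-cong eq zero    = ∼-refl
  sum-cong eq (suc n) = ⊕-cong (sum-cong eq n) (eq n)

  conv-congˡ : ∀ {a a′} b → (∀ n → a n ∼ a′ n) → ∀ n → conv a b n ∼ conv a′ b n
  conv-congˡ b eq zero    = ⊗-congʳ (eq 0)
  conv-congˡ b eq (suc n) = ⊕-cong (⊗-congʳ (eq 0)) (conv-congˡ b (eq ∘ suc) n)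

  conv-congʳ : ∀ a {b b′} → (∀ n → b n ∼ b′ n) → ∀ n → conv a b n ∼ conv a b′ n
  conv-congʳ a eq zero    = ⊗-congˡ (eq 0)
  conv-congʳ a eq (suc n) = ⊕-cong (⊗-congˡ (eq (suc n))) (conv-congʳ (a ∘ suc) eq n)

  conv-+ˡ : ∀ a a′ b n → conv (λ k → a k ⊕ a′ k) b n ∼ conv a b n ⊕ conv a′ b n
  conv-+ˡ a a′ b zero    = distribʳ (b 0) (a 0) (a′ 0)
  conv-+ˡ a a′ b (suc n) = ∼-trans (⊕-congˡ (conv-+ˡ (a ∘ suc) (a′ ∘ suc) b n))
    (solve 5 (λ x x′ y c c′ → (x :+ x′) :* y :+ (c :+ c′) := (x :* y :+ c) :+ (x′ :* y :+ c′))
      ∼-refl (a 0) (a′ 0) (b (suc n)) (conv (a ∘ suc) b n) (conv (a′ ∘ suc) b n))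

  conv-*ˡ : ∀ z a b n → conv (λ k → z ⊗ a k) b n ∼ z ⊗ conv a b n
  conv-*ˡ z a b zero    = *-assoc z (a 0) (b 0)
  conv-*ˡ z a b (suc n) = ∼-trans (⊕-congˡ (conv-*ˡ z (a ∘ suc) b n))
    (solve 4 (λ z x y c → z :* x :* y :+ z :* c := z :* (x :* y :+ c))
      ∼-refl z (a 0) (b (suc n)) (conv (a ∘ suc) b n))

  conv-*ʳ : ∀ z a b n → conv a (λ k → z ⊗ b k) n ∼ z ⊗ conv a b n
  conv-*ʳ z a b zero    = solve 3 (λ z x y → x :* (z :* y) := z :* (x :* y))
    ∼-refl z (a 0) (b 0)
  conv-*ʳ z a b (suc n) = ∼-trans (⊕-congˡ (conv-*ʳ z (a ∘ suc) b n))
    (solve 4 (λ z x y c → x :* (z :* y) :+ z :* c := z :* (x :* y :+ c))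
      ∼-refl z (a 0) (b (suc n)) (conv (a ∘ suc) b n))

-- ν n stands for the image of n in R, and κ n for 1 / (n + 1).
module ExponentialSequences
  (R : CommutativeRing 0ℓ 0ℓ) (ν κ : ℕ → CommutativeRing.Carrier R)
  (ν-1 : CommutativeRing._≈_ R (ν 1) (CommutativeRing.1# R))
  (ν-suc : ∀ n → CommutativeRing._≈_ R (ν (suc n)) (CommutativeRing._+_ R (CommutativeRing.1# R) (ν n)))
  (κ-inverse : ∀ n → CommutativeRing._≈_ R (CommutativeRing._*_ R (κ n) (ν (suc n))) (CommutativeRing.1# R))
  where

  open CommutativeRing R
    using (Carrier; 1#; setoid; commutativeSemiring; *-assoc; *-identityˡ; distribʳ)
    renaming (_≈_ to _∼_; _+_ to _⊕_; _*_ to _⊗_; +-cong to ⊕-cong; +-congˡ to ⊕-congˡ;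
              +-congʳ to ⊕-congʳ; *-congˡ to ⊗-congˡ; *-congʳ to ⊗-congʳ;
              *-cong to ⊗-cong;
              refl to ∼-refl; sym to ∼-sym; trans to ∼-trans)
  open Convolution R
  open SemiringSolver commutativeSemiring using (solve; con; _:+_; _:*_; _:=_)
  open SetoidReasoning setoid

  derivative : (ℕ → Carrier) → ℕ → Carrier
  derivative a n = ν (suc n) ⊗ a (suc n)

  -- The product rule for formal power series. The derivative of the shift falls short of the
  -- shifted derivative by a(k + 2); the extra copy of `c` obtained from ν(n + 2) = 1 + ν(n + 1)
  -- makes up for it.
  leibniz : ∀ a b n → derivative (conv a b) n ∼ conv (derivative a) b n ⊕ conv a (derivative b) n
  leibniz a b zero    = solve 5 (λ m x y x′ y′ → m :* (x :* y′ :+ x′ :* y) := m :* x′ :* y :+ x :* (m :* y′))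
    ∼-refl (ν 1) (a 0) (b 0) (a 1) (b 1)
  leibniz a b (suc n) = begin
    ν (suc (suc n)) ⊗ (a 0 ⊗ b (suc (suc n)) ⊕ c)
      ≈⟨ solve 4 (λ m x y c → m :* (x :* y :+ c) := x :* (m :* y) :+ m :* c) ∼-refl
           (ν (suc (suc n))) (a 0) (b (suc (suc n))) c ⟩
    a 0 ⊗ derivative b (suc n) ⊕ ν (suc (suc n)) ⊗ c
      ≈⟨ ⊕-congˡ (∼-trans (⊗-congʳ (ν-suc (suc n)))
           (solve 2 (λ m c → (con 1 :+ m) :* c := c :+ m :* c) ∼-refl (ν (suc n)) c)) ⟩
    a 0 ⊗ derivative b (suc n) ⊕ (c ⊕ ν (suc n) ⊗ c)
      ≈⟨ ⊕-congˡ (⊕-congˡ (leibniz (a ∘ suc) b n)) ⟩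
    a 0 ⊗ derivative b (suc n) ⊕ (a 1 ⊗ b (suc n) ⊕ c′ ⊕ (conv (derivative (a ∘ suc)) b n ⊕ d))
      ≈⟨ solve 6 (λ x y c′ u v d → x :+ (y :* u :+ c′ :+ (v :+ d)) := y :* u :+ (v :+ c′) :+ (x :+ d)) ∼-refl
           (a 0 ⊗ derivative b (suc n)) (a 1) c′ (b (suc n)) (conv (derivative (a ∘ suc)) b n) d ⟩
    a 1 ⊗ b (suc n) ⊕ (conv (derivative (a ∘ suc)) b n ⊕ c′) ⊕ (a 0 ⊗ derivative b (suc n) ⊕ d)
      ≈⟨ ⊕-congʳ (⊕-cong (⊗-congʳ (∼-trans (∼-sym (*-identityˡ (a 1))) (⊗-congʳ (∼-sym ν-1)))) (begin
           conv (derivative (a ∘ suc)) b n ⊕ c′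
             ≈⟨ ∼-sym (conv-+ˡ (derivative (a ∘ suc)) (a ∘ suc ∘ suc) b n) ⟩
           conv (λ k → derivative (a ∘ suc) k ⊕ a (suc (suc k))) b n
             ≈⟨ conv-congˡ b (λ k → ∼-trans
                  (solve 2 (λ m x → m :* x :+ x := (con 1 :+ m) :* x) ∼-refl (ν (suc k)) (a (suc (suc k))))
                  (⊗-congʳ (∼-sym (ν-suc (suc k))))) n ⟩
           conv (derivative a ∘ suc) b n ∎)) ⟩
    derivative a 0 ⊗ b (suc n) ⊕ conv (derivative a ∘ suc) b n ⊕ (a 0 ⊗ derivative b (suc n) ⊕ d) ∎
    where
    c = conv (a ∘ suc) b (suc n)
    c′ = conv (a ∘ suc ∘ suc) b n
    d = conv (a ∘ suc) (derivative b) n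

  -- Characterises a n = zⁿ / n!.
  record IsExponential (z : Carrier) (a : ℕ → Carrier) : Set where
    field
      initial : a 0 ∼ 1#
      step    : ∀ n → derivative a n ∼ z ⊗ a n

  open IsExponential

  -- Solutions of y′ = z y and y′ = w y with y(0) = 1 multiply to a solution for z + w. Together
  -- with uniqueness this replaces the binomial theorem.
  conv-isExponential : ∀ {z w a b} → IsExponential z a → IsExponential w b → IsExponential (z ⊕ w) (conv a b)
  initial (conv-isExponential p q) = ∼-trans (⊗-cong (initial p) (initial q)) (*-identityˡ 1#)
  step (conv-isExponential {z} {w} {a} {b} p q) n = begin
    derivative (conv a b) n
      ≈⟨ leibniz a b n ⟩
    conv (derivative a) b n ⊕ conv a (derivative b) n
      ≈⟨ ⊕-cong (∼-trans (conv-congˡ b (step p) n) (conv-*ˡ z a b n))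
                (∼-trans (conv-congʳ a (step q) n) (conv-*ʳ w a b n)) ⟩
    z ⊗ conv a b n ⊕ w ⊗ conv a b n
      ≈⟨ ∼-sym (distribʳ (conv a b n) z w) ⟩
    (z ⊕ w) ⊗ conv a b n ∎

  exponential-unique : ∀ {z a b} → IsExponential z a → IsExponential z b → ∀ n → a n ∼ b n
  exponential-unique p q zero    = ∼-trans (initial p) (∼-sym (initial q))
  exponential-unique {z} {a} {b} p q (suc n) = ∼-trans (divide a (step p n))
    (∼-trans (⊗-congˡ (⊗-congˡ (exponential-unique p q n))) (∼-sym (divide b (step q n))))
    where
    divide : ∀ c → derivative c n ∼ z ⊗ c n → c (suc n) ∼ κ n ⊗ (z ⊗ c n)
    divide c eq = begin
      c (suc n)                     ≈⟨ ∼-sym (*-identityˡ (c (suc n))) ⟩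
      1# ⊗ c (suc n)                ≈⟨ ⊗-congʳ (∼-sym (κ-inverse n)) ⟩
      κ n ⊗ ν (suc n) ⊗ c (suc n)   ≈⟨ *-assoc (κ n) (ν (suc n)) (c (suc n)) ⟩
      κ n ⊗ (ν (suc n) ⊗ c (suc n)) ≈⟨ ⊗-congˡ eq ⟩
      κ n ⊗ (z ⊗ c n)               ∎

module ℚ-Conv = Convolution ℚ.+-*-commutativeRing
module 𝔾-Conv = Convolution 𝔾-ring

ν-inverse : ∀ n → inv (ratio (suc n)) ℚ.* ratio (suc n) ≡ 1ℚ
ν-inverse n = trans (ℚ.*-comm (inv (ratio (suc n))) (ratio (suc n))) (inv-inverse (ratio-pos n))

real-⊠ : ∀ p q → real p ⊠ real q ≡ real (p ℚ.* q)
real-⊠ p q = cong₂ _,_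
  (solve 2 (λ p q → p :* q :+ :- (con 0ℚ :* con 0ℚ) := p :* q) refl p q)
  (solve 2 (λ p q → p :* con 0ℚ :+ con 0ℚ :* q := con 0ℚ) refl p q)
  where open +-*-Solver

module ℚ-Exp = ExponentialSequences ℚ.+-*-commutativeRing ratio (λ n → inv (ratio (suc n)))
  refl ratio-suc ν-inverse
module 𝔾-Exp = ExponentialSequences 𝔾-ring (λ n → real (ratio n)) (λ n → real (inv (ratio (suc n))))
  refl (λ n → cong real (ratio-suc n))
  (λ n → trans (real-⊠ (inv (ratio (suc n))) (ratio (suc n))) (cong real (ν-inverse n)))

at-partialSum : ∀ c n j → at j (partialSum c n) ≡ 𝔾-Conv.sum (λ k → at j (c k)) n
at-partialSum c zero    j = refl
at-partialSum c (suc n) j = cong (_⊞ at j (c n)) (at-partialSum c n j)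

invFact-step : ∀ n → ratio (suc n) ℚ.* invFact (suc n) ≡ invFact n
invFact-step n = begin
  r ℚ.* invFact (suc n)     ≡⟨ cong (r ℚ.*_) (invFact-suc n) ⟩
  r ℚ.* (invFact n ℚ.* inv r)
    ≡⟨ solve 3 (λ r f i → r :* (f :* i) := f :* (r :* i)) refl r (invFact n) (inv r) ⟩
  invFact n ℚ.* (r ℚ.* inv r) ≡⟨ cong (invFact n ℚ.*_) (inv-inverse (ratio-pos n)) ⟩
  invFact n ℚ.* 1ℚ            ≡⟨ ℚ.*-identityʳ _ ⟩
  invFact n                   ∎
  where
  open ≡-Reasoning
  open +-*-Solver
  r = ratio (suc n)

expTerm-isExponential : ∀ z j → 𝔾-Exp.IsExponential (at j z) (λ k → at j (expTerm z k))
expTerm-isExponential z j = record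
  { initial = refl
  ; step = λ n → trans
      (solve 4 (λ r i x p → r :* (i :* (x :* p)) := x :* ((r :* i) :* p)) refl
        (real (ratio (suc n))) (real (invFact (suc n))) (at j z) (at j (z ^ n)))
      (cong (λ y → at j z ⊠ (y ⊠ at j (z ^ n))) (trans
        (real-⊠ (ratio (suc n)) (invFact (suc n))) (cong real (invFact-step n))))
  }
  where open 𝔾-Solver

expBound-isExponential : ∀ B (0≤B : 0ℚ ℚ.≤ B) → ℚ-Exp.IsExponential B (ExpBound.expBound B 0≤B)
expBound-isExponential B 0≤B = record
  { initial = refl
  ; step = λ n → trans
      (solve 4 (λ r i x p → r :* (i :* (x :* p)) := x :* ((r :* i) :* p)) refl
        (ratio (suc n)) (invFact (suc n)) B (pow B n))
      (cong (λ y → B ℚ.* (y ℚ.* pow B n)) (invFact-step n))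
  }
  where open +-*-Solver

module _ where
  open ℚ-Conv

  sum-mono : ∀ {a} → (∀ k → 0ℚ ℚ.≤ a k) → ∀ {m n} → m ℕ.≤′ n → sum a m ℚ.≤ sum a n
  sum-mono a≥0 (ℕ.≤′-reflexive refl) = ℚ.≤-refl
  sum-mono {a} a≥0 {m} (ℕ.≤′-step {n} p) = ℚ.≤-trans (sum-mono a≥0 {m} {n} p)
    (subst (ℚ._≤ sum a (suc n)) (ℚ.+-identityʳ (sum a n)) (ℚ.+-monoʳ-≤ (sum a n) (a≥0 n)))

  sum-nonNeg : ∀ {a} → (∀ k → 0ℚ ℚ.≤ a k) → ∀ n → 0ℚ ℚ.≤ sum a n
  sum-nonNeg a≥0 n = sum-mono a≥0 {0} {n} (ℕ.≤⇒≤′ ℕ.z≤n)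

  conv-nonNeg : ∀ {a b} → (∀ k → 0ℚ ℚ.≤ a k) → (∀ k → 0ℚ ℚ.≤ b k) → ∀ n → 0ℚ ℚ.≤ conv a b n
  conv-nonNeg a≥0 b≥0 zero    = *-nonNeg (a≥0 0) (b≥0 0)
  conv-nonNeg a≥0 b≥0 (suc n) = ℚ.+-mono-≤ {0ℚ} {_} {0ℚ} (*-nonNeg (a≥0 0) (b≥0 (suc n)))
    (conv-nonNeg (a≥0 ∘ suc) b≥0 n)

  -- The index pairs of the product form a square inside the triangle i + j < n + m.
  product≤sum-conv : ∀ {a b} → (∀ k → 0ℚ ℚ.≤ a k) → (∀ k → 0ℚ ℚ.≤ b k) →
                     ∀ n m → sum a n ℚ.* sum b m ℚ.≤ sum (conv a b) (n ℕ.+ m)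
  product≤sum-conv {a} {b} a≥0 b≥0 zero m = subst (ℚ._≤ sum (conv a b) m) (sym (ℚ.*-zeroˡ (sum b m)))
    (sum-nonNeg (conv-nonNeg a≥0 b≥0) m)
  product≤sum-conv {a} {b} a≥0 b≥0 (suc n) m = begin
    sum a (suc n) ℚ.* sum b m
      ≡⟨ cong (ℚ._* sum b m) (sum-head a n) ⟩
    (a 0 ℚ.+ sum (a ∘ suc) n) ℚ.* sum b m
      ≡⟨ ℚ.*-distribʳ-+ (sum b m) (a 0) (sum (a ∘ suc) n) ⟩
    a 0 ℚ.* sum b m ℚ.+ sum (a ∘ suc) n ℚ.* sum b m
      ≤⟨ ℚ.+-mono-≤ (*-monoʳ (a≥0 0) (sum-mono b≥0 {m} {suc n ℕ.+ m} (ℕ.≤⇒≤′ (ℕ.m≤n+m m (suc n)))))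
           (product≤sum-conv (a≥0 ∘ suc) b≥0 n m) ⟩
    a 0 ℚ.* sum b (suc n ℕ.+ m) ℚ.+ sum (conv (a ∘ suc) b) (n ℕ.+ m)
      ≡⟨ sym (sum-conv a b (n ℕ.+ m)) ⟩
    sum (conv a b) (suc n ℕ.+ m) ∎
    where open ℚ.≤-Reasoning

p≤∣p∣ : ∀ p → p ℚ.≤ ℚ.∣ p ∣
p≤∣p∣ p = [ (λ 0≤p → ℚ.≤-reflexive (sym (ℚ.0≤p⇒∣p∣≡p 0≤p)))
          , (λ p≤0 → ℚ.≤-trans p≤0 (ℚ.0≤∣p∣ p)) ]′ (ℚ.≤-total 0ℚ p)

tail-dominated : ∀ {b β} → (∀ k → ∥ b k ∥ ℚ.≤ β k) → ∀ {m n} → m ℕ.≤′ n →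
  ∥ 𝔾-Conv.sum b n ⊞ ⊟ 𝔾-Conv.sum b m ∥ ℚ.≤ ℚ-Conv.sum β n ℚ.- ℚ-Conv.sum β m
tail-dominated {b} {β} b≤β {m} (ℕ.≤′-reflexive refl) = ℚ.≤-reflexive (trans
  (cong ∥_∥ (CommutativeRing.-‿inverseʳ 𝔾-ring (𝔾-Conv.sum b m))) (sym (ℚ.+-inverseʳ (ℚ-Conv.sum β m))))
tail-dominated {b} {β} b≤β {m} (ℕ.≤′-step {n} p) = begin
  ∥ 𝔾-Conv.sum b (suc n) ⊞ ⊟ 𝔾-Conv.sum b m ∥
    ≡⟨ cong ∥_∥ (solve 3 (λ s x t → (s :+ x) :- t := (s :- t) :+ x) refl
         (𝔾-Conv.sum b n) (b n) (𝔾-Conv.sum b m)) ⟩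
  ∥ (𝔾-Conv.sum b n ⊞ ⊟ 𝔾-Conv.sum b m) ⊞ b n ∥
    ≤⟨ ∥∥-⊞ (𝔾-Conv.sum b n ⊞ ⊟ 𝔾-Conv.sum b m) (b n) ⟩
  ∥ 𝔾-Conv.sum b n ⊞ ⊟ 𝔾-Conv.sum b m ∥ ℚ.+ ∥ b n ∥
    ≤⟨ ℚ.+-mono-≤ (tail-dominated b≤β p) (b≤β n) ⟩
  (ℚ-Conv.sum β n ℚ.- ℚ-Conv.sum β m) ℚ.+ β n
    ≡⟨ ℚS.solve 3 (λ s t x → (s ℚS.:- t) ℚS.:+ x ℚS.:= (s ℚS.:+ x) ℚS.:- t) refl
         (ℚ-Conv.sum β n) (ℚ-Conv.sum β m) (β n) ⟩
  ℚ-Conv.sum β (suc n) ℚ.- ℚ-Conv.sum β m ∎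
  where
  open ℚ.≤-Reasoning
  open 𝔾-Solver
  module ℚS = +-*-Solver

-- The difference collects the products a(i) b(j) with i < n and j < m outside the triangle i + j <
-- n, each of norm at most α(i) β(j). The length `m` stays fixed while the induction removes the row
-- i = 0; n ≤ m keeps the triangle inside the rectangle.
product-dominated : ∀ {a α b β} → (∀ k → ∥ a k ∥ ℚ.≤ α k) → (∀ k → ∥ b k ∥ ℚ.≤ β k) → ∀ {n m} → n ℕ.≤ m →
  ∥ 𝔾-Conv.sum a n ⊠ 𝔾-Conv.sum b m ⊞ ⊟ 𝔾-Conv.sum (𝔾-Conv.conv a b) n ∥ ℚ.≤
  ℚ-Conv.sum α n ℚ.* ℚ-Conv.sum β m ℚ.- ℚ-Conv.sum (ℚ-Conv.conv α β) n
product-dominated {b = b} {β} a≤α b≤β {zero} {m} _ = ℚ.≤-reflexive (trans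
  (cong ∥_∥ (solve 1 (λ s → con (real 0ℚ) :* s :- con (real 0ℚ) := con (real 0ℚ)) refl (𝔾-Conv.sum b m)))
  (ℚS.solve 1 (λ s → ℚS.con 0ℚ ℚS.:= ℚS.con 0ℚ ℚS.:* s ℚS.:- ℚS.con 0ℚ) refl (ℚ-Conv.sum β m)))
  where
  open 𝔾-Solver
  module ℚS = +-*-Solver
product-dominated {a} {α} {b} {β} a≤α b≤β {suc n} {m} n<m = begin
  ∥ 𝔾-Conv.sum a (suc n) ⊠ B ⊞ ⊟ 𝔾-Conv.sum (𝔾-Conv.conv a b) (suc n) ∥
    ≡⟨ cong₂ (λ x y → ∥ x ⊠ B ⊞ ⊟ y ∥) (𝔾-Conv.sum-head a n) (𝔾-Conv.sum-conv a b n) ⟩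
  ∥ (a 0 ⊞ A′) ⊠ B ⊞ ⊟ (a 0 ⊠ B₁ ⊞ C′) ∥
    ≡⟨ cong ∥_∥ (solve 5 (λ x A′ B B₁ C′ → (x :+ A′) :* B :- (x :* B₁ :+ C′) := x :* (B :- B₁) :+ (A′ :* B :- C′))
         refl (a 0) A′ B B₁ C′) ⟩
  ∥ a 0 ⊠ (B ⊞ ⊟ B₁) ⊞ (A′ ⊠ B ⊞ ⊟ C′) ∥
    ≤⟨ ∥∥-⊞ (a 0 ⊠ (B ⊞ ⊟ B₁)) (A′ ⊠ B ⊞ ⊟ C′) ⟩
  ∥ a 0 ⊠ (B ⊞ ⊟ B₁) ∥ ℚ.+ ∥ A′ ⊠ B ⊞ ⊟ C′ ∥
    ≤⟨ ℚ.+-mono-≤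
         (ℚ.≤-trans (∥∥-⊠ (a 0) (B ⊞ ⊟ B₁))
           (*-mono (ℚ.≤-trans (∥∥-nonNeg (a 0)) (a≤α 0)) (∥∥-nonNeg (B ⊞ ⊟ B₁)) (a≤α 0)
             (tail-dominated b≤β (ℕ.≤⇒≤′ n<m))))
         (product-dominated (a≤α ∘ suc) b≤β (ℕ.<⇒≤ n<m)) ⟩
  α 0 ℚ.* (β̂ ℚ.- β₁) ℚ.+ (α′ ℚ.* β̂ ℚ.- γ′)
    ≡⟨ ℚS.solve 5 (λ x A′ B B₁ C′ → x ℚS.:* (B ℚS.:- B₁) ℚS.:+ (A′ ℚS.:* B ℚS.:- C′)
                           ℚS.:= (x ℚS.:+ A′) ℚS.:* B ℚS.:- (x ℚS.:* B₁ ℚS.:+ C′)) refl (α 0) α′ β̂ β₁ γ′ ⟩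
  (α 0 ℚ.+ α′) ℚ.* β̂ ℚ.- (α 0 ℚ.* β₁ ℚ.+ γ′)
    ≡⟨ sym (cong₂ (λ x y → x ℚ.* β̂ ℚ.- y) (ℚ-Conv.sum-head α n) (ℚ-Conv.sum-conv α β n)) ⟩
  ℚ-Conv.sum α (suc n) ℚ.* β̂ ℚ.- ℚ-Conv.sum (ℚ-Conv.conv α β) (suc n) ∎
  where
  open ℚ.≤-Reasoning
  open 𝔾-Solver
  module ℚS = +-*-Solver
  A′ = 𝔾-Conv.sum (a ∘ suc) n
  B  = 𝔾-Conv.sum b m
  B₁ = 𝔾-Conv.sum b (suc n)
  C′ = 𝔾-Conv.sum (𝔾-Conv.conv (a ∘ suc) b) n
  α′ = ℚ-Conv.sum (α ∘ suc) n
  β̂  = ℚ-Conv.sum β m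
  β₁ = ℚ-Conv.sum β (suc n)
  γ′ = ℚ-Conv.sum (ℚ-Conv.conv (α ∘ suc) β) n

exp-↦ : ∀ z → partialSum (expTerm z) ↦ exp z
exp-↦ z = from-bounds λ 0<ε → 
  let M , p = proj₁ (exp-converges z) _ (half-pos 0<ε)
      N , q = proj₂ (exp-converges z) _ (half-pos 0<ε)
  in M ℕ.⊔ N , λ n le → eventually-zip sum-< (p n (ℕ.m⊔n≤o⇒m≤o M N le)) (q n (ℕ.m⊔n≤o⇒n≤o M N le))

module ExpSum (z w : ℂ) where

  open ExpConvergence using (B; 0≤B)

  private
    module E = ExpBound (B z ℚ.+ B w) (ℚ.+-mono-≤ {0ℚ} {B z} {0ℚ} {B w} (0≤B z) (0≤B w))

    S : ℂ → ℕ → ℂ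
    S z = partialSum (expTerm z)

    α β : ℕ → ℚ
    α = ExpBound.expBound (B z) (0≤B z)
    β = ExpBound.expBound (B w) (0≤B w)

    -- The majorants Bᵏ / k! multiply exactly, so the error of the product is again measured by a
    -- single exponential series.
    conv≡expBound : ∀ k → ℚ-Conv.conv α β k ≡ E.expBound k
    conv≡expBound = ℚ-Exp.exponential-unique
      (ℚ-Exp.conv-isExponential (expBound-isExponential (B z) (0≤B z)) (expBound-isExponential (B w) (0≤B w)))
      (expBound-isExponential (B z ℚ.+ B w) (ℚ.+-mono-≤ {0ℚ} {B z} {0ℚ} {B w} (0≤B z) (0≤B w)))

  -- The square minus the triangle is measured in the majorants. Enlarging the square to the
  -- triangle of side 2n leaves the terms n to 2n - 1 of the series for `B z + B w`, a tail that
  -- `Halving` controls.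
  product-bound : ∀ n j → E.expK ℕ.≤ n →
    ∥ at j (S z n * S w n - S (z + w) n) ∥ ℚ.≤ E.expBound n ℚ.+ E.expBound n
  product-bound n j K≤n = begin
    ∥ at j (S z n) ⊠ at j (S w n) ⊞ ⊟ at j (S (z + w) n) ∥
      ≡⟨ cong ∥_∥ (cong₂ (λ x y → x ⊞ ⊟ y)
           (cong₂ _⊠_ (at-partialSum (expTerm z) n j) (at-partialSum (expTerm w) n j))
           (trans (at-partialSum (expTerm (z + w)) n j) (𝔾-Conv.sum-cong (𝔾-Exp.exponential-unique
             (expTerm-isExponential (z + w) j)
             (𝔾-Exp.conv-isExponential (expTerm-isExponential z j) (expTerm-isExponential w j))) n))) ⟩
    ∥ 𝔾-Conv.sum a n ⊠ 𝔾-Conv.sum b n ⊞ ⊟ 𝔾-Conv.sum (𝔾-Conv.conv a b) n ∥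
      ≤⟨ product-dominated {a} {α} {b} {β}
           (λ k → ExpConvergence.size-expTerm z k j) (λ k → ExpConvergence.size-expTerm w k j) {n} {n} ℕ.≤-refl ⟩
    ℚ-Conv.sum α n ℚ.* ℚ-Conv.sum β n ℚ.- ℚ-Conv.sum (ℚ-Conv.conv α β) n
      ≤⟨ ℚ.+-monoˡ-≤ (ℚ.- ℚ-Conv.sum (ℚ-Conv.conv α β) n) (product≤sum-conv
           (ExpBound.expBound-nonNeg (B z) (0≤B z)) (ExpBound.expBound-nonNeg (B w) (0≤B w)) n n) ⟩
    ℚ-Conv.sum (ℚ-Conv.conv α β) (n ℕ.+ n) ℚ.- ℚ-Conv.sum (ℚ-Conv.conv α β) n
      ≡⟨ cong₂ ℚ._-_ (ℚ-Conv.sum-cong conv≡expBound (n ℕ.+ n)) (ℚ-Conv.sum-cong conv≡expBound n) ⟩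
    s (n ℕ.+ n) ℚ.- s n
      ≤⟨ p≤∣p∣ (s (n ℕ.+ n) ℚ.- s n) ⟩
    ℚ.∣ s (n ℕ.+ n) ℚ.- s n ∣
      ≤⟨ E.tail s (λ k → ℚ.≤-reflexive (trans
           (cong ℚ.∣_∣ (solve 2 (λ x y → (x :+ y) :- x := y) refl (s k) (E.expBound k)))
           (ℚ.0≤p⇒∣p∣≡p (E.expBound-nonNeg k)))) n (n ℕ.+ n) K≤n (ℕ.m≤m+n n n) ⟩
    E.expBound n ℚ.+ E.expBound n ∎
    where
    open ℚ.≤-Reasoning
    open +-*-Solver
    a b : ℕ → 𝔾
    a k = at j (expTerm z k)
    b k = at j (expTerm w k)
    s = ℚ-Conv.sum E.expBound

  exp-+ : exp (z + w) ≋ exp z * exp w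
  exp-+ = ↦-unique {s = λ n → S z n * S w n}
    (↦-close {s = S (z + w)} (λ 0<ε →
      let M , K≤M , q = E.small 0<ε
      -- The bound is uniform in the index `j`, so it holds from 0 on.
      in M , λ n M≤n → 0 , λ j _ → ℚ.≤-<-trans (product-bound n j (ℕ.≤-trans K≤M M≤n)) (q n M≤n))
      (exp-↦ (z + w)))
    (↦-* {S z} {S w} {exp z} {exp w} (exp-↦ z) (exp-↦ w))

open ExpSum using (exp-+)

partialSum-cong : ∀ {c d} → (∀ n → c n ≋ d n) → ∀ n → partialSum c n ≋ partialSum d n
partialSum-cong eq zero = ≋-refl
partialSum-cong {c} {d} eq (suc n) =
  +-cong {partialSum c n} {partialSum d n} {c n} {d n} (partialSum-cong eq n) (eq n)

exp-cong : ∀ {z w} → z ≋ w → exp z ≋ exp w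
exp-cong {z} {w} z≋w = ↦-unique
  (↦-resp (partialSum-cong λ n → *-congˡ {z ^ n} {w ^ n} (fromℝ (fromℚ (invFact n))) (^-cong z≋w n)) (exp-↦ z))
  (exp-↦ w)

exp-0 : exp 0ℂ ≋ 1ℂ
-- The empty partial sum is 0 rather than 1; the shift drops it.
exp-0 = ↦-unique (↦-shift (exp-↦ 0ℂ)) (↦-resp (λ n → ≡⇒≋ λ j → sym (lemma n j)) (↦-const 1ℂ))
  where
  open 𝔾-Solver
  lemma : ∀ n j → at j (partialSum (expTerm 0ℂ) (suc n)) ≡ at j 1ℂ
  lemma zero    j = refl
  lemma (suc n) j = trans
    (cong (_⊞ at j (expTerm 0ℂ (suc n))) (lemma n j))
    (solve 2 (λ f x → con (real 1ℚ) :+ f :* (con (real 0ℚ) :* x) := con (real 1ℚ)) refl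
      (real (invFact (suc n))) (at j (0ℂ ^ n)))

exp-neg : ∀ z → exp z * exp (- z) ≋ 1ℂ
exp-neg z = ≋-trans (≋-sym (exp-+ z (- z))) (≋-trans
  (exp-cong {z + - z} {0ℂ} (≡⇒≋ λ n → CommutativeRing.-‿inverseʳ 𝔾-ring (at n z))) exp-0)

-- Injectivity of the exponential near 0

∥at-^∥ : ∀ z k j → ∥ at j (z ^ k) ∥ ℚ.≤ pow ∥ at j z ∥ k
∥at-^∥ z zero    j = ℚ.≤-refl
∥at-^∥ z (suc k) j = ℚ.≤-trans (∥∥-⊠ (at j z) (at j (z ^ k)))
  (*-monoʳ (∥∥-nonNeg (at j z)) (∥at-^∥ z k j))

invFact≤1 : ∀ k → invFact k ℚ.≤ 1ℚ
invFact≤1 zero    = ℚ.≤-refl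
invFact≤1 (suc k) = subst (ℚ._≤ 1ℚ) (sym (invFact-suc k))
  (*-mono {invFact k} {1ℚ} {inv (ratio (suc k))} {1ℚ} (ℚ.nonNegative⁻¹ 1ℚ) (ℚ.<⇒≤ (inv-pos (ratio-pos k)))
    (invFact≤1 k) (inv-anti {1ℚ} (ℚ.positive⁻¹ 1ℚ) (ratio-mono {1} {suc k} (ℕ.s≤s ℕ.z≤n))))

-- In contrast to `size-expTerm`, the base is the size of `z` at this very index, so a small `z`
-- gives small terms. The factor 1 / k! is given up because a geometric series suffices.
∥expTerm∥ : ∀ z k j → ∥ at j (expTerm z k) ∥ ℚ.≤ pow ∥ at j z ∥ k
∥expTerm∥ z k j = begin
  ∥ real (invFact k) ⊠ at j (z ^ k) ∥             ≤⟨ ∥∥-⊠ (real (invFact k)) (at j (z ^ k)) ⟩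
  ∥ real (invFact k) ∥ ℚ.* ∥ at j (z ^ k) ∥       ≡⟨ cong (ℚ._* ∥ at j (z ^ k) ∥) (∥∥-real (invFact-nonNeg k)) ⟩
  invFact k ℚ.* ∥ at j (z ^ k) ∥                  ≤⟨ *-monoˡ (∥∥-nonNeg (at j (z ^ k))) (invFact≤1 k) ⟩
  1ℚ ℚ.* ∥ at j (z ^ k) ∥                         ≡⟨ ℚ.*-identityˡ _ ⟩
  ∥ at j (z ^ k) ∥                                ≤⟨ ∥at-^∥ z k j ⟩
  pow ∥ at j z ∥ k                                ∎
  where open ℚ.≤-Reasoning

double≤ : ∀ {s p} → s ℚ.≤ ½ → 0ℚ ℚ.≤ p → s ℚ.* p ℚ.+ s ℚ.* p ℚ.≤ p
double≤ {s} {p} s≤½ 0≤p = subst (s ℚ.* p ℚ.+ s ℚ.* p ℚ.≤_) (half+half p)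
  (ℚ.+-mono-≤ (*-monoˡ 0≤p s≤½) (*-monoˡ 0≤p s≤½))

-- The terms from the square on add up to at most 2 s², as in a geometric series of ratio s ≤ ½. The
-- summand 2 sⁿ⁺² on the left is the part of this budget still unspent and carries the induction.
exp-remainder : ∀ z j → ∥ at j z ∥ ℚ.≤ ½ → ∀ n → let s = ∥ at j z ∥ in
  ∥ at j (partialSum (expTerm z) (suc (suc n))) ⊞ ⊟ (at j 1ℂ ⊞ at j z) ∥
    ℚ.+ (pow s (suc (suc n)) ℚ.+ pow s (suc (suc n)))
    ℚ.≤ pow s 2 ℚ.+ pow s 2
exp-remainder z j s≤½ zero = ℚ.≤-reflexive (trans
  (cong (λ x → ∥ x ∥ ℚ.+ ((pow ∥ at j z ∥ 2) ℚ.+ (pow ∥ at j z ∥ 2)))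
    (solve 1 (λ x → con (real 0ℚ) :+ con (real 1ℚ) :* con (real 1ℚ)
                   :+ con (real 1ℚ) :* (x :* con (real 1ℚ)) :- (con (real 1ℚ) :+ x)
                 := con (real 0ℚ)) refl (at j z)))
  (ℚ.+-identityˡ _))
  where open 𝔾-Solver
exp-remainder z j s≤½ (suc n) = begin
  ∥ (S ⊞ e) ⊞ ⊟ (at j 1ℂ ⊞ at j z) ∥ ℚ.+ (s ℚ.* p ℚ.+ s ℚ.* p)
    ≡⟨ cong (λ x → ∥ x ∥ ℚ.+ (s ℚ.* p ℚ.+ s ℚ.* p))
         (solve 3 (λ S e x → (S :+ e) :- x := (S :- x) :+ e) refl S e (at j 1ℂ ⊞ at j z)) ⟩
  ∥ R ⊞ e ∥ ℚ.+ (s ℚ.* p ℚ.+ s ℚ.* p)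
    ≤⟨ ℚ.+-mono-≤ (ℚ.≤-trans (∥∥-⊞ R e) (ℚ.+-monoʳ-≤ ∥ R ∥ (∥expTerm∥ z (suc (suc n)) j)))
         (double≤ s≤½ (pow-nonNeg (∥∥-nonNeg (at j z)) (suc (suc n)))) ⟩
  ∥ R ∥ ℚ.+ p ℚ.+ p
    ≡⟨ ℚ.+-assoc ∥ R ∥ p p ⟩
  ∥ R ∥ ℚ.+ (p ℚ.+ p)
    ≤⟨ exp-remainder z j s≤½ n ⟩
  pow s 2 ℚ.+ pow s 2 ∎
  where
  open ℚ.≤-Reasoning
  open 𝔾-Solver
  s = ∥ at j z ∥
  p = pow s (suc (suc n))
  S = at j (partialSum (expTerm z) (suc (suc n)))
  e = at j (expTerm z (suc (suc n)))
  R = S ⊞ ⊟ (at j 1ℂ ⊞ at j z)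

¼ : ℚ
¼ = ½ ℚ.* ½

-- `z` is `D` minus the remainder `R`, and ∥ R ∥ ≤ 2 s² ≤ s / 2; the last inequality fixes the
-- constant ¼.
exp-lower-bound : ∀ z j n → ∥ at j z ∥ ℚ.≤ ¼ →
  ½ ℚ.* ∥ at j z ∥ ℚ.≤ ∥ at j (partialSum (expTerm z) (suc (suc n)) - 1ℂ) ∥
exp-lower-bound z j n s≤¼ = subst₂ ℚ._≤_
    (solve 1 (λ s → (con 1ℚ :- con ½) :* s := con ½ :* s) refl s)
    (solve 2 (λ D h → (D :+ h) :- h := D) refl ∥ D ∥ (½ ℚ.* s))
    (subst (ℚ._≤ (∥ D ∥ ℚ.+ ½ ℚ.* s) ℚ.- ½ ℚ.* s)
      (solve 1 (λ s → s :- con ½ :* s := (con 1ℚ :- con ½) :* s) refl s)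
      (ℚ.+-monoˡ-≤ (ℚ.- (½ ℚ.* s)) bound))
  where
  open +-*-Solver
  module G = 𝔾-Solver
  s = ∥ at j z ∥
  S = at j (partialSum (expTerm z) (suc (suc n)))
  D = S ⊞ ⊟ at j 1ℂ
  R = S ⊞ ⊟ (at j 1ℂ ⊞ at j z)
  0≤s : 0ℚ ℚ.≤ s
  0≤s = ∥∥-nonNeg (at j z)
  s≤½ : s ℚ.≤ ½
  s≤½ = ℚ.≤-trans s≤¼ (toWitness {a? = ¼ ℚ.≤? ½} _)
  bound : s ℚ.≤ ∥ D ∥ ℚ.+ ½ ℚ.* s
  bound = begin
    s
      ≡⟨ cong ∥_∥ (G.solve 3 (λ S o x → x G.:= (S G.:- o) G.:+ G.:- (S G.:- (o G.:+ x))) refl S (at j 1ℂ) (at j z)) ⟩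
    ∥ D ⊞ ⊟ R ∥
      ≤⟨ ∥∥-⊞ D (⊟ R) ⟩
    ∥ D ∥ ℚ.+ ∥ ⊟ R ∥
      ≡⟨ cong (∥ D ∥ ℚ.+_) (∥∥-⊟ R) ⟩
    ∥ D ∥ ℚ.+ ∥ R ∥
      ≡⟨ cong (∥ D ∥ ℚ.+_) (sym (ℚ.+-identityʳ ∥ R ∥)) ⟩
    ∥ D ∥ ℚ.+ (∥ R ∥ ℚ.+ 0ℚ)
      ≤⟨ ℚ.+-monoʳ-≤ ∥ D ∥ (ℚ.+-monoʳ-≤ ∥ R ∥ (ℚ.+-mono-≤ {0ℚ} {p} {0ℚ} {p} 0≤p 0≤p)) ⟩
    ∥ D ∥ ℚ.+ (∥ R ∥ ℚ.+ (p ℚ.+ p))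
      ≤⟨ ℚ.+-monoʳ-≤ ∥ D ∥ (exp-remainder z j s≤½ n) ⟩
    ∥ D ∥ ℚ.+ (s ℚ.* (s ℚ.* 1ℚ) ℚ.+ s ℚ.* (s ℚ.* 1ℚ))
      ≡⟨ cong (∥ D ∥ ℚ.+_) (solve 1 (λ s → s :* (s :* con 1ℚ) :+ s :* (s :* con 1ℚ) := (s :+ s) :* s) refl s) ⟩
    ∥ D ∥ ℚ.+ (s ℚ.+ s) ℚ.* s
      ≤⟨ ℚ.+-monoʳ-≤ ∥ D ∥ (*-monoˡ 0≤s (ℚ.+-mono-≤ s≤¼ s≤¼)) ⟩
    ∥ D ∥ ℚ.+ ½ ℚ.* s ∎
    where
    open ℚ.≤-Reasoning
    p = pow s (suc (suc n))
    0≤p = pow-nonNeg 0≤s (suc (suc n))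

-- One partial sum within ε / 2 of 1 suffices, since the lower bound turns it into ∥ z ∥ < ε. Its
-- length is N + 2 because that bound starts with the terms of degree 0 and 1.
exp-injective-at-0 : ∀ {z} → z ≺ ¼ → exp z ≋ 1ℂ → z ≋ 0ℂ
exp-injective-at-0 {z} (mk≺ z≺¼) eq = mk≋ λ {ε} 0<ε →
  let N , p = tends (↦-respʳ eq (exp-↦ z)) (half-pos 0<ε)
  in ≺-resp (mk≺ {z} (eventually-zip
       (λ {j} r s → ℚ.*-cancelˡ-<-nonNeg ½ (ℚ.≤-<-trans (exp-lower-bound z j N (ℚ.<⇒≤ r)) s))
       z≺¼ (_≺_.bound (p (suc (suc N)) (ℕ.m≤n⇒m≤1+n (ℕ.m≤n⇒m≤1+n (ℕ.≤-refl {N})))))))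
     (λ n → solve 1 (λ x → x := x :- con (real 0ℚ)) refl (at n z))
  where open 𝔾-Solver

-- Uniqueness of power series coefficients

rational : ℚ → ℂ
rational q = fromℝ (fromℚ q)

powerTerm : (ℕ → ℂ) → ℂ → ℕ → ℂ
powerTerm d z n = d n * z ^ n

≤-+ʳ : ∀ {p q} → 0ℚ ℚ.≤ q → p ℚ.≤ p ℚ.+ q
≤-+ʳ {p} {q} 0≤q = subst (ℚ._≤ p ℚ.+ q) (ℚ.+-identityʳ p) (ℚ.+-monoʳ-≤ p 0≤q)

≤-+ˡ : ∀ {p q} → 0ℚ ℚ.≤ q → p ℚ.≤ q ℚ.+ p
≤-+ˡ {p} {q} 0≤q = subst (ℚ._≤ q ℚ.+ p) (ℚ.+-identityˡ p) (ℚ.+-monoˡ-≤ p 0≤q)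

+-pos : ∀ {p q} → 0ℚ ℚ.< p → 0ℚ ℚ.< q → 0ℚ ℚ.< p ℚ.+ q
+-pos {p} {q} = ℚ.+-mono-< {0ℚ} {p} {0ℚ} {q}

⊓-pos : ∀ {p q} → 0ℚ ℚ.< p → 0ℚ ℚ.< q → 0ℚ ℚ.< p ℚ.⊓ q
⊓-pos {p} {q} 0<p 0<q =
  [ (λ eq → subst (0ℚ ℚ.<_) (sym eq) 0<p) , (λ eq → subst (0ℚ ℚ.<_) (sym eq) 0<q) ]′ (ℚ.⊓-sel p q)

initial-bound : ∀ (c : ℕ → ℂ) N → ∃ λ M → 0ℚ ℚ.< M × (∀ k → k ℕ.< N → c k ≺ M)
initial-bound c zero    = 1ℚ , ℚ.positive⁻¹ 1ℚ , λ k ()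
initial-bound c (suc N) =
  let M , 0<M , p = initial-bound c N
      B , 0<B , q = ≺-bounded (c N)
  in M ℚ.+ B , +-pos 0<M 0<B , λ k k≤N →
       [ (λ k<N → ≺-weaken (≤-+ʳ (ℚ.<⇒≤ 0<B)) (p k k<N))
       , (λ where refl → ≺-weaken (≤-+ˡ (ℚ.<⇒≤ 0<M)) q) ]′ (ℕ.m<1+n⇒m<n∨m≡n k≤N)

-- From `N` on the terms are differences of partial sums within ½ of the limit, hence below 1;
-- finitely many others remain.
terms-bounded : ∀ {c l} → partialSum c ↦ l → ∃ λ M → 0ℚ ℚ.< M × (∀ k → c k ≺ M)
terms-bounded {c} {l} p = M ℚ.+ 1ℚ , +-pos 0<M (ℚ.positive⁻¹ 1ℚ) , λ k →
    [ (λ k<N → ≺-weaken (≤-+ʳ (ℚ.nonNegative⁻¹ 1ℚ)) (initial k k<N))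
    , (λ N≤k → ≺-weaken (≤-+ˡ (ℚ.<⇒≤ 0<M)) (final k N≤k)) ]′ (ℕ.<-≤-connex k N)
  where
  open 𝔾-Solver
  N = proj₁ (tends p (ℚ.positive⁻¹ ½))
  M = proj₁ (initial-bound c N)
  0<M = proj₁ (proj₂ (initial-bound c N))
  initial = proj₂ (proj₂ (initial-bound c N))
  final : ∀ k → N ℕ.≤ k → c k ≺ 1ℚ
  final k N≤k = ≺-resp
    (≺-+ {partialSum c (suc k) - l} { - (partialSum c k - l)}
      (proj₂ (tends p (ℚ.positive⁻¹ ½)) (suc k) (ℕ.m≤n⇒m≤1+n N≤k))
      (≺-neg {partialSum c k - l} (proj₂ (tends p (ℚ.positive⁻¹ ½)) k N≤k)))
    (λ j → solve 3 (λ S x l → ((S :+ x) :- l) :+ :- (S :- l) := x) refl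
      (at j (partialSum c k)) (at j (c k)) (at j l))

at-rational-^ : ∀ q k j → at j (rational q ^ k) ≡ real (pow q k)
at-rational-^ q zero    j = refl
at-rational-^ q (suc k) j = trans (cong (real q ⊠_) (at-rational-^ q k j)) (real-⊠ q (pow q k))

pow-* : ∀ p q k → pow (p ℚ.* q) k ≡ pow p k ℚ.* pow q k
pow-* p q zero    = refl
pow-* p q (suc k) = trans (cong (p ℚ.* q ℚ.*_) (pow-* p q k))
  (solve 4 (λ p q x y → p :* q :* (x :* y) := p :* x :* (q :* y)) refl p q (pow p k) (pow q k))
  where open +-*-Solver

pow-pos : ∀ {q} → 0ℚ ℚ.< q → ∀ k → 0ℚ ℚ.< pow q k
pow-pos 0<q zero    = ℚ.positive⁻¹ 1ℚ
pow-pos 0<q (suc k) = *-pos 0<q (pow-pos 0<q k)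

-- Terms bounded by M at τ are at most M σᵏ at τ σ, so the partial sums there differ from the
-- constant term by at most a fixed multiple of M σ.
module Geometric (d : ℕ → ℂ) (τ σ M : ℚ) (0<σ : 0ℚ ℚ.< σ) (σ≤½ : σ ℚ.≤ ½) (0<M : 0ℚ ℚ.< M)
                 (bound : ∀ k → powerTerm d (rational τ) k ≺ M) where

  c : ℕ → ℂ
  c = powerTerm d (rational (τ ℚ.* σ))

  term-bound : ∀ k → c k ≺ M ℚ.* pow σ k
  term-bound k = ≺-map (λ j r → begin-strict
      ∥ at j (c k) ∥
        ≡⟨ cong ∥_∥ (eq j) ⟩
      ∥ at j (powerTerm d (rational τ) k) ⊠ real (pow σ k) ∥
        ≤⟨ ∥∥-⊠ (at j (powerTerm d (rational τ) k)) (real (pow σ k)) ⟩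
      ∥ at j (powerTerm d (rational τ) k) ∥ ℚ.* ∥ real (pow σ k) ∥
        ≡⟨ cong (∥ at j (powerTerm d (rational τ) k) ∥ ℚ.*_) (∥∥-real (ℚ.<⇒≤ 0<σᵏ)) ⟩
      ∥ at j (powerTerm d (rational τ) k) ∥ ℚ.* pow σ k
        <⟨ ℚ.*-monoˡ-<-pos (pow σ k) {{ℚ.positive 0<σᵏ}} r ⟩
      M ℚ.* pow σ k ∎) (bound k)
    where
    open ℚ.≤-Reasoning
    0<σᵏ = pow-pos 0<σ k
    eq : ∀ j → at j (c k) ≡ at j (powerTerm d (rational τ) k) ⊠ real (pow σ k)
    eq j = trans (cong (at j (d k) ⊠_) (trans (at-rational-^ (τ ℚ.* σ) k j)
               (trans (cong real (pow-* τ σ k)) (sym (real-⊠ (pow τ k) (pow σ k))))))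
      (trans (sym (CommutativeRing.*-assoc 𝔾-ring (at j (d k)) (real (pow τ k)) (real (pow σ k))))
        (cong (λ x → at j (d k) ⊠ x ⊠ real (pow σ k)) (sym (at-rational-^ τ k j))))

  C : ℕ → ℚ
  C n = M ℚ.* pow σ (suc n)

  0<C : ∀ n → 0ℚ ℚ.< C n
  0<C n = *-pos 0<M (pow-pos 0<σ (suc n))

  C-halves : ∀ n → C (suc n) ℚ.+ C (suc n) ℚ.≤ C n
  C-halves n = subst (ℚ._≤ C n)
    (solve 3 (λ σ M p → σ :* (M :* p) :+ σ :* (M :* p)
                     := M :* (σ :* p) :+ M :* (σ :* p)) refl σ M (pow σ (suc n)))
    (double≤ σ≤½ (ℚ.<⇒≤ (0<C n)))
    where open +-*-Solver

  K : ℚ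
  K = (C 0 ℚ.+ C 0) ℚ.+ (C 0 ℚ.+ C 0)

  tail-bound : ∀ n → ∃ λ X → partialSum c (suc n) - d 0 ≺ X × X ℚ.+ (C n ℚ.+ C n) ℚ.≤ K
  -- Even the zero difference needs a positive bound, and 2 C(0) is taken for it; the remaining 2
  -- C(0) of `K` pays for all later terms.
  tail-bound zero = C 0 ℚ.+ C 0 , ≺-resp (≺-zero (+-pos (0<C 0) (0<C 0)))
      (λ j → solve 1 (λ x → con (real 0ℚ) := (con (real 0ℚ) :+ x :* con (real 1ℚ)) :- x) refl (at j (d 0)))
    , ℚ.≤-refl
    where open 𝔾-Solver
  tail-bound (suc n) = let X , p , q = tail-bound n in
    X ℚ.+ C n ,
    ≺-resp (≺-+ {partialSum c (suc n) - d 0} {c (suc n)} p (term-bound (suc n)))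
      (λ j → solve 3 (λ S x y → (S :- y) :+ x := (S :+ x) :- y) refl
        (at j (partialSum c (suc n))) (at j (c (suc n))) (at j (d 0))) ,
    ℚ.≤-trans (ℚ.+-monoʳ-≤ (X ℚ.+ C n) (C-halves n))
      (ℚ.≤-trans (ℚ.≤-reflexive (ℚ.+-assoc X (C n) (C n))) q)
    where open 𝔾-Solver

  constant-bound : ∀ {η} → 0ℚ ℚ.< η → partialSum c ↦ 0ℂ → d 0 ≺ K ℚ.+ η
  constant-bound 0<η p =
    let N , r = tends p 0<η
        X , t , X+≤K = tail-bound N
    in ≺-resp (≺-+ { - (partialSum c (suc N) - d 0)} {partialSum c (suc N) - 0ℂ}
         (≺-weaken (ℚ.≤-trans (≤-+ʳ (ℚ.<⇒≤ (+-pos (0<C N) (0<C N)))) X+≤K)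
           (≺-neg {partialSum c (suc N) - d 0} t))
         (r (suc N) (ℕ.m≤n⇒m≤1+n ℕ.≤-refl)))
       (λ j → solve 2 (λ S x → :- (S :- x) :+ (S :- con (real 0ℚ)) := x) refl (at j (partialSum c (suc N))) (at j (d 0)))
    where open 𝔾-Solver

-- Positive rational points are enough for uniqueness; there the norm is the number itself. The
-- point 0 is excluded because shifting the series divides by q.
VanishesUpTo : ℚ → (ℕ → ℂ) → Set
VanishesUpTo τ d = ∀ q → 0ℚ ℚ.< q → q ℚ.≤ τ → partialSum (powerTerm d (rational q)) ↦ 0ℂ

constant≋0 : ∀ {τ d} → 0ℚ ℚ.< τ → VanishesUpTo τ d → d 0 ≋ 0ℂ
constant≋0 {τ} {d} 0<τ p = mk≋ λ {ε} 0<ε → small 0<ε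
  where
  bounded′ = terms-bounded (p τ 0<τ ℚ.≤-refl)
  M = proj₁ bounded′
  0<M = proj₁ (proj₂ bounded′)
  F = (M ℚ.+ M) ℚ.+ (M ℚ.+ M)
  0<F : 0ℚ ℚ.< F
  0<F = +-pos (+-pos 0<M 0<M) (+-pos 0<M 0<M)
  small : ∀ {ε} → 0ℚ ℚ.< ε → d 0 - 0ℂ ≺ ε
  small {ε} 0<ε = ≺-resp (≺-weaken K+η≤ε (constant-bound (half-pos 0<ε) (p (τ ℚ.* σ) (*-pos 0<τ 0<σ) τσ≤τ)))
    (λ j → 𝔾-Solver.solve 1 (λ x → x 𝔾-Solver.:= x 𝔾-Solver.:- 𝔾-Solver.con (real 0ℚ)) refl (at j (d 0)))
    where
    open +-*-Solver
    -- Chosen so that `K`, which is F σ with F = 4 M, is at most ε / 2; the other half of ε absorbs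
    -- the distance from a partial sum to its limit.
    θ = ½ ℚ.* ε ℚ.* inv F
    σ = ½ ℚ.⊓ θ
    0<σ : 0ℚ ℚ.< σ
    0<σ = ⊓-pos (ℚ.positive⁻¹ ½) (*-pos (half-pos 0<ε) (inv-pos 0<F))
    open Geometric d τ σ M 0<σ (ℚ.p⊓q≤p ½ θ) 0<M (proj₂ (proj₂ bounded′))
    τσ≤τ : τ ℚ.* σ ℚ.≤ τ
    τσ≤τ = subst (τ ℚ.* σ ℚ.≤_) (ℚ.*-identityʳ τ)
      (*-monoʳ (ℚ.<⇒≤ 0<τ) (ℚ.≤-trans (ℚ.p⊓q≤p ½ θ) (toWitness {a? = ½ ℚ.≤? 1ℚ} _)))
    K+η≤ε : K ℚ.+ ½ ℚ.* ε ℚ.≤ ε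
    K+η≤ε = subst (K ℚ.+ ½ ℚ.* ε ℚ.≤_) (half+half ε) (ℚ.+-monoˡ-≤ (½ ℚ.* ε) (begin
      K
        ≡⟨ solve 2 (λ M σ → (M :* (σ :* con 1ℚ) :+ M :* (σ :* con 1ℚ))
                           :+ (M :* (σ :* con 1ℚ) :+ M :* (σ :* con 1ℚ))
                         := ((M :+ M) :+ (M :+ M)) :* σ) refl M σ ⟩
      F ℚ.* σ
        ≤⟨ *-monoʳ (ℚ.<⇒≤ 0<F) (ℚ.p⊓q≤q ½ θ) ⟩
      F ℚ.* (½ ℚ.* ε ℚ.* inv F)
        ≡⟨ solve 3 (λ F e i → F :* (e :* i) := e :* (F :* i)) refl F (½ ℚ.* ε) (inv F) ⟩
      ½ ℚ.* ε ℚ.* (F ℚ.* inv F)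
        ≡⟨ cong (½ ℚ.* ε ℚ.*_) (inv-inverse 0<F) ⟩
      ½ ℚ.* ε ℚ.* 1ℚ
        ≡⟨ ℚ.*-identityʳ _ ⟩
      ½ ℚ.* ε ∎))
      where open ℚ.≤-Reasoning

shift : (ℕ → ℂ) → ℕ → ℂ
shift d n = d (suc n)

at-partialSum-power-suc : ∀ d z n j → at j (partialSum (powerTerm d z) (suc n)) ≡
  at j (d 0) ⊞ at j z ⊠ at j (partialSum (powerTerm (shift d) z) n)
at-partialSum-power-suc d z zero j =
  solve 2 (λ x z → con (real 0ℚ) :+ x :* con (real 1ℚ) := x :+ z :* con (real 0ℚ)) refl (at j (d 0)) (at j z)
  where open 𝔾-Solver
at-partialSum-power-suc d z (suc n) j = begin
  at j (partialSum (powerTerm d z) (suc n)) ⊞ at j (powerTerm d z (suc n))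
    ≡⟨ cong (_⊞ at j (powerTerm d z (suc n))) (at-partialSum-power-suc d z n j) ⟩
  (at j (d 0) ⊞ at j z ⊠ S) ⊞ at j (d (suc n)) ⊠ (at j z ⊠ at j (z ^ n))
    ≡⟨ solve 5 (λ x z S y p → (x :+ z :* S) :+ y :* (z :* p) := x :+ z :* (S :+ y :* p)) refl
         (at j (d 0)) (at j z) S (at j (d (suc n))) (at j (z ^ n)) ⟩
  at j (d 0) ⊞ at j z ⊠ (S ⊞ at j (d (suc n)) ⊠ at j (z ^ n)) ∎
  where
  open 𝔾-Solver
  open ≡-Reasoning
  S = at j (partialSum (powerTerm (shift d) z) n)

-- S(n + 1) = d(0) + q S′(n), so once d(0) vanishes the shifted series is the original one divided
-- by q.
vanishes-shift : ∀ {τ d} → d 0 ≋ 0ℂ → VanishesUpTo τ d → VanishesUpTo τ (shift d)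
vanishes-shift {τ} {d} d₀ p q 0<q q≤τ = ↦-respʳ {S′} {rational (inv q) * 0ℂ} {0ℂ}
  (≡⇒≋ λ j → zeroʳ (real (inv q)))
  (↦-resp {λ n → rational (inv q) * S (suc n)} {S′} step
    (↦-* {λ _ → rational (inv q)} {λ n → S (suc n)} {rational (inv q)} {0ℂ}
      (↦-const (rational (inv q))) (↦-shift {S} (p q 0<q q≤τ))))
  where
  open CommutativeRing 𝔾-ring using (zeroʳ)
  open 𝔾-Solver
  S S′ : ℕ → ℂ
  S  = partialSum (powerTerm d (rational q))
  S′ = partialSum (powerTerm (shift d) (rational q))
  step : ∀ n → rational (inv q) * S (suc n) ≋ S′ n
  step n = mk≋ λ 0<ε →
    let B , 0<B , r = ≺-bounded (rational (inv q))
    in ≺-resp {rational (inv q) * (d 0 - 0ℂ)}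
         (≺-scale {d 0 - 0ℂ} {rational (inv q)} r 0<B (diff {d 0} {0ℂ} d₀ (*-pos 0<ε (inv-pos 0<B))))
         (λ j → divide (at j (d 0)) (at j (S′ n)) {at j (S (suc n))}
           (at-partialSum-power-suc d (rational q) n j))
    where
    -- With `s` a variable, matching on `refl` leaves the solver a goal in ring variables; the same
    -- device recurs below.
    divide : ∀ x s′ {s} → s ≡ x ⊞ real q ⊠ s′ → real (inv q) ⊠ (x ⊞ ⊟ real 0ℚ) ≡ real (inv q) ⊠ s ⊞ ⊟ s′
    divide x s′ refl = trans
      (solve 3 (λ i x s′ → i :* (x :- con (real 0ℚ)) := i :* x :+ con (real 1ℚ) :* s′ :- s′) refl
        (real (inv q)) x s′)
      (trans
        (cong (λ y → real (inv q) ⊠ x ⊞ y ⊠ s′ ⊞ ⊟ s′)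
          (sym (trans (real-⊠ (inv q) q) (cong real (trans (ℚ.*-comm (inv q) q) (inv-inverse 0<q))))))
        (solve 4 (λ i x o s′ → i :* x :+ i :* o :* s′ :- s′ := i :* (x :+ o :* s′) :- s′) refl
          (real (inv q)) x (real q) s′))

coefficients≋0 : ∀ {τ d} → 0ℚ ℚ.< τ → VanishesUpTo τ d → ∀ n → d n ≋ 0ℂ
coefficients≋0 {τ} {d} 0<τ p zero    = constant≋0 {τ} {d} 0<τ p
coefficients≋0 {τ} {d} 0<τ p (suc n) =
  coefficients≋0 {τ} {shift d} 0<τ (vanishes-shift {τ} {d} (constant≋0 {τ} {d} 0<τ p) p) n

-- Moduli, neighbourhoods of 0 and continuity

square-abs : ∀ p → p ℚ.* p ≡ ℚ.∣ p ∣ ℚ.* ℚ.∣ p ∣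
square-abs p = [ (λ eq → sym (cong₂ ℚ._*_ eq eq)) , (λ eq → trans
  (solve 1 (λ p → p :* p := (:- p) :* (:- p)) refl p) (sym (cong₂ ℚ._*_ eq eq))) ]′ (ℚ.∣p∣≡p∨∣p∣≡-p p)
  where open +-*-Solver

square-nonNeg : ∀ p → 0ℚ ℚ.≤ p ℚ.* p
square-nonNeg p = subst (0ℚ ℚ.≤_) (sym (square-abs p)) (*-nonNeg (ℚ.0≤∣p∣ p) (ℚ.0≤∣p∣ p))

square-mono-< : ∀ {p q} → 0ℚ ℚ.≤ p → p ℚ.< q → p ℚ.* p ℚ.< q ℚ.* q
square-mono-< {p} {q} 0≤p p<q = ℚ.≤-<-trans (*-monoʳ 0≤p (ℚ.<⇒≤ p<q))
  (ℚ.*-monoˡ-<-pos q {{ℚ.positive (ℚ.≤-<-trans 0≤p p<q)}} p<q)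

square-cancel-< : ∀ {p q} → 0ℚ ℚ.≤ q → p ℚ.* p ℚ.< q ℚ.* q → p ℚ.< q
square-cancel-< {p} {q} 0≤q p²<q² with q ℚ.≤? p
... | no  q≰p = ℚ.≰⇒> q≰p
... | yes q≤p = contradiction (ℚ.<-≤-trans p²<q² (*-mono (ℚ.≤-trans 0≤q q≤p) 0≤q q≤p q≤p)) (ℚ.<-irrefl refl)

∥_∥² : 𝔾 → ℚ
∥ a , b ∥² = a ℚ.* a ℚ.+ b ℚ.* b

∥∥²≤∥∥*∥∥ : ∀ x → ∥ x ∥² ℚ.≤ ∥ x ∥ ℚ.* ∥ x ∥
∥∥²≤∥∥*∥∥ (a , b) = begin
  a ℚ.* a ℚ.+ b ℚ.* b
    ≡⟨ cong₂ ℚ._+_ (square-abs a) (square-abs b) ⟩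
  A ℚ.* A ℚ.+ B ℚ.* B
    ≤⟨ ≤-+ʳ (ℚ.+-mono-≤ {0ℚ} {A ℚ.* B} {0ℚ} {A ℚ.* B} 0≤AB 0≤AB) ⟩
  A ℚ.* A ℚ.+ B ℚ.* B ℚ.+ (A ℚ.* B ℚ.+ A ℚ.* B)
    ≡⟨ solve 2 (λ A B → A :* A :+ B :* B :+ (A :* B :+ A :* B) := (A :+ B) :* (A :+ B)) refl A B ⟩
  (A ℚ.+ B) ℚ.* (A ℚ.+ B) ∎
  where
  open ℚ.≤-Reasoning
  open +-*-Solver
  A = ℚ.∣ a ∣
  B = ℚ.∣ b ∣
  0≤AB : 0ℚ ℚ.≤ A ℚ.* B
  0≤AB = *-nonNeg (ℚ.0≤∣p∣ a) (ℚ.0≤∣p∣ b)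

-- The square of |a| - |b| is nonnegative. With the preceding lemma this compares the ℓ¹ norm and
-- the modulus in both directions.
∥∥*∥∥≤2∥∥² : ∀ x → ∥ x ∥ ℚ.* ∥ x ∥ ℚ.≤ ∥ x ∥² ℚ.+ ∥ x ∥²
∥∥*∥∥≤2∥∥² (a , b) = begin
  (A ℚ.+ B) ℚ.* (A ℚ.+ B)
    ≤⟨ ≤-+ʳ (square-nonNeg (A ℚ.- B)) ⟩
  (A ℚ.+ B) ℚ.* (A ℚ.+ B) ℚ.+ (A ℚ.- B) ℚ.* (A ℚ.- B)
    ≡⟨ solve 2 (λ A B → (A :+ B) :* (A :+ B) :+ (A :- B) :* (A :- B)
                     := (A :* A :+ B :* B) :+ (A :* A :+ B :* B)) refl A B ⟩
  (A ℚ.* A ℚ.+ B ℚ.* B) ℚ.+ (A ℚ.* A ℚ.+ B ℚ.* B)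
    ≡⟨ sym (cong₂ (λ x y → (x ℚ.+ y) ℚ.+ (x ℚ.+ y)) (square-abs a) (square-abs b)) ⟩
  (a ℚ.* a ℚ.+ b ℚ.* b) ℚ.+ (a ℚ.* a ℚ.+ b ℚ.* b) ∎
  where
  open ℚ.≤-Reasoning
  open +-*-Solver
  A = ℚ.∣ a ∣
  B = ℚ.∣ b ∣

fromℚ-pos : ∀ {ε} → 0ℚ ℚ.< ε → 0ᵣ <ᵣ fromℚ ε
fromℚ-pos {ε} 0<ε = ½ ℚ.* ε , half-pos 0<ε , 0 , λ _ _ →
  subst₂ ℚ._<_ (sym (ℚ.+-identityˡ (½ ℚ.* ε))) (half+half ε)
    (subst (ℚ._< ½ ℚ.* ε ℚ.+ ½ ℚ.* ε) (ℚ.+-identityʳ (½ ℚ.* ε)) (ℚ.+-monoʳ-< (½ ℚ.* ε) (half-pos 0<ε)))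

∣∣<⇒≺ : ∀ {z ε} → 0ℚ ℚ.< ε → ∣ z ∣< fromℚ ε → z ≺ ε ℚ.+ ε
∣∣<⇒≺ {z} {ε} 0<ε (δ , 0<δ , N , p) = mk≺ (N , λ n N≤n → square-cancel-< (ℚ.<⇒≤ 0<2ε) (begin-strict
    ∥ at n z ∥ ℚ.* ∥ at n z ∥                 ≤⟨ ∥∥*∥∥≤2∥∥² (at n z) ⟩
    ∥ at n z ∥² ℚ.+ ∥ at n z ∥²               <⟨ ℚ.+-mono-< (below n N≤n) (below n N≤n) ⟩
    ε ℚ.* ε ℚ.+ ε ℚ.* ε                       ≤⟨ ≤-+ʳ (ℚ.<⇒≤ (+-pos (*-pos 0<ε 0<ε) (*-pos 0<ε 0<ε))) ⟩
    ε ℚ.* ε ℚ.+ ε ℚ.* ε ℚ.+ (ε ℚ.* ε ℚ.+ ε ℚ.* ε)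
      ≡⟨ solve 1 (λ e → e :* e :+ e :* e :+ (e :* e :+ e :* e) := (e :+ e) :* (e :+ e)) refl ε ⟩
    (ε ℚ.+ ε) ℚ.* (ε ℚ.+ ε)                   ∎))
  where
  open ℚ.≤-Reasoning
  open +-*-Solver
  0<2ε = +-pos 0<ε 0<ε
  below : ∀ n → N ℕ.≤ n → ∥ at n z ∥² ℚ.< ε ℚ.* ε
  below n N≤n = ℚ.≤-<-trans (≤-+ʳ (ℚ.<⇒≤ 0<δ)) (p n N≤n)

-- With δ eventually below r and η = δ / 2, the sum η² + η² is at most δ² < r². The second η² is the
-- gap that `_<ᵣ_` demands.
≺⇒∣∣< : ∀ {r} → 0ᵣ <ᵣ r → ∃ λ ρ → 0ℚ ℚ.< ρ × (∀ {z} → z ≺ ρ → ∣ z ∣< r)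
≺⇒∣∣< {r} (δ , 0<δ , N , p) = η , half-pos 0<δ , λ {z} z≺η →
    η ℚ.* η , *-pos (half-pos 0<δ) (half-pos 0<δ) ,
    eventually-zip (λ {n} → step {z} {n}) (_≺_.bound z≺η) (N , p)
  where
  open ℚ.≤-Reasoning
  open +-*-Solver
  η = ½ ℚ.* δ
  0≤η² = ℚ.<⇒≤ (*-pos (half-pos 0<δ) (half-pos 0<δ))
  step : ∀ {z n} → ∥ at n z ∥ ℚ.< η → 0ℚ ℚ.+ δ ℚ.< seq r n →
         seq ∣ z ∣² n ℚ.+ η ℚ.* η ℚ.< seq r n ℚ.* seq r n
  step {z} {n} z<η δ<r = begin-strict
    ∥ at n z ∥² ℚ.+ η ℚ.* η
      ≤⟨ ℚ.+-monoˡ-≤ (η ℚ.* η) (∥∥²≤∥∥*∥∥ (at n z)) ⟩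
    ∥ at n z ∥ ℚ.* ∥ at n z ∥ ℚ.+ η ℚ.* η
      <⟨ ℚ.+-monoˡ-< (η ℚ.* η) (square-mono-< (∥∥-nonNeg (at n z)) z<η) ⟩
    η ℚ.* η ℚ.+ η ℚ.* η
      ≤⟨ ≤-+ʳ (ℚ.+-mono-≤ {0ℚ} {η ℚ.* η} {0ℚ} {η ℚ.* η} 0≤η² 0≤η²) ⟩
    η ℚ.* η ℚ.+ η ℚ.* η ℚ.+ (η ℚ.* η ℚ.+ η ℚ.* η)
      ≡⟨ solve 1 (λ e → e :* e :+ e :* e :+ (e :* e :+ e :* e) := (e :+ e) :* (e :+ e)) refl η ⟩
    (η ℚ.+ η) ℚ.* (η ℚ.+ η)
      ≡⟨ cong₂ ℚ._*_ (half+half δ) (half+half δ) ⟩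
    δ ℚ.* δ
      <⟨ square-mono-< (ℚ.<⇒≤ 0<δ) (subst (ℚ._< seq r n) (ℚ.+-identityˡ δ) δ<r) ⟩
    seq r n ℚ.* seq r n ∎

-- A version of `Near0` with a rational radius and the ℓ¹ norm, so that neighbourhoods intersect by
-- taking the smaller radius.
NearZero : (ℂ → Set) → Set
NearZero P = ∃ λ ρ → 0ℚ ℚ.< ρ × (∀ t → t ≺ ρ → P t)

Near0⇒NearZero : ∀ {P} → Near0 P → NearZero P
Near0⇒NearZero {P} (r , 0<r , p) =
  let ρ , 0<ρ , q = ≺⇒∣∣< {r} 0<r in ρ , 0<ρ , λ t t≺ρ → p t (q {t} t≺ρ)

NearZero⇒Near0 : ∀ {P} → NearZero P → Near0 P
NearZero⇒Near0 {P} (ρ , 0<ρ , p) = fromℚ (½ ℚ.* ρ) , fromℚ-pos (half-pos 0<ρ) , λ t ∣t∣< →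
  p t (subst (t ≺_) (half+half ρ) (∣∣<⇒≺ {t} (half-pos 0<ρ) ∣t∣<))

NearZero-× : ∀ {P Q} → NearZero P → NearZero Q → NearZero λ t → P t × Q t
NearZero-× (ρ , 0<ρ , p) (σ , 0<σ , q) = ρ ℚ.⊓ σ , ⊓-pos 0<ρ 0<σ , λ t t≺ →
  p t (≺-weaken (ℚ.p⊓q≤p ρ σ) t≺) , q t (≺-weaken (ℚ.p⊓q≤q ρ σ) t≺)

NearZero-neg : ∀ {P} → NearZero P → NearZero λ t → P (- t)
NearZero-neg (ρ , 0<ρ , p) = ρ , 0<ρ , λ t t≺ρ → p (- t) (≺-neg {t} t≺ρ)

NearZero-map : ∀ {P Q : ℂ → Set} → (∀ t → P t → Q t) → NearZero P → NearZero Q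
NearZero-map f (ρ , 0<ρ , p) = ρ , 0<ρ , λ t t≺ρ → f t (p t t≺ρ)

⟶⇒↦ : ∀ {s l} → s ⟶ l → s ↦ l
⟶⇒↦ {s} {l} p = mk↦ λ {ε} 0<ε →
  let N , q = p (fromℚ (½ ℚ.* ε)) (fromℚ-pos (half-pos 0<ε))
  in N , λ n N≤n → subst (s n - l ≺_) (half+half ε) (∣∣<⇒≺ {s n - l} (half-pos 0<ε) (q n N≤n))

∣-∣<⇒< : ∀ p q {ε} → ℚ.∣ p ℚ.- q ∣ ℚ.< ε → p ℚ.< q ℚ.+ ε
∣-∣<⇒< p q {ε} r = subst (ℚ._< q ℚ.+ ε) (solve 2 (λ p q → q :+ (p :- q) := p) refl p q)
  (ℚ.+-monoʳ-< q (ℚ.≤-<-trans (p≤∣p∣ (p ℚ.- q)) r))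
  where open +-*-Solver

-- `_≤ᵣ_` is a negation, yet it yields positive information because rationals can be compared: a
-- failure at one late index would persist, with a gap of ε / 2 after two Cauchy errors of ε / 4,
-- and prove y <ᵣ x.
≤ᵣ-eventually : ∀ x y → x ≤ᵣ y → ∀ {ε} → 0ℚ ℚ.< ε → Eventually λ n → seq x n ℚ.< seq y n ℚ.+ ε
≤ᵣ-eventually x y x≤y {ε} 0<ε = N ℕ.⊔ M , close
  where
  open ℚ.≤-Reasoning
  open +-*-Solver
  h = ½ ℚ.* ε
  k = ½ ℚ.* h
  0<h : 0ℚ ℚ.< h
  0<h = half-pos 0<ε
  N = proj₁ (cauchy x k (half-pos 0<h))
  M = proj₁ (cauchy y k (half-pos 0<h))
  close : ∀ n → N ℕ.⊔ M ℕ.≤ n → seq x n ℚ.< seq y n ℚ.+ ε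
  close n le with seq x n ℚ.<? seq y n ℚ.+ ε
  ... | yes r = r
  ... | no  r = contradiction (h , 0<h , N ℕ.⊔ M , λ m le′ → below m le′) x≤y
    where
    below : ∀ m → N ℕ.⊔ M ℕ.≤ m → seq y m ℚ.+ h ℚ.< seq x m
    below m le′ = begin-strict
      seq y m ℚ.+ h
        <⟨ ℚ.+-monoˡ-< h (∣-∣<⇒< (seq y m) (seq y n)
             (proj₂ (cauchy y k (half-pos 0<h)) m n (ℕ.m⊔n≤o⇒n≤o N M le′) (ℕ.m⊔n≤o⇒n≤o N M le))) ⟩
      seq y n ℚ.+ k ℚ.+ h
        ≡⟨ solve 2 (λ y e → y :+ con ½ :* (con ½ :* e) :+ con ½ :* e := (y :+ e) :- con ½ :* (con ½ :* e)) refl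
             (seq y n) ε ⟩
      (seq y n ℚ.+ ε) ℚ.- k
        ≤⟨ ℚ.+-monoˡ-≤ (ℚ.- k) (ℚ.≮⇒≥ r) ⟩
      seq x n ℚ.- k
        <⟨ ℚ.+-monoˡ-< (ℚ.- k) (∣-∣<⇒< (seq x n) (seq x m)
             (proj₂ (cauchy x k (half-pos 0<h)) n m (ℕ.m⊔n≤o⇒m≤o N M le) (ℕ.m⊔n≤o⇒m≤o N M le′))) ⟩
      seq x m ℚ.+ k ℚ.- k
        ≡⟨ solve 2 (λ x k → x :+ k :- k := x) refl (seq x m) k ⟩
      seq x m ∎

∣∣≤⇒≺ : ∀ {z w ρ} → ∣ z ∣≤ 1ᵣ ·∣ w ∣ → w ≺ ρ → z ≺ ρ ℚ.+ ρ
∣∣≤⇒≺ {z} {w} {ρ} z≤w w≺ρ = mk≺ (eventually-zip (λ {n} → step {n}) (_≺_.bound w≺ρ)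
    -- The slack ρ² makes |z|² < 2 ρ², hence ∥ z ∥² < 4 ρ².
    (≤ᵣ-eventually (∣ z ∣²) ((1ᵣ *ᵣ 1ᵣ) *ᵣ ∣ w ∣²) z≤w (*-pos 0<ρ 0<ρ)))
  where
  open ℚ.≤-Reasoning
  open +-*-Solver
  0<ρ = ≺-positive w≺ρ
  step : ∀ {n} → ∥ at n w ∥ ℚ.< ρ → ∥ at n z ∥² ℚ.< (1ℚ ℚ.* 1ℚ) ℚ.* ∥ at n w ∥² ℚ.+ ρ ℚ.* ρ →
         ∥ at n z ∥ ℚ.< ρ ℚ.+ ρ
  step {n} w<ρ z² = square-cancel-< (ℚ.<⇒≤ (+-pos 0<ρ 0<ρ)) (begin-strict
      ∥ at n z ∥ ℚ.* ∥ at n z ∥   ≤⟨ ∥∥*∥∥≤2∥∥² (at n z) ⟩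
      ∥ at n z ∥² ℚ.+ ∥ at n z ∥² <⟨ ℚ.+-mono-< below below ⟩
      (ρ ℚ.* ρ ℚ.+ ρ ℚ.* ρ) ℚ.+ (ρ ℚ.* ρ ℚ.+ ρ ℚ.* ρ)
        ≡⟨ solve 1 (λ e → (e :* e :+ e :* e) :+ (e :* e :+ e :* e) := (e :+ e) :* (e :+ e)) refl ρ ⟩
      (ρ ℚ.+ ρ) ℚ.* (ρ ℚ.+ ρ) ∎)
    where
    below : ∥ at n z ∥² ℚ.< ρ ℚ.* ρ ℚ.+ ρ ℚ.* ρ
    below = begin-strict
      ∥ at n z ∥²                                     <⟨ z² ⟩
      (1ℚ ℚ.* 1ℚ) ℚ.* ∥ at n w ∥² ℚ.+ ρ ℚ.* ρ         ≡⟨ cong (ℚ._+ ρ ℚ.* ρ) (ℚ.*-identityˡ ∥ at n w ∥²) ⟩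
      ∥ at n w ∥² ℚ.+ ρ ℚ.* ρ                         ≤⟨ ℚ.+-monoˡ-≤ (ρ ℚ.* ρ) (∥∥²≤∥∥*∥∥ (at n w)) ⟩
      ∥ at n w ∥ ℚ.* ∥ at n w ∥ ℚ.+ ρ ℚ.* ρ           <⟨ ℚ.+-monoˡ-< (ρ ℚ.* ρ) (square-mono-< (∥∥-nonNeg (at n w)) w<ρ) ⟩
      ρ ℚ.* ρ ℚ.+ ρ ℚ.* ρ                             ∎

ContinuousAt0 : (ℂ → ℂ) → Set
ContinuousAt0 f = ∀ {ε} → 0ℚ ℚ.< ε → NearZero λ t → f t - f 0ℂ ≺ ε

differentiable⇒continuous : ∀ {f d} → HasDerivAt f d 0ℂ → ContinuousAt0 f
differentiable⇒continuous {f} {d} f′ {ε} 0<ε = ρ , 0<ρ , λ t t≺ρ →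
    let t-0≺ρ : t - 0ℂ ≺ ρ
        t-0≺ρ = ≺-resp {t} t≺ρ (λ j → solve 1 (λ x → x := x :- con (real 0ℚ)) refl (at j t))
    in ≺-weaken bound≤ε (≺-resp
      (≺-+ {(f t - f 0ℂ) - d * (t - 0ℂ)} {d * (t - 0ℂ)}
        (∣∣≤⇒≺ {(f t - f 0ℂ) - d * (t - 0ℂ)} {t - 0ℂ}
          (approx t (q {t - 0ℂ} (≺-weaken (ℚ.p⊓q≤p ρ₀ ρ₁) t-0≺ρ))) t-0≺ρ)
        (≺-* {d} {t - 0ℂ} d≺D t-0≺ρ))
      (λ j → solve 3 (λ x y z → ((x :- y) :- z) :+ z := x :- y) refl
        (at j (f t)) (at j (f 0ℂ)) (at j (d * (t - 0ℂ)))))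
  where
  open 𝔾-Solver
  D = proj₁ (≺-bounded d)
  0<D = proj₁ (proj₂ (≺-bounded d))
  d≺D = proj₂ (proj₂ (≺-bounded d))
  δ = f′ 1ᵣ (fromℚ-pos (ℚ.positive⁻¹ 1ℚ))
  approx = proj₂ (proj₂ δ)
  ρ₀ = proj₁ (≺⇒∣∣< {proj₁ δ} (proj₁ (proj₂ δ)))
  q = λ {z} → proj₂ (proj₂ (≺⇒∣∣< {proj₁ δ} (proj₁ (proj₂ δ)))) {z}
  -- With tolerance 1 in the derivative, the remainder is below 2 ρ and the linear part below D ρ.
  E = 1ℚ ℚ.+ 1ℚ ℚ.+ D
  0<E : 0ℚ ℚ.< E
  0<E = +-pos (ℚ.positive⁻¹ (1ℚ ℚ.+ 1ℚ)) 0<D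
  ρ₁ = ε ℚ.* inv E
  ρ = ρ₀ ℚ.⊓ ρ₁
  0<ρ : 0ℚ ℚ.< ρ
  0<ρ = ⊓-pos (proj₁ (proj₂ (≺⇒∣∣< {proj₁ δ} (proj₁ (proj₂ δ))))) (*-pos 0<ε (inv-pos 0<E))
  bound≤ε : (ρ ℚ.+ ρ) ℚ.+ D ℚ.* ρ ℚ.≤ ε
  bound≤ε = begin
    (ρ ℚ.+ ρ) ℚ.+ D ℚ.* ρ
      ≡⟨ S.solve 2 (λ r D → (r S.:+ r) S.:+ D S.:* r S.:= (S.con 1ℚ S.:+ S.con 1ℚ S.:+ D) S.:* r) refl ρ D ⟩
    E ℚ.* ρ
      ≤⟨ *-monoʳ (ℚ.<⇒≤ 0<E) (ℚ.p⊓q≤q ρ₀ ρ₁) ⟩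
    E ℚ.* (ε ℚ.* inv E)
      ≡⟨ S.solve 3 (λ x e i → x S.:* (e S.:* i) S.:= e S.:* (x S.:* i)) refl E ε (inv E) ⟩
    ε ℚ.* (E ℚ.* inv E)
      ≡⟨ cong (ε ℚ.*_) (inv-inverse 0<E) ⟩
    ε ℚ.* 1ℚ
      ≡⟨ ℚ.*-identityʳ ε ⟩
    ε ∎
    where
    open ℚ.≤-Reasoning
    module S = +-*-Solver

holomorphic⇒continuous : ∀ {f} → HolomorphicAt0 f → ContinuousAt0 f
holomorphic⇒continuous {f} hol 0<ε =
  let ρ , 0<ρ , p = Near0⇒NearZero hol
      d , f′ = p 0ℂ (≺-zero 0<ρ)
  in differentiable⇒continuous {f} {d} f′ 0<ε

-- Invertible complex numbers

*-inverse : ∀ z (z#0 : z #0) → z * inverse z z#0 ≋ 1ℂ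
-- Before `N` an approximation of |z|² may be 0, where `inv` takes the default value 0; the identity
-- is only eventual and `≡⇒≋` does not apply.
*-inverse z (δ , 0<δ , N , p) = from-bounds λ 0<ε → N , λ n N≤n →
  subst (ℚ._< _) (cong ∥_∥ (sym (eq n (ℚ.<-trans 0<δ
    (subst (ℚ._< ∥ at n z ∥²) (ℚ.+-identityˡ δ) (p n N≤n)))))) 0<ε
  where
  open +-*-Solver
  eq : ∀ n → 0ℚ ℚ.< ∥ at n z ∥² → at n (z * inverse z (δ , 0<δ , N , p)) ⊞ ⊟ at n 1ℂ ≡ real 0ℚ
  eq n 0<∥z∥² = cong₂ _,_
    (trans (solve 3 (λ a b i → (a :* (a :* i) :+ :- (b :* (:- b :* i))) :+ :- con 1ℚ
                     := (a :* a :+ b :* b) :* i :- con 1ℚ) refl a b i)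
      (trans (cong (ℚ._- 1ℚ) (inv-inverse 0<∥z∥²)) (ℚ.+-inverseʳ 1ℚ)))
    (solve 3 (λ a b i → (a :* (:- b :* i) :+ b :* (a :* i)) :+ :- con 0ℚ := con 0ℚ) refl a b i)
    where
    a = seq (re z) n
    b = seq (im z) n
    i = inv (∥ at n z ∥²)

near-1⇒#0 : ∀ {v} → v - 1ℂ ≺ ½ → v #0
near-1⇒#0 {v} (mk≺ (N , p)) = ¼ , *-pos (ℚ.positive⁻¹ ½) (ℚ.positive⁻¹ ½) , N , λ n N≤n → below n (p n N≤n)
  where
  open ℚ.≤-Reasoning
  open +-*-Solver
  below : ∀ n → ∥ at n (v - 1ℂ) ∥ ℚ.< ½ → 0ℚ ℚ.+ ¼ ℚ.< seq ∣ v ∣² n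
  below n r = begin-strict
    0ℚ ℚ.+ ¼ ≡⟨ ℚ.+-identityˡ ¼ ⟩
    ½ ℚ.* ½  <⟨ square-mono-< (ℚ.<⇒≤ (ℚ.positive⁻¹ ½)) ½<a ⟩
    a ℚ.* a  ≤⟨ ≤-+ʳ (square-nonNeg b) ⟩
    a ℚ.* a ℚ.+ b ℚ.* b ∎
    where
    a = seq (re v) n
    b = seq (im v) n
    1<a+½ : 1ℚ ℚ.< a ℚ.+ ½
    1<a+½ = ∣-∣<⇒< 1ℚ a (subst (ℚ._< ½) (dist-sym a 1ℚ)
      (ℚ.≤-<-trans (≤-+ʳ {ℚ.∣ a ℚ.- 1ℚ ∣} (ℚ.0≤∣p∣ (b ℚ.+ ℚ.- 0ℚ))) r))
    ½<a : ½ ℚ.< a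
    ½<a = subst (½ ℚ.<_) (solve 1 (λ a → (a :+ con ½) :- con ½ := a) refl a) (ℚ.+-monoˡ-< (ℚ.- ½) 1<a+½)

Invertible : ℂ → Set
Invertible z = ∃ λ y → y * z ≋ 1ℂ

invertible : ∀ v w → v * w ≋ 1ℂ → Invertible v
invertible v w eq = w , ≋-trans (*-comm w v) eq

near-1⇒invertible : ∀ {v} → v - 1ℂ ≺ ½ → Invertible v
near-1⇒invertible {v} v≺ = let v#0 = near-1⇒#0 {v} v≺ in invertible v (inverse v v#0) (*-inverse v v#0)

*-invertibleʳ : ∀ i z → Invertible (i * z) → Invertible z
*-invertibleʳ i z (w , eq) = w * i ,
  ≋-trans (≡⇒≋ λ j → CommutativeRing.*-assoc 𝔾-ring (at j w) (at j i) (at j z)) eq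

-- Multiplying by the inverse i of f(0) moves the values close to 1: i f(t) - 1 splits into i (f(t)
-- - f(0)) and f(0) i - 1, each below ¼.
invertible-near-0 : ∀ {f i} → ContinuousAt0 f → f 0ℂ * i ≋ 1ℂ → NearZero λ t → Invertible (f t)
invertible-near-0 {f} {i} cont f0*i≋1 =
  let B , 0<B , i≺B = ≺-bounded i
      ρ , 0<ρ , p = cont (*-pos (half-pos (ℚ.positive⁻¹ ½)) (inv-pos 0<B))
  in ρ , 0<ρ , λ t t≺ρ → *-invertibleʳ i (f t) (near-1⇒invertible {i * f t} (≺-resp
       (≺-halves {i * (f t - f 0ℂ)} {f 0ℂ * i - 1ℂ} (≺-scale {f t - f 0ℂ} {i} i≺B 0<B (p t t≺ρ))
         (diff {f 0ℂ * i} {1ℂ} f0*i≋1 (half-pos (ℚ.positive⁻¹ ½))))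
       (λ j → solve 4 (λ i x y o → i :* (x :- y) :+ (y :* i :- o) := i :* x :- o) refl
         (at j i) (at j (f t)) (at j (f 0ℂ)) (at j 1ℂ))))
  where open 𝔾-Solver

open SetoidReasoning ℂ-setoid

-- The functional equation

cancelˡ : ∀ {z a b} → Invertible z → z * a ≋ z * b → a ≋ b
cancelˡ {z} {a} {b} (y , y*z≋1) eq = begin
  a            ≈⟨ ≋-sym (unit a) ⟩
  y * z * a    ≈⟨ ≡⇒≋ (λ j → *-assoc (at j y) (at j z) (at j a)) ⟩
  y * (z * a)  ≈⟨ *-congˡ {z * a} {z * b} y eq ⟩
  y * (z * b)  ≈⟨ ≋-sym (≡⇒≋ λ j → *-assoc (at j y) (at j z) (at j b)) ⟩
  y * z * b    ≈⟨ unit b ⟩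
  b            ∎
  where
  open CommutativeRing 𝔾-ring using (*-assoc; *-identityˡ)
  unit : ∀ x → y * z * x ≋ x
  unit x = ≋-trans (*-cong {y * z} {1ℂ} {x} {x} y*z≋1 ≋-refl) (≡⇒≋ λ j → *-identityˡ (at j x))

*-invertible : ∀ {z w} → Invertible z → Invertible w → Invertible (z * w)
*-invertible {z} {w} (y , p) (x , q) = y * x , (begin
  y * x * (z * w)    ≈⟨ ≡⇒≋ (λ j → solve 4 (λ y x z w → y :* x :* (z :* w) := y :* z :* (x :* w)) refl
                          (at j y) (at j x) (at j z) (at j w)) ⟩
  y * z * (x * w)    ≈⟨ *-cong {y * z} {1ℂ} {x * w} {1ℂ} p q ⟩
  1ℂ * 1ℂ            ≈⟨ ≡⇒≋ (λ _ → refl) ⟩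
  1ℂ                 ∎)
  where open 𝔾-Solver

exp-invertible : ∀ z → Invertible (exp z)
exp-invertible z = invertible (exp z) (exp (- z)) (exp-neg z)

at-*-^ : ∀ {x} y z → (∀ j → at j x ≡ at j y ⊠ at j z) → ∀ n j → at j (x ^ n) ≡ at j (y ^ n) ⊠ at j (z ^ n)
at-*-^ y z eq zero    j = refl
at-*-^ {x} y z eq (suc n) j = trans (cong₂ _⊠_ (eq j) (at-*-^ {x} y z eq n j))
  (solve 4 (λ y z s p → (y :* z) :* (s :* p) := (y :* s) :* (z :* p)) refl
    (at j y) (at j z) (at j (y ^ n)) (at j (z ^ n)))
  where open 𝔾-Solver

at-neg-^ : ∀ t n j → at j ((- t) ^ n) ≡ at j ((- 1ℂ) ^ n) ⊠ at j (t ^ n)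
at-neg-^ t = at-*-^ { - t} (- 1ℂ) t λ j → solve 1 (λ x → :- x := (:- con (real 1ℚ)) :* x) refl (at j t)
  where open 𝔾-Solver

scaledTerm : (ℕ → ℂ) → (ℕ → ℂ) → ℂ → ℕ → ℂ
scaledTerm u c t n = u n * (t ^ n * c n)

Expands : (ℕ → ℂ) → (ℕ → ℂ) → (ℂ → ℂ) → Set
Expands u c F = NearZero λ t → partialSum (scaledTerm u c t) ↦ F t

-- Meant for u(n) = P_n(a - x) and v(n) = P_n(x). As (- t)ⁿ = (- 1)ⁿ tⁿ, the series of F at t and of
-- G at - t agree term by term, and limits are unique.
symmetric⇒functional : ∀ {u v c F G} → Expands u c F → Expands v c G →
  (∀ n → u n ≋ (- 1ℂ) ^ n * v n) → NearZero λ t → F t ≋ G (- t)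
symmetric⇒functional {u} {v} {c} {F} {G} uF vG eq =
  NearZero-map (λ t (p , q) → ↦-unique {partialSum (scaledTerm u c t)} p
      (↦-resp {partialSum (scaledTerm v c (- t))}
        (partialSum-cong {scaledTerm v c (- t)} {scaledTerm u c t} (terms t)) q))
    (NearZero-× uF (NearZero-neg vG))
  where
  open 𝔾-Solver
  reorder : ∀ v c s p {q} → q ≡ s ⊠ p → v ⊠ (q ⊠ c) ≡ (s ⊠ v) ⊠ (p ⊠ c)
  reorder v c s p refl = solve 4 (λ v c s p → v :* (s :* p :* c) := (s :* v) :* (p :* c)) refl v c s p
  terms : ∀ t n → v n * ((- t) ^ n * c n) ≋ u n * (t ^ n * c n)
  terms t n = begin
    v n * ((- t) ^ n * c n)
      ≈⟨ ≡⇒≋ (λ j → reorder (at j (v n)) (at j (c n)) (at j ((- 1ℂ) ^ n)) (at j (t ^ n))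
           {at j ((- t) ^ n)} (at-neg-^ t n j)) ⟩
    (- 1ℂ) ^ n * v n * (t ^ n * c n)
      ≈⟨ *-cong {(- 1ℂ) ^ n * v n} {u n} {t ^ n * c n} {t ^ n * c n} (≋-sym (eq n)) ≋-refl ⟩
    u n * (t ^ n * c n) ∎

at-partialSum-sub : ∀ a b {d} → (∀ n j → at j (d n) ≡ at j (a n) ⊞ ⊟ at j (b n)) → ∀ n j →
  at j (partialSum d n) ≡ at j (partialSum a n) ⊞ ⊟ at j (partialSum b n)
at-partialSum-sub a b eq zero    j = refl
at-partialSum-sub a b eq (suc n) j = trans
  (cong₂ _⊞_ (at-partialSum-sub a b eq n j) (eq n j))
  (solve 4 (λ x y S T → (S :- T) :+ (x :- y) := (S :+ x) :- (T :+ y)) refl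
    (at j (a n)) (at j (b n)) (at j (partialSum a n)) (at j (partialSum b n)))
  where open 𝔾-Solver

rational-≺ : ∀ {q ρ} → 0ℚ ℚ.< q → q ℚ.≤ ½ ℚ.* ρ → 0ℚ ℚ.< ρ → rational q ≺ ρ
rational-≺ {q} {ρ} 0<q q≤½ρ 0<ρ = mk≺ (0 , λ _ _ → subst (ℚ._< ρ) (sym (∥∥-real (ℚ.<⇒≤ 0<q)))
  (ℚ.≤-<-trans q≤½ρ (subst (½ ℚ.* ρ ℚ.<_) (half+half ρ)
    (subst (ℚ._< ½ ℚ.* ρ ℚ.+ ½ ℚ.* ρ) (ℚ.+-identityʳ (½ ℚ.* ρ)) (ℚ.+-monoʳ-< (½ ℚ.* ρ) (half-pos 0<ρ))))))

≋-sub : ∀ {a b} → a ≋ b → a - b ≋ 0ℂ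
≋-sub {a} {b} eq = ≋-trans (+-cong {a} {b} { - b} { - b} eq ≋-refl)
  (≡⇒≋ λ j → CommutativeRing.-‿inverseʳ 𝔾-ring (at j b))

sub-≋ : ∀ {a b} → a - b ≋ 0ℂ → a ≋ b
sub-≋ {a} {b} eq = begin
  a             ≈⟨ ≡⇒≋ (λ j → solve 2 (λ a b → a := (a :- b) :+ b) refl (at j a) (at j b)) ⟩
  (a - b) + b   ≈⟨ +-cong {a - b} {0ℂ} {b} {b} eq ≋-refl ⟩
  0ℂ + b        ≈⟨ ≡⇒≋ (λ j → CommutativeRing.+-identityˡ 𝔾-ring (at j b)) ⟩
  b             ∎
  where open 𝔾-Solver

-- The difference of the two series is a power series in t that vanishes at all small t, so its
-- coefficients are 0; cancelling the invertible c(n) gives the symmetry.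
functional⇒symmetric : ∀ {u v c F G} → (∀ n → Invertible (c n)) → Expands u c F → Expands v c G →
  (NearZero λ t → F t ≋ G (- t)) → ∀ n → u n ≋ (- 1ℂ) ^ n * v n
functional⇒symmetric {u} {v} {c} {F} {G} c⁻¹ uF vG eq n =
  sub-≋ {u n} {(- 1ℂ) ^ n * v n} (cancelˡ {c n} (c⁻¹ n) (≋-trans
    (≋-trans (*-comm (c n) (u n - (- 1ℂ) ^ n * v n)) (coefficients≋0 {½ ℚ.* ρ} {d} (half-pos 0<ρ) vanishes n))
    (≋-sym (≡⇒≋ λ j → CommutativeRing.zeroʳ 𝔾-ring (at j (c n))))))
  where
  open 𝔾-Solver
  near = NearZero-× uF (NearZero-× (NearZero-neg vG) eq)
  ρ = proj₁ near
  0<ρ = proj₁ (proj₂ near)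
  d : ℕ → ℂ
  d n = (u n - (- 1ℂ) ^ n * v n) * c n
  reorder : ∀ u v c s p {q} → q ≡ s ⊠ p → (u ⊞ ⊟ (s ⊠ v)) ⊠ c ⊠ p ≡ u ⊠ (p ⊠ c) ⊞ ⊟ (v ⊠ (q ⊠ c))
  reorder u v c s p refl =
    solve 5 (λ u v c s p → (u :- s :* v) :* c :* p := u :* (p :* c) :- v :* (s :* p :* c)) refl u v c s p
  difference : ∀ t → partialSum (scaledTerm u c t) ↦ F t → partialSum (scaledTerm v c (- t)) ↦ G (- t) →
    F t ≋ G (- t) → partialSum (powerTerm d t) ↦ 0ℂ
  difference t p q F≋G = ↦-respʳ {partialSum (powerTerm d t)} {F t - G (- t)} {0ℂ} (≋-sub {F t} {G (- t)} F≋G)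
    (↦-resp {λ n → partialSum (scaledTerm u c t) n - partialSum (scaledTerm v c (- t)) n}
      {partialSum (powerTerm d t)}
      (λ n → ≋-sym (≡⇒≋ λ j → at-partialSum-sub (scaledTerm u c t) (scaledTerm v c (- t)) {powerTerm d t}
        (λ k j → reorder (at j (u k)) (at j (v k)) (at j (c k)) (at j ((- 1ℂ) ^ k)) (at j (t ^ k))
          {at j ((- t) ^ k)} (at-neg-^ t k j)) n j))
      (↦-+ {partialSum (scaledTerm u c t)} {λ n → - partialSum (scaledTerm v c (- t)) n} {F t} { - G (- t)}
        p (↦-neg {partialSum (scaledTerm v c (- t))} {G (- t)} q)))
  -- Half the radius, since the norm of q ≤ ½ ρ must stay strictly below ρ.
  vanishes : VanishesUpTo (½ ℚ.* ρ) d
  vanishes q 0<q q≤ = let p , r , F≋G = proj₂ (proj₂ near) (rational q) (rational-≺ 0<q q≤ 0<ρ)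
    in difference (rational q) p r F≋G

-- Multiplying by exp(u) turns the hypothesis into exp(u + v) = 1; the bound 1/8 on each of u and v
-- keeps their sum below ¼.
exp-injective : ∀ {u v} → u ≺ ½ ℚ.* ¼ → v ≺ ½ ℚ.* ¼ → exp (- u) ≋ exp v → v ≋ - u
exp-injective {u} {v} small small′ eq = begin
  v                ≈⟨ ≡⇒≋ (λ j → solve 2 (λ u v → v := (u :+ v) :- u) refl (at j u) (at j v)) ⟩
  (u + v) - u      ≈⟨ +-cong {u + v} {0ℂ} { - u} { - u} u+v≋0 ≋-refl ⟩
  0ℂ - u           ≈⟨ ≡⇒≋ (λ j → CommutativeRing.+-identityˡ 𝔾-ring (at j (- u))) ⟩
  - u              ∎
  where
  open 𝔾-Solver
  u+v≋0 : u + v ≋ 0ℂ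
  u+v≋0 = exp-injective-at-0 {u + v} (≺-halves {u} {v} small small′) (begin
    exp (u + v)         ≈⟨ exp-+ u v ⟩
    exp u * exp v       ≈⟨ *-congˡ {exp v} {exp (- u)} (exp u) (≋-sym eq) ⟩
    exp u * exp (- u)   ≈⟨ exp-neg u ⟩
    1ℂ                  ∎)

*-assoc : ∀ x y z → x * y * z ≋ x * (y * z)
*-assoc x y z = ≡⇒≋ λ j → CommutativeRing.*-assoc 𝔾-ring (at j x) (at j y) (at j z)

-- x u = H u + (x - H) u. The second summand is passed as `y`, so that callers can supply it in
-- simplified form.
factor : ∀ c H x u {y} → (∀ j → at j ((x - H) * u) ≡ at j y) → c * exp (x * u) ≋ c * exp (H * u) * exp y
factor c H x u {y} eq = begin
  c * exp (x * u)
    ≈⟨ *-congˡ {exp (x * u)} {exp (H * u) * exp y} c (≋-trans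
         (exp-cong {x * u} {H * u + y} (≡⇒≋ λ j → split (at j x) (at j H) (at j u) {at j y} (eq j)))
         (exp-+ (H * u) y)) ⟩
  c * (exp (H * u) * exp y)
    ≈⟨ ≋-sym (*-assoc c (exp (H * u)) (exp y)) ⟩
  c * exp (H * u) * exp y ∎
  where
  open 𝔾-Solver
  split : ∀ x h u {y} → (x ⊞ ⊟ h) ⊠ u ≡ y → x ⊠ u ≡ h ⊠ u ⊞ y
  split x h u refl = solve 3 (λ x h u → x :* u := h :* u :+ (x :- h) :* u) refl x h u

-- To be applied to F x t = f t * exp (x * g t).
module Symmetry
  (F : ℂ → ℂ → ℂ) (g : ℂ → ℂ) (A H : ℂ)
  (A≡H+H : ∀ j → at j A ≡ at j H ⊞ at j H)
  (F-cong : ∀ x y t → (∀ j → at j x ≡ at j y) → F x t ≋ F y t)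
  (F-factor : ∀ x y t → (∀ j → at j ((x - H) * g t) ≡ at j y) → F x t ≋ F H t * exp y)
  where

  FunctionalEquation : ℂ → Set
  FunctionalEquation x = NearZero λ t → F (A - x) t ≋ F x (- t)

  -- `H` is the fixed point of x ↦ A - x.
  functional⇒even : FunctionalEquation H → NearZero λ t → F H (- t) ≋ F H t
  functional⇒even = NearZero-map λ t eq → ≋-sym (≋-trans
    (F-cong H (A - H) t λ j → reflect (at j H) (A≡H+H j)) eq)
    where
    open 𝔾-Solver
    reflect : ∀ h {a} → a ≡ h ⊞ h → h ≡ a ⊞ ⊟ h
    reflect h refl = solve 1 (λ h → h := (h :+ h) :- h) refl h

  -- At x = H + 1 the exponents ((A - x) - H) g(t) and (x - H) g(- t) become - g(t) and g(- t), the
  -- form that `exp-injective` compares.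
  functional⇒odd : ContinuousAt0 g → g 0ℂ ≋ 0ℂ → (NearZero λ t → Invertible (F H t)) →
    FunctionalEquation H → FunctionalEquation (H + 1ℂ) → NearZero λ t → g (- t) ≋ - g t
  functional⇒odd cont g0 F⁻¹ eqH eqH+1 = NearZero-map
    (λ t (((small , small⁻) , inv) , (even , eq)) → odd t small small⁻ inv even eq)
    (NearZero-× (NearZero-× (NearZero-× g-small (NearZero-neg g-small)) F⁻¹)
      (NearZero-× (functional⇒even eqH) eqH+1))
    where
    open 𝔾-Solver
    -- Half of the bound 1/8 in `exp-injective`, because g(t) is split as (g(t) - g(0)) + (g(0) -
    -- 0).
    1/16>0 : 0ℚ ℚ.< ½ ℚ.* (½ ℚ.* ¼)
    1/16>0 = ℚ.positive⁻¹ (½ ℚ.* (½ ℚ.* ¼))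
    g-small : NearZero λ t → g t ≺ ½ ℚ.* ¼
    g-small = NearZero-map (λ t gt → ≺-resp
      (≺-halves {g t - g 0ℂ} {g 0ℂ - 0ℂ} gt (diff {g 0ℂ} {0ℂ} g0 1/16>0))
      (λ j → solve 2 (λ x y → (x :- y) :+ (y :- con (real 0ℚ)) := x) refl (at j (g t)) (at j (g 0ℂ)))) (cont 1/16>0)
    backward : ∀ h u {a} → a ≡ h ⊞ h → ((a ⊞ ⊟ (h ⊞ real 1ℚ)) ⊞ ⊟ h) ⊠ u ≡ ⊟ u
    backward h u refl = solve 2 (λ h u → (((h :+ h) :- (h :+ con (real 1ℚ))) :- h) :* u := :- u) refl h u
    forward : ∀ h v → ((h ⊞ real 1ℚ) ⊞ ⊟ h) ⊠ v ≡ v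
    forward = solve 2 (λ h v → ((h :+ con (real 1ℚ)) :- h) :* v := v) refl
    odd : ∀ t → g t ≺ ½ ℚ.* ¼ → g (- t) ≺ ½ ℚ.* ¼ → Invertible (F H t) → F H (- t) ≋ F H t →
          F (A - (H + 1ℂ)) t ≋ F (H + 1ℂ) (- t) → g (- t) ≋ - g t
    odd t small small⁻ inv even eq = exp-injective {g t} {g (- t)} small small⁻ (cancelˡ {F H t} inv (begin
      F H t * exp (- g t)       ≈⟨ ≋-sym (F-factor (A - (H + 1ℂ)) (- g t) t
                                     λ j → backward (at j H) (at j (g t)) (A≡H+H j)) ⟩
      F (A - (H + 1ℂ)) t        ≈⟨ eq ⟩
      F (H + 1ℂ) (- t)          ≈⟨ F-factor (H + 1ℂ) (g (- t)) (- t) (λ j → forward (at j H) (at j (g (- t)))) ⟩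
      F H (- t) * exp (g (- t)) ≈⟨ *-cong {F H (- t)} {F H t} {exp (g (- t))} {exp (g (- t))} even ≋-refl ⟩
      F H t * exp (g (- t))     ∎))

  odd-even⇒functional : (NearZero λ t → g (- t) ≋ - g t) → (NearZero λ t → F H (- t) ≋ F H t) →
    ∀ x → FunctionalEquation x
  odd-even⇒functional g-odd h-even x = NearZero-map (λ t (odd , even) → begin
      F (A - x) t
        ≈⟨ F-factor (A - x) ((x - H) * - g t) t (λ j → reflect (at j x) (at j H) (at j (g t)) (A≡H+H j)) ⟩
      F H t * exp ((x - H) * - g t)
        ≈⟨ *-cong {F H t} {F H (- t)} {exp ((x - H) * - g t)} {exp ((x - H) * g (- t))} (≋-sym even)
             (exp-cong {(x - H) * - g t} {(x - H) * g (- t)} (*-congˡ { - g t} {g (- t)} (x - H) (≋-sym odd))) ⟩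
      F H (- t) * exp ((x - H) * g (- t))
        ≈⟨ ≋-sym (F-factor x ((x - H) * g (- t)) (- t) (λ _ → refl)) ⟩
      F x (- t) ∎)
    (NearZero-× g-odd h-even)
    where
    open 𝔾-Solver
    reflect : ∀ x h u {a} → a ≡ h ⊞ h → ((a ⊞ ⊟ x) ⊞ ⊟ h) ⊠ u ≡ (x ⊞ ⊟ h) ⊠ ⊟ u
    reflect x h u refl = solve 3 (λ x h u → (((h :+ h) :- x) :- h) :* u := (x :- h) :* :- u) refl x h u

  characterisation : ∀ (u : ℂ → ℕ → ℂ) c → (∀ n → Invertible (c n)) → (∀ x → Expands (u x) c (F x)) →
    ContinuousAt0 g → g 0ℂ ≋ 0ℂ → (NearZero λ t → Invertible (F H t)) →
    (∀ n x → u (A - x) n ≈ (- 1ℂ) ^ n * u x n) ⇔ (OddNear0 g × EvenNear0 (F H))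
  characterisation u c c⁻¹ expands cont g0 F⁻¹ = mk⇔
    (λ symmetric →
      let functional : ∀ x → FunctionalEquation x
          functional x = symmetric⇒functional {u (A - x)} {u x} {c} {F (A - x)} {F x}
            (expands (A - x)) (expands x) (λ n → ≈⇒≋ (symmetric n x))
      in NearZero⇒Near0 (NearZero-map (λ t → ≋⇒≈)
           (functional⇒odd cont g0 F⁻¹ (functional H) (functional (H + 1ℂ))))
       , NearZero⇒Near0 (NearZero-map (λ t → ≋⇒≈) (functional⇒even (functional H))))
    (λ (g-odd , F-even) n x → ≋⇒≈ (functional⇒symmetric {u (A - x)} {u x} {c} {F (A - x)} {F x} c⁻¹
      (expands (A - x)) (expands x)
      (odd-even⇒functional
        (NearZero-map (λ t → ≈⇒≋) (Near0⇒NearZero g-odd))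
        (NearZero-map (λ t → ≈⇒≋) (Near0⇒NearZero F-even)) x) n))

-- Application to Appell sequences

double-half : ∀ a j → at j (fromℝ a) ≡ at j (fromℝ (fromℚ ½ *ᵣ a)) ⊞ at j (fromℝ (fromℚ ½ *ᵣ a))
double-half a j = cong (_, 0ℚ) (sym (half+half (seq a j)))

appell-expands : ∀ {g φ φ#0 f P} → IsAppell g φ φ#0 f P → ∀ x →
  Expands (λ n → eval (P n) x) (λ n → inverse (prodUpTo φ n) (prodUpTo-#0 φ φ#0 n))
    (λ t → f t * exp (x * g t))
appell-expands {g} {φ} {φ#0} {f} {P} (_ , _ , series) x =
  NearZero-map (λ t p → ⟶⇒↦ p) (Near0⇒NearZero (series x))

mainTheorem1 :
    (g : ℂ → ℂ) → HolomorphicAt0 g → g 0ℂ ≈ 0ℂ →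
    (∃ λ d → HasDerivAt g d 0ℂ × d #0) →
    (φ : ℕ → ℂ) (φ#0 : ∀ n → φ n #0) (a : ℝ)
    (f : ℂ → ℂ) (P : ℕ → Polynomial) → IsAppell g φ φ#0 f P →
    let h : ℂ → ℂ
        h t = f t * exp (fromℝ (fromℚ ½ *ᵣ a) * g t)
    in (∀ n x → eval (P n) (fromℝ a - x) ≈ (- 1ℂ) ^ n * eval (P n) x)
       ⇔ (OddNear0 g × EvenNear0 h)
mainTheorem1 g g-hol g0 _ φ φ#0 a f P appell@(f-hol , f0#0 , _) = Symmetry.characterisation
  (λ x t → f t * exp (x * g t)) g (fromℝ a) (fromℝ (fromℚ ½ *ᵣ a)) (double-half a)
  (λ x y t x≡y → *-congˡ {exp (x * g t)} {exp (y * g t)} (f t) (exp-cong {x * g t} {y * g t}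
    (≡⇒≋ λ j → cong (_⊠ at j (g t)) (x≡y j))))
  (λ x y t → factor (f t) (fromℝ (fromℚ ½ *ᵣ a)) x (g t) {y})
  (λ x n → eval (P n) x) (λ n → inverse (prodUpTo φ n) (prodUpTo-#0 φ φ#0 n))
  -- The coefficients of the expansion are 1 / (φ(0) ⋯ φ(n)), so the products themselves invert
  -- them.
  (λ n → prodUpTo φ n , *-inverse (prodUpTo φ n) (prodUpTo-#0 φ φ#0 n))
  (appell-expands {g} {φ} {φ#0} {f} {P} appell)
  (holomorphic⇒continuous {g} g-hol) (≈⇒≋ g0)
  (NearZero-map (λ t f⁻¹ → *-invertible {f t} {exp (fromℝ (fromℚ ½ *ᵣ a) * g t)} f⁻¹
      (exp-invertible (fromℝ (fromℚ ½ *ᵣ a) * g t)))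
    (invertible-near-0 {f} {inverse (f 0ℂ) f0#0} (holomorphic⇒continuous {f} f-hol) (*-inverse (f 0ℂ) f0#0)))
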